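{- $F_e(3,3;4) \leq 860$. That is, there exists a $K_4$-free simple graph on $860$ vertices such that every $2$-coloring of its edges contains a monochromatic triangle.
   Context: For a simple graph $G$, $G \rightarrow (3,3)$ means that every coloring of the edges of $G$ with two colors yields a triangle ($K_3$) all of whose edges have the same color. The edge Folkman number $F_e(3,3;4)$ is the smallest number of vertices of a graph $G$ that contains no $K_4$ (complete graph on 4 vertices) and satisfies $G \rightarrow (3,3)$. -}

module Defs where

open import Data.Nat using (ℕ)
open import Data.Fin using (Fin)
open import Data.Bool using (Bool; true; false)
open import Data.Product using (Σ; ∃; _×_)
open import Relation.Binary.PropositionalEquality using (_≡_)
open import Relation.Nullary using (¬_)

record SimpleGraph (n : ℕ) : Set where
  field
    adj   : Fin n → Fin n → Bool
    sym   : ∀ x y → adj x y ≡ adj y x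
    irrefl : ∀ x → adj x x ≡ false

open SimpleGraph public

Adj : ∀ {n} → SimpleGraph n → Fin n → Fin n → Set
Adj G x y = adj G x y ≡ true

-- G contains K₄: four vertices pairwise adjacent (adjacency forces distinctness
-- since the graph is irreflexive).
HasK4 : ∀ {n} → SimpleGraph n → Set
HasK4 {n} G = Σ (Fin n) λ a → Σ (Fin n) λ b → Σ (Fin n) λ c → Σ (Fin n) λ d →
  Adj G a b × Adj G a c × Adj G a d × Adj G b c × Adj G b d × Adj G c d

K4Free : ∀ {n} → SimpleGraph n → Set
K4Free G = ¬ HasK4 G

-- A 2-colouring of the edges of G: a colour for each unordered pair, i.e. a
-- symmetric function (its values on non-edges are irrelevant).
record EdgeColouring {n : ℕ} (G : SimpleGraph n) : Set where
  field
    colour : Fin n → Fin n → Bool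
    colour-sym : ∀ x y → colour x y ≡ colour y x

open EdgeColouring public

MonoTriangle : ∀ {n} {G : SimpleGraph n} → EdgeColouring G → Set
MonoTriangle {n} {G} χ = Σ (Fin n) λ a → Σ (Fin n) λ b → Σ (Fin n) λ c →
  Adj G a b × Adj G a c × Adj G b c ×
  colour χ a b ≡ colour χ a c × colour χ a b ≡ colour χ b c

Arrows33 : ∀ {n} → SimpleGraph n → Set
Arrows33 G = (χ : EdgeColouring G) → MonoTriangle χ

{-# OPTIONS --safe #-}
module Submission where

open import Defs hiding (sym)
open import Data.Bool using (Bool; true; false; _∧_; _∨_; T; if_then_else_; not)
open import Data.Bool.ListAction using (any)
open import Data.Bool.Properties as Bool using (T-∧; T-∨; T-≡; T?; ∧-comm; ∨-comm)
open import Data.Empty using (⊥; ⊥-elim)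
open import Data.Fin using (Fin; toℕ)
open import Data.Fin.Properties using (toℕ<n; toℕ-fromℕ<; any?)
open import Data.Integer as ℤ using (ℤ; +_; 0ℤ; 1ℤ)
import Data.Integer.Properties as ℤₚ
open import Data.Integer.Tactic.RingSolver using (solve-∀)
open import Data.List using (List; []; _∷_; _++_; map; length; replicate; zipWith; drop; take; applyUpTo; upTo; filterᵇ; iterate)
open import Data.List.Membership.Propositional using (_∈_; lose; find)
open import Data.List.Membership.Propositional.Properties using (∈-upTo⁺; ∈-applyUpTo⁺; ∈-applyUpTo⁻; ∈-filter⁺)
open import Data.List.Properties using (map-applyUpTo)
open import Data.List.Relation.Binary.Permutation.Propositional using (_↭_; refl; prep; swap; trans; ↭-trans; ↭-sym; ↭-reflexive)
open import Data.List.Relation.Unary.All as All using (All; []; _∷_)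
open import Data.List.Relation.Unary.Any as Any using (Any)
open import Data.List.Relation.Unary.Any.Properties using (any⁺; any⁻; map⁻)
open import Data.Maybe using (Maybe; just; nothing)
open import Data.Nat using (ℕ; zero; suc; _+_; _*_; _∸_; _^_; _⊓_; _⊔_; _<_; _≤_; z≤n; s≤s; NonZero; _≡ᵇ_; _<ᵇ_; >-nonZero; >-nonZero⁻¹)
open import Data.Nat.DivMod using (_/_; _%_; _mod_; m≡m%n+[m/n]*n; [m+kn]%n≡m%n; m%n<n; m<n⇒m%n≡m; m<n⇒m/n≡0; m%n%n≡m%n; m*n/n≡m; m*n%n≡0; +-distrib-/-∣ʳ; %-distribˡ-+; %-distribˡ-*; m∣n⇒o%n%m≡o%m)
open import Data.Nat.Divisibility using (divides)
import Data.Nat.Properties as ℕ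
import Data.Nat.Tactic.RingSolver as ℕSolver
open import Data.Product using (_×_; _,_; proj₁; proj₂; Σ; ∃)
open import Data.Sum using (_⊎_; inj₁; inj₂)
open import Data.Unit using (⊤; tt)
open import Function using (_∘_; case_of_)
open import Function.Bundles using (Equivalence)
open import Relation.Nullary using (¬_; Dec; yes; no)
open import Relation.Nullary.Decidable using (_×-dec_; decidable-stable; from-yes)
open import Relation.Binary.PropositionalEquality as ≡ using (_≡_; _≢_; cong; cong₂; sym; subst; module ≡-Reasoning)
open import Algebra.Properties.AbelianGroup ℤₚ.+-0-abelianGroup using (∙-cancelˡ)
open import Data.List.Sort.InsertionSort ℕ.≤-decTotalOrder using (insertionSort)
open import Data.List.Sort.Base ℕ.≤-totalOrder using (module SortingAlgorithm)
open SortingAlgorithm insertionSort using (sort; sort-↭)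

-- Let L be the Cayley graph on ℤ/785 whose connection set is the cyclic group of powers of 53; it is
-- K₄-free.  Write a 2-colouring of L without monochromatic triangles as a ±1-valued function x on arcs.
-- Each triangle contributes -1 to the sum of the products of the colours of its pairs of edges, which
-- says that x attains a prescribed value -14 ⟪ x , x ⟫ of the quadratic form of the "same triangle"
-- operator A.  This is the least eigenvalue of A, and its eigenvectors depend only on the end points
-- modulo 5: reduction modulo 5 maps L to K₅, and the good colourings of K₅ pull back.
--
-- To see that nothing else attains the value, let y be the deviation of x from its means over the
-- fibres of the reduction, M₀ = 6 - A and Mⱼ₊₁ = Mⱼ² - rⱼ.  Convexity turns ⟪ y , M₀ y ⟫ ≥ 20 ⟪ y , y ⟫ into
-- ⟪ y , Mⱼ y ⟫ ≥ cⱼ ⟪ y , y ⟫, whereas ⟪ y , M₅ y ⟫ is at most the ℓ¹-norm of the convolution kernel of M₅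
-- (on the group of maps v ↦ sv + w, which acts regularly on arcs) modulo fibre-constant functions.
-- The kernel is computed exactly and its norm is too small unless y = 0.
--
-- Hence all good colourings of L come from K₅.  The graph sought is L with one more vertex, joined to a
-- triangle-free set W chosen so that none of these colourings extends (and with isolated vertices).

-- The margin is narrow. The choice r₀ = 188 reflects that the eigenvalues of M₀ = 6 - A off the
-- fibre-constant functions reach about √376 ≈ 19.4 in absolute value, against the 20 that belongs
-- to the eigenvalue -14 of A. Replacing a spectral radius by the ℓ¹-norm of a kernel may cost a
-- factor of order √(156 · 785) ≈ 350. Squaring and subtracting r widens the gap: c₅ is about 1.09 ·
-- 10³⁵, the radius of M₅ about 7.5 · 10³¹, and this ratio of more than 1000 absorbs the loss. So no
-- eigenvalue is ever computed; one column of M₅ in exact integers suffices, because all operators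
-- commute with a group that is transitive on arcs.
--
-- The modulus is 785 = 5 · 157, and 53 is a primitive root modulo 157 with residue 3, a primitive
-- root, modulo 5. Two vertices are adjacent iff their difference is a unit whose class modulo
-- fourth powers in (ℤ/157)* is the one prescribed by its residue modulo 5. Hence the five residue
-- classes are independent sets, and 39 · 157 arcs of L lie over each arc of K₅.

-- Finite sums and periodic functions.

∑ : ℕ → (ℕ → ℤ) → ℤ
∑ zero    f = 0ℤ
∑ (suc n) f = ∑ n f ℤ.+ f n

∑-cong< : ∀ n {f g} → (∀ i → i < n → f i ≡ g i) → ∑ n f ≡ ∑ n g
∑-cong< zero    e = ≡.refl
∑-cong< (suc n) e = cong₂ ℤ._+_ (∑-cong< n (λ i i<n → e i (ℕ.m<n⇒m<1+n i<n))) (e n (ℕ.n<1+n n))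

∑-cong : ∀ n {f g} → (∀ i → f i ≡ g i) → ∑ n f ≡ ∑ n g
∑-cong n e = ∑-cong< n (λ i _ → e i)

∑-0 : ∀ n → ∑ n (λ _ → 0ℤ) ≡ 0ℤ
∑-0 zero    = ≡.refl
∑-0 (suc n) = ≡.trans (ℤₚ.+-identityʳ _) (∑-0 n)

∑-+ : ∀ n f g → ∑ n (λ i → f i ℤ.+ g i) ≡ ∑ n f ℤ.+ ∑ n g
∑-+ zero    f g = ≡.refl
∑-+ (suc n) f g = ≡.trans (cong (ℤ._+ (f n ℤ.+ g n)) (∑-+ n f g)) (interchange (∑ n f) (∑ n g) (f n) (g n))
  where
  interchange : ∀ a b c d → (a ℤ.+ b) ℤ.+ (c ℤ.+ d) ≡ (a ℤ.+ c) ℤ.+ (b ℤ.+ d)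
  interchange = solve-∀

∑-* : ∀ n c f → ∑ n (λ i → c ℤ.* f i) ≡ c ℤ.* ∑ n f
∑-* zero    c f = sym (ℤₚ.*-zeroʳ c)
∑-* (suc n) c f = ≡.trans (cong (ℤ._+ c ℤ.* f n) (∑-* n c f)) (sym (ℤₚ.*-distribˡ-+ c _ _))

∑-const : ∀ n c → ∑ n (λ _ → c) ≡ + n ℤ.* c
∑-const zero    c = ≡.refl
∑-const (suc n) c = ≡.trans (cong (ℤ._+ c) (∑-const n c)) (≡.trans (ℤₚ.+-comm _ c) (sym (ℤₚ.suc-* (+ n) c)))

∑-swap : ∀ m n (f : ℕ → ℕ → ℤ) → ∑ m (λ i → ∑ n (f i)) ≡ ∑ n (λ j → ∑ m (λ i → f i j))
∑-swap zero    n f = sym (∑-0 n)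
∑-swap (suc m) n f = ≡.trans (cong (ℤ._+ ∑ n (f m)) (∑-swap m n f)) (sym (∑-+ n _ _))

∑-mono : ∀ n {f g} → (∀ i → f i ℤ.≤ g i) → ∑ n f ℤ.≤ ∑ n g
∑-mono zero    le = ℤₚ.≤-refl
∑-mono (suc n) le = ℤₚ.+-mono-≤ (∑-mono n le) (le n)

∑-nonneg : ∀ n {f} → (∀ i → 0ℤ ℤ.≤ f i) → 0ℤ ℤ.≤ ∑ n f
∑-nonneg n le = ℤₚ.≤-trans (ℤₚ.≤-reflexive (sym (∑-0 n))) (∑-mono n le)

∑-first : ∀ n f → ∑ (suc n) f ≡ f 0 ℤ.+ ∑ n (λ i → f (suc i))
∑-first zero    f = ℤₚ.+-comm 0ℤ (f 0)
∑-first (suc n) f = ≡.trans (cong (ℤ._+ f (suc n)) (∑-first n f)) (ℤₚ.+-assoc (f 0) _ _)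

nonneg-sum-zero : ∀ {a b} → 0ℤ ℤ.≤ a → 0ℤ ℤ.≤ b → a ℤ.+ b ≡ 0ℤ → b ≡ 0ℤ
nonneg-sum-zero {a} {b} a≥0 b≥0 e =
  ℤₚ.≤-antisym (ℤₚ.≤-trans (subst (ℤ._≤ a ℤ.+ b) (ℤₚ.+-identityˡ b) (ℤₚ.+-monoˡ-≤ b a≥0)) (ℤₚ.≤-reflexive e)) b≥0

∑-zero⁻ : ∀ n {f} → (∀ i → 0ℤ ℤ.≤ f i) → ∑ n f ≡ 0ℤ → ∀ i → i < n → f i ≡ 0ℤ
∑-zero⁻ (suc n) {f} le e i i<1+n with ℕ.m≤n⇒m<n∨m≡n (ℕ.m<1+n⇒m≤n i<1+n)
... | inj₂ ≡.refl = nonneg-sum-zero (∑-nonneg n le) (le n) e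
... | inj₁ i<n = ∑-zero⁻ n le (nonneg-sum-zero (le n) (∑-nonneg n le) (≡.trans (ℤₚ.+-comm (f n) _) e)) i i<n

slide : ∀ i j k → i + k + j ≡ i + j + 1 * k
slide = ℕSolver.solve-∀

module Periodic (p : ℕ) {A : Set} (f : ℕ → A) (per : ∀ i → f (i + p) ≡ f i) where

  period-* : ∀ i k → f (i + k * p) ≡ f i
  period-* i zero    = cong f (ℕ.+-identityʳ i)
  period-* i (suc k) = ≡.trans (cong f (≡.trans (cong (λ z → i + z) (ℕ.+-comm p (k * p))) (sym (ℕ.+-assoc i (k * p) p))))
                      (≡.trans (per (i + k * p)) (period-* i k))

  module _ .{{_ : NonZero p}} where

    period-% : ∀ i → f (i % p) ≡ f i
    period-% i = ≡.trans (sym (period-* (i % p) (i / p))) (cong f (sym (m≡m%n+[m/n]*n i p)))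

    period-≡ : ∀ {i j} → i % p ≡ j % p → f i ≡ f j
    period-≡ {i} {j} e = ≡.trans (sym (period-% i)) (≡.trans (cong f e) (period-% j))

open Periodic public

∑-shift : ∀ n f → (∀ i → f (i + n) ≡ f i) → ∀ r → ∑ n (λ i → f (i + r)) ≡ ∑ n f
∑-shift n f per zero    = ∑-cong n (λ i → cong f (ℕ.+-identityʳ i))
∑-shift n f per (suc r) = begin
  ∑ n (λ i → f (i + suc r))  ≡⟨ ∑-cong n (λ i → cong f (ℕ.+-suc i r)) ⟩
  ∑ n (λ i → g (suc i))      ≡⟨ ∑-shift1 ⟩
  ∑ n g                      ≡⟨ ∑-shift n f per r ⟩
  ∑ n f                      ∎
  where
  open ≡-Reasoning
  g : ℕ → ℤ
  g i = f (i + r)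
  g-per : g n ≡ g 0
  g-per = ≡.trans (cong f (ℕ.+-comm n r)) (per r)
  ∑-shift1 : ∑ n (λ i → g (suc i)) ≡ ∑ n g
  ∑-shift1 = ∙-cancelˡ (g 0) _ _ (begin
    g 0 ℤ.+ ∑ n (λ i → g (suc i)) ≡⟨ ∑-first n g ⟨
    ∑ n g ℤ.+ g n                 ≡⟨ cong (ℤ._+_ (∑ n g)) g-per ⟩
    ∑ n g ℤ.+ g 0                 ≡⟨ ℤₚ.+-comm (∑ n g) (g 0) ⟩
    g 0 ℤ.+ ∑ n g                 ∎)

-- Shifting by u′c turns g (u b) into g (u b + c); averaging over c then makes the factor u irrelevant.
∑-unit : ∀ n .{{_ : NonZero n}} g → (∀ i → g (i + n) ≡ g i) →
         ∀ u u′ q → u * u′ ≡ 1 + q * n → ∑ n (λ b → g (u * b)) ≡ ∑ n g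
∑-unit n g per u u′ q uu′ = ℤₚ.*-cancelˡ-≡ (+ n) _ _ (begin
  + n ℤ.* ∑ n (λ b → g (u * b))                     ≡⟨ ∑-const n _ ⟨
  ∑ n (λ c → ∑ n (λ b → g (u * b)))                 ≡⟨ ∑-cong n (λ c → ∑-shift n (λ b → g (u * b)) per-u (u′ * c)) ⟨
  ∑ n (λ c → ∑ n (λ b → g (u * (b + u′ * c))))      ≡⟨ ∑-cong n (λ c → ∑-cong n (λ b → reduce b c)) ⟩
  ∑ n (λ c → ∑ n (λ b → g (c + u * b)))             ≡⟨ ∑-swap n n _ ⟩
  ∑ n (λ b → ∑ n (λ c → g (c + u * b)))             ≡⟨ ∑-cong n (λ b → ∑-shift n g per (u * b)) ⟩
  ∑ n (λ b → ∑ n g)                                 ≡⟨ ∑-const n _ ⟩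
  + n ℤ.* ∑ n g                                     ∎)
  where
  open ≡-Reasoning
  per-u : ∀ b → g (u * (b + n)) ≡ g (u * b)
  per-u b = ≡.trans (cong g (ℕ.*-distribˡ-+ u b n)) (period-* n g per (u * b) u)
  regroup : ∀ u u′ b c → u * (b + u′ * c) ≡ u * b + (u * u′) * c
  regroup = ℕSolver.solve-∀
  regroup₂ : ∀ u b c q n → u * b + (1 + q * n) * c ≡ (c + u * b) + (c * q) * n
  regroup₂ = ℕSolver.solve-∀
  reduce : ∀ b c → g (u * (b + u′ * c)) ≡ g (c + u * b)
  reduce b c = ≡.trans (cong g (≡.trans (regroup u u′ b c)
    (≡.trans (cong (λ z → u * b + z * c) uu′) (regroup₂ u b c q n)))) (period-* n g per (c + u * b) (c * q))

∑ᴸ : List ℕ → (ℕ → ℤ) → ℤ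
∑ᴸ []       f = 0ℤ
∑ᴸ (t ∷ ts) f = f t ℤ.+ ∑ᴸ ts f

∑ᴸ-cong : ∀ ts {f g} → (∀ t → f t ≡ g t) → ∑ᴸ ts f ≡ ∑ᴸ ts g
∑ᴸ-cong []       e = ≡.refl
∑ᴸ-cong (t ∷ ts) e = cong₂ ℤ._+_ (e t) (∑ᴸ-cong ts e)

∑ᴸ-congᴬ : ∀ {P : ℕ → Set} {ts} {f g} → All P ts → (∀ t → P t → f t ≡ g t) → ∑ᴸ ts f ≡ ∑ᴸ ts g
∑ᴸ-congᴬ []       e = ≡.refl
∑ᴸ-congᴬ (p ∷ ps) e = cong₂ ℤ._+_ (e _ p) (∑ᴸ-congᴬ ps e)

∑ᴸ-map : ∀ (φ : ℕ → ℕ) ts f → ∑ᴸ (map φ ts) f ≡ ∑ᴸ ts (λ t → f (φ t))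
∑ᴸ-map φ []       f = ≡.refl
∑ᴸ-map φ (t ∷ ts) f = cong (ℤ._+_ (f (φ t))) (∑ᴸ-map φ ts f)

∑ᴸ-↭ : ∀ {ts us} f → ts ↭ us → ∑ᴸ ts f ≡ ∑ᴸ us f
∑ᴸ-↭ f refl = ≡.refl
∑ᴸ-↭ f (prep x p) = cong (ℤ._+_ (f x)) (∑ᴸ-↭ f p)
∑ᴸ-↭ f (swap {xs = ts} x y p) = ≡.trans (cong (λ z → f x ℤ.+ (f y ℤ.+ z)) (∑ᴸ-↭ f p)) (exchange (f x) (f y) _)
  where
  exchange : ∀ a b c → a ℤ.+ (b ℤ.+ c) ≡ b ℤ.+ (a ℤ.+ c)
  exchange = solve-∀
∑ᴸ-↭ f (trans p q) = ≡.trans (∑ᴸ-↭ f p) (∑ᴸ-↭ f q)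

∑-∑ᴸ : ∀ n ts (f : ℕ → ℕ → ℤ) → ∑ n (λ i → ∑ᴸ ts (f i)) ≡ ∑ᴸ ts (λ t → ∑ n (λ i → f i t))
∑-∑ᴸ n []       f = ∑-0 n
∑-∑ᴸ n (t ∷ ts) f = ≡.trans (∑-+ n (λ i → f i t) _) (cong (ℤ._+_ (∑ n (λ i → f i t))) (∑-∑ᴸ n ts f))

∑ᴸ-*ʳ : ∀ ts f c → ∑ᴸ ts f ℤ.* c ≡ ∑ᴸ ts (λ t → f t ℤ.* c)
∑ᴸ-*ʳ []       f c = ≡.refl
∑ᴸ-*ʳ (t ∷ ts) f c = ≡.trans (ℤₚ.*-distribʳ-+ c (f t) _) (cong (ℤ._+_ (f t ℤ.* c)) (∑ᴸ-*ʳ ts f c))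

∑ᴸ-*ˡ : ∀ ts f c → c ℤ.* ∑ᴸ ts f ≡ ∑ᴸ ts (λ t → c ℤ.* f t)
∑ᴸ-*ˡ []       f c = ℤₚ.*-zeroʳ c
∑ᴸ-*ˡ (t ∷ ts) f c = ≡.trans (ℤₚ.*-distribˡ-+ c (f t) _) (cong (ℤ._+_ (c ℤ.* f t)) (∑ᴸ-*ˡ ts f c))

∑ᴸ-const : ∀ ts c → ∑ᴸ ts (λ _ → c) ≡ + length ts ℤ.* c
∑ᴸ-const []       c = ≡.refl
∑ᴸ-const (t ∷ ts) c = ≡.trans (cong (ℤ._+_ c) (∑ᴸ-const ts c)) (sym (ℤₚ.suc-* (+ length ts) c))

∑ᴸ-+ : ∀ ts f g → ∑ᴸ ts (λ t → f t ℤ.+ g t) ≡ ∑ᴸ ts f ℤ.+ ∑ᴸ ts g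
∑ᴸ-+ []       f g = ≡.refl
∑ᴸ-+ (t ∷ ts) f g = ≡.trans (cong (ℤ._+_ (f t ℤ.+ g t)) (∑ᴸ-+ ts f g)) (lemma (f t) (g t) _ _)
  where
  lemma : ∀ a b c d → (a ℤ.+ b) ℤ.+ (c ℤ.+ d) ≡ (a ℤ.+ c) ℤ.+ (b ℤ.+ d)
  lemma = solve-∀

∑ᴸ-++ : ∀ ts us f → ∑ᴸ (ts ++ us) f ≡ ∑ᴸ ts f ℤ.+ ∑ᴸ us f
∑ᴸ-++ []       us f = sym (ℤₚ.+-identityˡ _)
∑ᴸ-++ (t ∷ ts) us f = ≡.trans (cong (ℤ._+_ (f t)) (∑ᴸ-++ ts us f)) (sym (ℤₚ.+-assoc (f t) _ _))

∑ᴸ-replicate : ∀ e t f → ∑ᴸ (replicate e t) f ≡ + e ℤ.* f t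
∑ᴸ-replicate zero    t f = ≡.refl
∑ᴸ-replicate (suc e) t f = ≡.trans (cong (ℤ._+_ (f t)) (∑ᴸ-replicate e t f)) (sym (ℤₚ.suc-* (+ e) (f t)))

∑-- : ∀ n f g → ∑ n (λ i → f i ℤ.- g i) ≡ ∑ n f ℤ.- ∑ n g
∑-- zero    f g = ≡.refl
∑-- (suc n) f g = ≡.trans (cong (ℤ._+ (f n ℤ.- g n)) (∑-- n f g)) (lemma (∑ n f) (∑ n g) (f n) (g n))
  where
  lemma : ∀ a b c d → (a ℤ.- b) ℤ.+ (c ℤ.- d) ≡ (a ℤ.+ c) ℤ.- (b ℤ.+ d)
  lemma = solve-∀

[_≡0] : ℕ → ℕ
[ zero  ≡0] = 1
[ suc _ ≡0] = 0

∑-indicator : ∀ k .{{_ : NonZero k}} (f : ℕ → ℤ) → ∑ k (λ i → + [ i % k ≡0] ℤ.* f i) ≡ f 0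
∑-indicator (suc k) f = begin
  ∑ (suc k) (λ i → + [ i % suc k ≡0] ℤ.* f i)
    ≡⟨ ∑-first k _ ⟩
  1ℤ ℤ.* f 0 ℤ.+ ∑ k (λ i → + [ suc i % suc k ≡0] ℤ.* f (suc i))
    ≡⟨ cong₂ ℤ._+_ (ℤₚ.*-identityˡ (f 0)) (∑-cong< k λ i i<k → cong (λ r → + [ r ≡0] ℤ.* f (suc i)) (m<n⇒m%n≡m (s≤s i<k))) ⟩
  f 0 ℤ.+ ∑ k (λ _ → 0ℤ)
    ≡⟨ cong (ℤ._+_ (f 0)) (∑-0 k) ⟩
  f 0 ℤ.+ 0ℤ
    ≡⟨ ℤₚ.+-identityʳ (f 0) ⟩
  f 0 ∎
  where open ≡-Reasoning

*-≤-∣∣ : ∀ c {r N} → r ℤ.≤ N → ℤ.- r ℤ.≤ N → c ℤ.* r ℤ.≤ + ℤ.∣ c ∣ ℤ.* N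
*-≤-∣∣ (+ k)       r≤N -r≤N = ℤₚ.*-monoˡ-≤-nonNeg (+ k) r≤N
*-≤-∣∣ ℤ.-[1+ k ] {r} r≤N -r≤N = ℤₚ.≤-trans (ℤₚ.≤-reflexive (lemma (+ suc k) r)) (ℤₚ.*-monoˡ-≤-nonNeg (+ suc k) -r≤N)
  where
  lemma : ∀ k r → ℤ.- k ℤ.* r ≡ k ℤ.* ℤ.- r
  lemma = solve-∀

-- Rows of digits packed into natural numbers.

-- Least significant digit first. A single operation on a large natural number acts on all digits of
-- a row, which keeps the kernel computable during type checking.
pack : ℕ → ℕ → (ℕ → ℕ) → ℕ
pack B zero    d = 0
pack B (suc n) d = d 0 + B * pack B n (λ w → d (suc w))

module _ (B : ℕ) where

  pack-cong : ∀ n {d d′} → (∀ w → d w ≡ d′ w) → pack B n d ≡ pack B n d′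
  pack-cong zero    eq = ≡.refl
  pack-cong (suc n) eq = cong₂ (λ a p → a + B * p) (eq 0) (pack-cong n λ w → eq (suc w))

  pack-+ : ∀ n d d′ → pack B n (λ w → d w + d′ w) ≡ pack B n d + pack B n d′
  pack-+ zero    d d′ = ≡.refl
  pack-+ (suc n) d d′ = ≡.trans (cong (λ p → d 0 + d′ 0 + B * p) (pack-+ n _ _)) (lemma (d 0) (d′ 0) B _ _)
    where
    lemma : ∀ a b c p r → a + b + c * (p + r) ≡ (a + c * p) + (b + c * r)
    lemma = ℕSolver.solve-∀

  pack-* : ∀ n c d → pack B n (λ w → c * d w) ≡ c * pack B n d
  pack-* zero    c d = sym (ℕ.*-zeroʳ c)
  pack-* (suc n) c d = ≡.trans (cong (λ p → c * d 0 + B * p) (pack-* n c _)) (lemma c (d 0) B _)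
    where
    lemma : ∀ c a b p → c * a + b * (c * p) ≡ c * (a + b * p)
    lemma = ℕSolver.solve-∀

  -- Every digit of the minuend is `k`, hence no borrow crosses a digit boundary.
  pack-∸ : ∀ n k d → (∀ w → d w ≤ k) → pack B n (λ w → k ∸ d w) ≡ k * pack B n (λ _ → 1) ∸ pack B n d
  pack-∸ n k d d≤k = begin
    pack B n (λ w → k ∸ d w)                                       ≡⟨ ℕ.m+n∸n≡m _ (pack B n d) ⟨
    pack B n (λ w → k ∸ d w) + pack B n d ∸ pack B n d             ≡⟨ cong (_∸ pack B n d) (pack-+ n _ d) ⟨
    pack B n (λ w → k ∸ d w + d w) ∸ pack B n d                    ≡⟨ cong (_∸ pack B n d) (pack-cong n λ w → ≡.trans (ℕ.m∸n+n≡m (d≤k w)) (sym (ℕ.*-identityʳ k))) ⟩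
    pack B n (λ w → k * 1) ∸ pack B n d                            ≡⟨ cong (_∸ pack B n d) (pack-* n k (λ _ → 1)) ⟩
    k * pack B n (λ _ → 1) ∸ pack B n d                            ∎
    where open ≡-Reasoning

  pack-split : ∀ r k d → pack B (r + k) d ≡ pack B r d + B ^ r * pack B k (λ w → d (r + w))
  pack-split zero    k d = sym (ℕ.*-identityˡ _)
  pack-split (suc r) k d = ≡.trans (cong (λ p → d 0 + B * p) (pack-split r k _)) (lemma (d 0) B _ (B ^ r) _)
    where
    lemma : ∀ a b p c q → a + b * (p + c * q) ≡ a + b * p + b * c * q
    lemma = ℕSolver.solve-∀

  pack-< : ∀ n d → (∀ w → d w < B) → pack B n d < B ^ n
  pack-< zero    d d<B = s≤s z≤n
  pack-< (suc n) d d<B = begin-strict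
    d 0 + B * pack B n d′   <⟨ ℕ.+-monoˡ-< (B * pack B n d′) (d<B 0) ⟩
    B + B * pack B n d′     ≡⟨ ℕ.*-suc B _ ⟨
    B * suc (pack B n d′)   ≤⟨ ℕ.*-monoʳ-≤ B (pack-< n d′ λ w → d<B (suc w)) ⟩
    B * B ^ n               ∎
    where
    open ℕ.≤-Reasoning
    d′ : ℕ → ℕ
    d′ w = d (suc w)

divMod-unique : ∀ b .{{_ : NonZero b}} lo hi → lo < b → ((lo + b * hi) / b ≡ hi) × ((lo + b * hi) % b ≡ lo)
divMod-unique b lo hi lo<b = quotient , remainder
  where
  quotient : (lo + b * hi) / b ≡ hi
  quotient = ≡.trans (+-distrib-/-∣ʳ lo (divides hi (ℕ.*-comm b hi)))
    (cong₂ _+_ (m<n⇒m/n≡0 lo<b) (≡.trans (cong (_/ b) (ℕ.*-comm b hi)) (m*n/n≡m hi b)))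
  remainder : (lo + b * hi) % b ≡ lo
  remainder = ≡.trans (cong (λ z → (lo + z) % b) (ℕ.*-comm b hi)) (≡.trans ([m+kn]%n≡m%n lo hi b) (m<n⇒m%n≡m lo<b))

-- A cyclic shift of digits: with the pair `(B ^ r , B ^ k)` the low `r` digits are cut off by
-- division and put back on top of the other `k`. Matching on `suc b` provides a non-zero divisor;
-- the value for zero is a dummy.
rotate-digits : ℕ × ℕ → ℕ → ℕ
rotate-digits (zero  , c) P = 0
rotate-digits (suc b , c) P = P / suc b + P % suc b * c

rotate-digits-pack : ∀ B .{{_ : NonZero B}} r k d → (∀ w → d w < B) → (∀ w → d (w + (r + k)) ≡ d w) →
                     rotate-digits (B ^ r , B ^ k) (pack B (r + k) d) ≡ pack B (r + k) (λ w → d (w + r))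
rotate-digits-pack B r k d d<B per = begin
  rotate-digits (B ^ r , B ^ k) (pack B (r + k) d)
    ≡⟨ cong (rotate-digits (B ^ r , B ^ k)) (pack-split B r k d) ⟩
  rotate-digits (B ^ r , B ^ k) (lo + B ^ r * hi)
    ≡⟨ rotate-pair (B ^ r) {{ℕ.m^n≢0 B r}} (pack-< B r d d<B) ⟩
  hi + lo * B ^ k
    ≡⟨ cong (λ z → hi + z) (ℕ.*-comm lo (B ^ k)) ⟩
  hi + B ^ k * lo
    ≡⟨ cong₂ (λ p q → p + B ^ k * q) (pack-cong B k λ w → cong d (ℕ.+-comm r w)) (pack-cong B r λ w → ≡.trans (sym (per w)) (cong d (lemma w r k))) ⟩
  pack B k (λ w → d (w + r)) + B ^ k * pack B r (λ w → d (k + w + r))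
    ≡⟨ pack-split B k r (λ w → d (w + r)) ⟨
  pack B (k + r) (λ w → d (w + r))
    ≡⟨ cong (λ l → pack B l (λ w → d (w + r))) (ℕ.+-comm k r) ⟩
  pack B (r + k) (λ w → d (w + r)) ∎
  where
  open ≡-Reasoning
  lo hi : ℕ
  lo = pack B r d
  hi = pack B k (λ w → d (r + w))
  lemma : ∀ w r k → w + (r + k) ≡ k + w + r
  lemma = ℕSolver.solve-∀
  rotate-pair : ∀ b .{{_ : NonZero b}} → lo < b → rotate-digits (b , B ^ k) (lo + b * hi) ≡ hi + lo * B ^ k
  rotate-pair (suc b) lo<b = cong₂ (λ p q → p + q * B ^ k) (proj₁ uniq) (proj₂ uniq)
    where
    uniq = divMod-unique (suc b) lo hi lo<b

rotate : ∀ {A : Set} → ℕ → List A → List A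
rotate t xs = drop t xs ++ take t xs

module _ {A : Set} where

  drop-applyUpTo : ∀ (u : ℕ → A) t k → drop t (applyUpTo u (t + k)) ≡ applyUpTo (λ i → u (t + i)) k
  drop-applyUpTo u zero    k = ≡.refl
  drop-applyUpTo u (suc t) k = drop-applyUpTo (λ i → u (suc i)) t k

  take-applyUpTo : ∀ (u : ℕ → A) t k → take t (applyUpTo u (t + k)) ≡ applyUpTo u t
  take-applyUpTo u zero    k = ≡.refl
  take-applyUpTo u (suc t) k = cong (u 0 ∷_) (take-applyUpTo (λ i → u (suc i)) t k)

  applyUpTo-++ : ∀ (u : ℕ → A) k t → applyUpTo u k ++ applyUpTo (λ i → u (k + i)) t ≡ applyUpTo u (k + t)
  applyUpTo-++ u zero    t = ≡.refl
  applyUpTo-++ u (suc k) t = cong (u 0 ∷_) (applyUpTo-++ (λ i → u (suc i)) k t)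

  applyUpTo-cong : ∀ {u v : ℕ → A} → (∀ i → u i ≡ v i) → ∀ k → applyUpTo u k ≡ applyUpTo v k
  applyUpTo-cong eq zero    = ≡.refl
  applyUpTo-cong eq (suc k) = cong₂ _∷_ (eq 0) (applyUpTo-cong (λ i → eq (suc i)) k)

  rotate-applyUpTo : ∀ (u : ℕ → A) t k → (∀ i → u (i + (t + k)) ≡ u i) →
                     rotate t (applyUpTo u (t + k)) ≡ applyUpTo (λ i → u (i + t)) (t + k)
  rotate-applyUpTo u t k per = begin
    rotate t (applyUpTo u (t + k))
      ≡⟨ cong₂ _++_ (drop-applyUpTo u t k) (take-applyUpTo u t k) ⟩
    applyUpTo (λ i → u (t + i)) k ++ applyUpTo u t
      ≡⟨ cong₂ _++_ (applyUpTo-cong (λ i → cong u (ℕ.+-comm t i)) k) (applyUpTo-cong (λ i → ≡.trans (sym (per i)) (cong u (lemma i t k))) t) ⟩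
    applyUpTo (λ i → u (i + t)) k ++ applyUpTo (λ i → u (k + i + t)) t
      ≡⟨ applyUpTo-++ (λ i → u (i + t)) k t ⟩
    applyUpTo (λ i → u (i + t)) (k + t)
      ≡⟨ cong (applyUpTo (λ i → u (i + t))) (ℕ.+-comm k t) ⟩
    applyUpTo (λ i → u (i + t)) (t + k) ∎
    where
    open ≡-Reasoning
    lemma : ∀ i t k → i + (t + k) ≡ k + i + t
    lemma = ℕSolver.solve-∀

zipWith-applyUpTo : ∀ {A A′ A″ : Set} (_∙_ : A → A′ → A″) u v k →
                    zipWith _∙_ (applyUpTo u k) (applyUpTo v k) ≡ applyUpTo (λ i → u i ∙ v i) k
zipWith-applyUpTo _∙_ u v zero    = ≡.refl
zipWith-applyUpTo _∙_ u v (suc k) = cong (_ ∷_) (zipWith-applyUpTo _∙_ _ _ k)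

-- An arc function is stored as the list of its m rows, each row packed into one number in base B.
module Evaluator (n m h g : ℕ) .{{n≢0 : NonZero n}} (Δ : List ℕ) (a B : ℕ) where

  powers : List (ℕ × ℕ)
  powers = applyUpTo (λ j → B ^ (g ^ j % n) , B ^ (n ∸ g ^ j % n)) m

  ones : ℕ
  ones = pack B n (λ _ → 1)

  sumᴾ : List ℕ → List ℕ → List ℕ
  sumᴾ = zipWith _+_

  scaleᴾ : ℕ → List ℕ → List ℕ
  scaleᴾ k = map (k *_)

  -- The shift by k · ones keeps the digits non-negative when they are bounded by k.
  diffᴾ : ℕ → List ℕ → List ℕ → List ℕ
  diffᴾ k·ones = zipWith (λ p r → p + (k·ones ∸ r))

  Cᴾ : List ℕ → List ℕ → List ℕ
  Cᴾ []       Ps = applyUpTo (λ _ → 0) m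
  Cᴾ (t ∷ ts) Ps = sumᴾ (rotate t Ps) (Cᴾ ts Ps)

  Fᴾ : List (ℕ × ℕ) → List ℕ → List ℕ
  Fᴾ pw Ps = zipWith rotate-digits pw (rotate h Ps)

  -- Worst-case digit size when each subtraction is carried out by adding a complement, so that the
  -- bounds of both operands add up.
  bound : List ℕ → ℕ → ℕ
  bound []       D = a * D + (length Δ * D + length Δ * D)
  bound (r ∷ rs) D = bound rs (bound rs D) + r * D

  Mᴾ : List (ℕ × ℕ) → ℕ → List ℕ → ℕ → List ℕ → List ℕ
  Mᴾ pw u [] D Ps = diffᴾ ((length Δ * D + length Δ * D) * u) (scaleᴾ a Ps) (A (Cᴾ Δ Ps))
    where
    A : List ℕ → List ℕ
    A Qs = sumᴾ Qs (Fᴾ pw Qs)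
  Mᴾ pw u (r ∷ rs) D Ps = diffᴾ (r * D * u) (Mᴾ pw u rs (bound rs D) (Mᴾ pw u rs D Ps)) (scaleᴾ r Ps)

  εᴾ : .{{_ : NonZero m}} → List (ℕ × ℕ) → List ℕ
  εᴾ pw = sumᴾ δᴾ (Fᴾ pw δᴾ)
    where
    δᴾ : List ℕ
    δᴾ = applyUpTo (λ j → [ j % m ≡0]) m

  deviation : .{{_ : NonZero B}} → (ℕ → ℕ) → ℕ → ℕ → ℕ → ℕ
  deviation κ zero    w P = 0
  deviation κ (suc k) w P = ℤ.∣ + (P % B) ℤ.- + κ w ∣ + deviation κ k (suc w) (P / B)

  deviations : .{{_ : NonZero B}} → (ℕ → ℕ → ℕ) → ℕ → List ℕ → ℕ
  deviations κ j []       = 0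
  deviations κ j (P ∷ Ps) = deviation (κ j) n 0 P + deviations κ (suc j) Ps

  -- The start `εᴾ` is a sum of two indicators, whence the digit bound `2`. The powers and the
  -- packed ones are passed to `go` as arguments so that their evaluation is shared.
  evaluate : .{{_ : NonZero m}} .{{_ : NonZero B}} → (ℕ → ℕ → ℕ) → List ℕ → ℕ
  evaluate κ rs = go powers ones
    where
    go : List (ℕ × ℕ) → ℕ → ℕ
    go pw u = deviations κ 0 (Mᴾ pw u rs 2 (εᴾ pw))

pack-indicator : ∀ B n .{{_ : NonZero n}} → pack B n (λ w → [ w % n ≡0]) ≡ 1
pack-indicator B (suc n) = cong suc (≡.trans (cong (B *_) (zeros n λ w w<n → cong [_≡0] (m<n⇒m%n≡m (s≤s w<n)))) (ℕ.*-zeroʳ B))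
  where
  zeros : ∀ k {d} → (∀ w → w < k → d w ≡ 0) → pack B k d ≡ 0
  zeros zero    eq = ≡.refl
  zeros (suc k) eq = ≡.trans (cong₂ (λ a p → a + B * p) (eq 0 (s≤s z≤n)) (zeros k λ w w<k → eq (suc w) (s≤s w<k))) (ℕ.*-zeroʳ B)

[≡0]≤1 : ∀ k → [ k ≡0] ≤ 1
[≡0]≤1 zero    = s≤s z≤n
[≡0]≤1 (suc k) = z≤n

-- Refutation by branching over Boolean variables.

∧-elim : ∀ {x y} → T (x ∧ y) → T x × T y
∧-elim = Equivalence.to T-∧

∨-elim : ∀ {x y} → T (x ∨ y) → T x ⊎ T y
∨-elim = Equivalence.to T-∨

none : ∀ {A : Set} (p : A → Bool) {xs x} → any p xs ≡ false → x ∈ xs → ¬ T (p x)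
none p eq x∈xs px = subst T eq (any⁺ p (lose x∈xs px))

assigned : List (ℕ × Bool) → ℕ → Maybe Bool
assigned []              k = nothing
assigned ((l , b) ∷ asg) k = if l ≡ᵇ k then just b else assigned asg k

unanimous : Maybe Bool → Maybe Bool → Maybe Bool → Bool
unanimous (just true)  (just true)  (just true)  = true
unanimous (just false) (just false) (just false) = true
unanimous _            _            _            = false

conflict : List (ℕ × ℕ × ℕ) → List (ℕ × Bool) → Bool
conflict cs asg = any (λ (x , y , z) → unanimous (assigned asg x) (assigned asg y) (assigned asg z)) cs

-- A decision tree with a fixed order of variables; a branch closes as soon as some triple is fully
-- assigned and constant.
refute : List (ℕ × ℕ × ℕ) → List ℕ → List (ℕ × Bool) → Bool
refute cs []       asg = conflict cs asg
refute cs (v ∷ vs) asg = conflict cs asg ∨ (refute cs vs ((v , true) ∷ asg) ∧ refute cs vs ((v , false) ∷ asg))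

module _ (α : ℕ → Bool) where

  Consistent : List (ℕ × Bool) → Set
  Consistent = All λ (k , b) → α k ≡ b

  Constant : ℕ × ℕ × ℕ → Set
  Constant (x , y , z) = α x ≡ α y × α x ≡ α z

  assigned-sound : ∀ {asg} → Consistent asg → ∀ {k b} → assigned asg k ≡ just b → α k ≡ b
  assigned-sound {(l , c) ∷ asg} (αl≡c ∷ con) {k} eq with l ≡ᵇ k in l≡k
  assigned-sound {(l , c) ∷ asg} (αl≡c ∷ con) {k} ≡.refl | true = subst (λ z → α z ≡ c) (ℕ.≡ᵇ⇒≡ l k (Equivalence.from T-≡ l≡k)) αl≡c
  assigned-sound {(l , c) ∷ asg} (αl≡c ∷ con) {k} eq     | false = assigned-sound con eq

  unanimous-sound : ∀ {asg} → Consistent asg → ∀ {x y z} → T (unanimous (assigned asg x) (assigned asg y) (assigned asg z)) → Constant (x , y , z)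
  unanimous-sound {asg} con {x} {y} {z} t with assigned asg x in ex | assigned asg y in ey | assigned asg z in ez
  ... | just true  | just true  | just true  = ≡.trans (assigned-sound con ex) (sym (assigned-sound con ey)) , ≡.trans (assigned-sound con ex) (sym (assigned-sound con ez))
  ... | just false | just false | just false = ≡.trans (assigned-sound con ex) (sym (assigned-sound con ey)) , ≡.trans (assigned-sound con ex) (sym (assigned-sound con ez))

  conflict-sound : ∀ cs {asg} → Consistent asg → T (conflict cs asg) → Any Constant cs
  conflict-sound cs con t = Any.map (λ {(x , y , z)} → unanimous-sound con {x} {y} {z}) (any⁻ _ cs t)

  -- The values of `α` single out one branch, along which the partial assignment agrees with `α`;
  -- the conflict that closes it is therefore genuine.
  refute-sound : ∀ cs vs {asg} → Consistent asg → T (refute cs vs asg) → Any Constant cs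
  refute-sound cs []       con t = conflict-sound cs con t
  refute-sound cs (v ∷ vs) con t with ∨-elim t
  ... | inj₁ u = conflict-sound cs con u
  ... | inj₂ u with ∧-elim u | α v in αv
  ... | t₁ , _ | true  = refute-sound cs vs (αv ∷ con) t₁
  ... | _ , t₂ | false = refute-sound cs vs (αv ∷ con) t₂

sgn : Bool → ℤ
sgn true  = 1ℤ
sgn false = ℤ.-1ℤ

sgn-injective : ∀ {b c} → sgn b ≡ sgn c → b ≡ c
sgn-injective {true}  {true}  _ = ≡.refl
sgn-injective {false} {false} _ = ≡.refl

sgn-square : ∀ b → sgn b ℤ.* sgn b ≡ 1ℤ
sgn-square true  = ≡.refl
sgn-square false = ≡.refl

-- Of three signs that are not all equal exactly one pair agrees, so the products are 1, -1, -1 in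
-- some order.
sgn-nae : ∀ b c d → ¬ (b ≡ c × b ≡ d) → sgn b ℤ.* sgn c ℤ.+ (sgn b ℤ.* sgn d ℤ.+ sgn c ℤ.* sgn d) ≡ ℤ.-1ℤ
sgn-nae true  true  true  nae = ⊥-elim (nae (≡.refl , ≡.refl))
sgn-nae true  true  false nae = ≡.refl
sgn-nae true  false true  nae = ≡.refl
sgn-nae true  false false nae = ≡.refl
sgn-nae false true  true  nae = ≡.refl
sgn-nae false true  false nae = ≡.refl
sgn-nae false false true  nae = ≡.refl
sgn-nae false false false nae = ⊥-elim (nae (≡.refl , ≡.refl))

monoTriangle? : ∀ {V} {G : SimpleGraph V} (χ : EdgeColouring G) → Dec (MonoTriangle χ)
monoTriangle? {G = G} χ = any? λ a → any? λ b → any? λ c →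
  (adj G a b Bool.≟ true) ×-dec (adj G a c Bool.≟ true) ×-dec (adj G b c Bool.≟ true)
  ×-dec (colour χ a b Bool.≟ colour χ a c) ×-dec (colour χ a b Bool.≟ colour χ b c)

-- Functions on arcs: inner product, reversal and translations.

-- Indices are plain naturals and periodicity is a separate property (`Biperiodic`), so that
-- exponents and vertices can be added without reduction.
Arc : Set
Arc = ℕ → ℕ → ℤ

infix 4 _≗_
_≗_ : Arc → Arc → Set
f ≗ g = ∀ i v → f i v ≡ g i v

-- The pair (i , v) stands for the arc from v to v + gⁱ (mod n); reversing it adds h to i, since gʰ ≡ -1.
module Arcs (n m h g q : ℕ) .{{n≢0 : NonZero n}} .{{m≢0 : NonZero m}}
            (h+h≡m : h + h ≡ m) (1+gʰ : 1 + g ^ h ≡ q * n) where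

  s : ℕ → ℕ
  s i = g ^ i

  s-+ : ∀ i j → s (i + j) ≡ s i * s j
  s-+ = ℕ.^-distribˡ-+-* g

  record Biperiodic (f : Arc) : Set where
    field
      perᵢ : ∀ i v → f (i + m) v ≡ f i v
      perᵥ : ∀ i v → f i (v + n) ≡ f i v

    reduceᵥ : ∀ i {v w} k → v ≡ w + k * n → f i v ≡ f i w
    reduceᵥ i {v} {w} k e = ≡.trans (cong (f i) e) (period-* n (f i) (perᵥ i) w k)

    reduceᵢ : ∀ {i j} v k → i ≡ j + k * m → f i v ≡ f j v
    reduceᵢ {i} {j} v k e = ≡.trans (cong (λ i → f i v) e) (period-* m (λ i → f i v) (λ i → perᵢ i v) j k)

    opposite : ∀ i v j → f i (v + s j + s (j + h)) ≡ f i v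
    opposite i v j = reduceᵥ i (s j * q) (begin
      v + s j + s (j + h)     ≡⟨ cong (λ z → v + s j + z) (s-+ j h) ⟩
      v + s j + s j * s h     ≡⟨ lemma v (s j) (s h) ⟩
      v + s j * (1 + s h)     ≡⟨ cong (λ z → v + s j * z) 1+gʰ ⟩
      v + s j * (q * n)       ≡⟨ cong (λ z → v + z) (ℕ.*-assoc (s j) q n) ⟨
      v + s j * q * n         ∎)
      where
      open ≡-Reasoning
      lemma : ∀ v a b → v + a + a * b ≡ v + a * (1 + b)
      lemma = ℕSolver.solve-∀

    -- Both `s j` and `s (j + h + h)` are cancelled by `s (j + h)`, so the walk through all three
    -- steps can be shortened in two ways.
    full-turn : ∀ i v j → f i (v + s (j + m)) ≡ f i (v + s j)
    full-turn i v j = begin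
      f i (v + s (j + m))                       ≡⟨ cong (λ z → f i (v + s z)) (≡.trans (cong (λ z → j + z) (sym h+h≡m)) (sym (ℕ.+-assoc j h h))) ⟩
      f i (v + s (j + h + h))                   ≡⟨ opposite i _ j ⟨
      f i (v + s (j + h + h) + s j + s (j + h)) ≡⟨ cong (f i) (lemma v _ (s j) (s (j + h))) ⟩
      f i (v + s j + s (j + h) + s (j + h + h)) ≡⟨ opposite i (v + s j) (j + h) ⟩
      f i (v + s j)                             ∎
      where
      open ≡-Reasoning
      lemma : ∀ v a b c → v + a + b + c ≡ v + b + c + a
      lemma = ℕSolver.solve-∀

  open Biperiodic public

  ∑∑ : Arc → ℤ
  ∑∑ f = ∑ m λ i → ∑ n λ v → f i v

  ∑∑-cong : ∀ {f g} → f ≗ g → ∑∑ f ≡ ∑∑ g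
  ∑∑-cong e = ∑-cong m λ i → ∑-cong n λ v → e i v

  -- The shift of `v` may depend on `i`. This shear covers the reversal `F` and the right
  -- translations that occur in autocorrelations.
  ∑∑-shift : ∀ {f} → Biperiodic f → ∀ j (c : ℕ → ℕ) → ∑∑ (λ i v → f (i + j) (v + c i)) ≡ ∑∑ f
  ∑∑-shift {f} F j c = ≡.trans (∑-cong m λ i → ∑-shift n (f (i + j)) (perᵥ F (i + j)) (c i))
    (∑-shift m (λ i → ∑ n (f i)) (λ i → ∑-cong n (perᵢ F i)) j)

  infixl 7 _·_
  _·_ : Arc → Arc → Arc
  (f · g) i v = f i v ℤ.* g i v

  infixl 6 _⊕_ _⊖_
  _⊕_ _⊖_ : Arc → Arc → Arc
  (f ⊕ g) i v = f i v ℤ.+ g i v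
  (f ⊖ g) i v = f i v ℤ.- g i v

  infixr 7 _⊙_
  _⊙_ : ℤ → Arc → Arc
  (c ⊙ f) i v = c ℤ.* f i v

  ⟪_,_⟫ : Arc → Arc → ℤ
  ⟪ f , g ⟫ = ∑∑ (f · g)

  ⟪⟫-cong : ∀ {f f′ g g′} → f ≗ f′ → g ≗ g′ → ⟪ f , g ⟫ ≡ ⟪ f′ , g′ ⟫
  ⟪⟫-cong e e′ = ∑∑-cong λ i v → cong₂ ℤ._*_ (e i v) (e′ i v)

  ⟪⟫-congʳ : ∀ f {g g′} → g ≗ g′ → ⟪ f , g ⟫ ≡ ⟪ f , g′ ⟫
  ⟪⟫-congʳ f = ⟪⟫-cong {f} (λ i v → ≡.refl)

  ⟪⟫-congˡ : ∀ {f f′} g → f ≗ f′ → ⟪ f , g ⟫ ≡ ⟪ f′ , g ⟫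
  ⟪⟫-congˡ g e = ⟪⟫-cong {g = g} e (λ i v → ≡.refl)

  ⟪⟫-comm : ∀ f g → ⟪ f , g ⟫ ≡ ⟪ g , f ⟫
  ⟪⟫-comm f g = ∑∑-cong λ i v → ℤₚ.*-comm (f i v) (g i v)

  ∑∑-⊕ : ∀ f g → ∑∑ (f ⊕ g) ≡ ∑∑ f ℤ.+ ∑∑ g
  ∑∑-⊕ f g = ≡.trans (∑-cong m λ i → ∑-+ n (f i) (g i)) (∑-+ m _ _)

  ∑∑-⊙ : ∀ c f → ∑∑ (c ⊙ f) ≡ c ℤ.* ∑∑ f
  ∑∑-⊙ c f = ≡.trans (∑-cong m λ i → ∑-* n c (f i)) (∑-* m c _)

  ⟪⟫-⊕ : ∀ f g k → ⟪ f , g ⊕ k ⟫ ≡ ⟪ f , g ⟫ ℤ.+ ⟪ f , k ⟫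
  ⟪⟫-⊕ f g k = ≡.trans (∑∑-cong λ i v → ℤₚ.*-distribˡ-+ (f i v) (g i v) (k i v)) (∑∑-⊕ (f · g) (f · k))

  ⟪⟫-⊙ : ∀ c f g → ⟪ f , c ⊙ g ⟫ ≡ c ℤ.* ⟪ f , g ⟫
  ⟪⟫-⊙ c f g = ≡.trans (∑∑-cong λ i v → lemma (f i v) c (g i v)) (∑∑-⊙ c (f · g))
    where
    lemma : ∀ a b c → a ℤ.* (b ℤ.* c) ≡ b ℤ.* (a ℤ.* c)
    lemma = solve-∀

  ⟪⟫-⊖ : ∀ f g k → ⟪ f , g ⊖ k ⟫ ≡ ⟪ f , g ⟫ ℤ.- ⟪ f , k ⟫
  ⟪⟫-⊖ f g k = begin
    ⟪ f , g ⊖ k ⟫                            ≡⟨ ⟪⟫-congʳ f (λ i v → lemma (g i v) (k i v)) ⟩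
    ⟪ f , g ⊕ ℤ.-1ℤ ⊙ k ⟫                    ≡⟨ ⟪⟫-⊕ f g (ℤ.-1ℤ ⊙ k) ⟩
    ⟪ f , g ⟫ ℤ.+ ⟪ f , ℤ.-1ℤ ⊙ k ⟫          ≡⟨ cong (ℤ._+_ ⟪ f , g ⟫) (⟪⟫-⊙ ℤ.-1ℤ f k) ⟩
    ⟪ f , g ⟫ ℤ.+ ℤ.-1ℤ ℤ.* ⟪ f , k ⟫        ≡⟨ lemma ⟪ f , g ⟫ ⟪ f , k ⟫ ⟨
    ⟪ f , g ⟫ ℤ.- ⟪ f , k ⟫                  ∎
    where
    open ≡-Reasoning
    lemma : ∀ a b → a ℤ.- b ≡ a ℤ.+ ℤ.-1ℤ ℤ.* b
    lemma = solve-∀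

  square-nonneg : ∀ (i : ℤ) → 0ℤ ℤ.≤ i ℤ.* i
  square-nonneg (+ zero)     = ℤ.+≤+ z≤n
  square-nonneg (+ (suc n))  = ℤ.+≤+ z≤n
  square-nonneg (ℤ.-[1+ n ]) = ℤ.+≤+ z≤n

  ⟪⟫-nonneg : ∀ f → 0ℤ ℤ.≤ ⟪ f , f ⟫
  ⟪⟫-nonneg f = ∑-nonneg m λ i → ∑-nonneg n λ v → square-nonneg (f i v)

  shift : ℕ → ℕ → Arc → Arc
  shift j w f i v = f (i + j) (v + w)

  F : Arc → Arc
  F f i v = f (i + h) (v + s i)

  -- With the arc `(j , w)` read as the map u ↦ w + gʲu, this is left translation by u ↦ v₀ + s i₀ ·
  -- u. Reversal is right multiplication by u ↦ 1 + gʰu, and a change of exponent by `t` is right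
  -- multiplication by u ↦ gᵗu; both therefore commute with `L`.
  L : ℕ → ℕ → Arc → Arc
  L i₀ v₀ f j w = f (i₀ + j) (v₀ + s i₀ * w)

  shift-bip : ∀ {f} j w → Biperiodic f → Biperiodic (shift j w f)
  shift-bip {f} j w B .perᵢ i v = reduceᵢ B (v + w) 1 (slide i j m)
  shift-bip {f} j w B .perᵥ i v = reduceᵥ B (i + j) 1 (slide v w n)

  F-bip : ∀ {f} → Biperiodic f → Biperiodic (F f)
  F-bip {f} B .perᵢ i v = ≡.trans (reduceᵢ B (v + s (i + m)) 1 (slide i h m)) (full-turn B (i + h) v i)
  F-bip {f} B .perᵥ i v = reduceᵥ B (i + h) 1 (slide v (s i) n)

  L-bip : ∀ {f} i₀ v₀ → Biperiodic f → Biperiodic (L i₀ v₀ f)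
  L-bip {f} i₀ v₀ B .perᵢ i v = reduceᵢ B _ 1 (lemma i₀ i m)
    where
    lemma : ∀ i j m → i + (j + m) ≡ i + j + 1 * m
    lemma = ℕSolver.solve-∀
  L-bip {f} i₀ v₀ B .perᵥ i v = reduceᵥ B (i₀ + i) (s i₀) (lemma v₀ (s i₀) v n)
    where
    lemma : ∀ a b c d → a + b * (c + d) ≡ a + b * c + b * d
    lemma = ℕSolver.solve-∀

  ·-bip : ∀ {f g} → Biperiodic f → Biperiodic g → Biperiodic (f · g)
  ·-bip A B .perᵢ i v = cong₂ ℤ._*_ (perᵢ A i v) (perᵢ B i v)
  ·-bip A B .perᵥ i v = cong₂ ℤ._*_ (perᵥ A i v) (perᵥ B i v)

  ⊕-bip : ∀ {f g} → Biperiodic f → Biperiodic g → Biperiodic (f ⊕ g)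
  ⊕-bip A B .perᵢ i v = cong₂ ℤ._+_ (perᵢ A i v) (perᵢ B i v)
  ⊕-bip A B .perᵥ i v = cong₂ ℤ._+_ (perᵥ A i v) (perᵥ B i v)

  ⊖-bip : ∀ {f g} → Biperiodic f → Biperiodic g → Biperiodic (f ⊖ g)
  ⊖-bip A B .perᵢ i v = cong₂ ℤ._-_ (perᵢ A i v) (perᵢ B i v)
  ⊖-bip A B .perᵥ i v = cong₂ ℤ._-_ (perᵥ A i v) (perᵥ B i v)

  ⊙-bip : ∀ {f} c → Biperiodic f → Biperiodic (c ⊙ f)
  ⊙-bip c A .perᵢ i v = cong (c ℤ.*_) (perᵢ A i v)
  ⊙-bip c A .perᵥ i v = cong (c ℤ.*_) (perᵥ A i v)

  shift-isometry : ∀ {f g} j w → Biperiodic f → Biperiodic g → ⟪ shift j w f , shift j w g ⟫ ≡ ⟪ f , g ⟫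
  shift-isometry j w A B = ∑∑-shift (·-bip A B) j (λ _ → w)

  F-isometry : ∀ {f g} → Biperiodic f → Biperiodic g → ⟪ F f , F g ⟫ ≡ ⟪ f , g ⟫
  F-isometry A B = ∑∑-shift (·-bip A B) h s

  F-involutive : ∀ {f} → Biperiodic f → F (F f) ≗ f
  F-involutive {f} B i v = ≡.trans (opposite B (i + h + h) v i)
    (≡.trans (cong (λ z → f z v) (≡.trans (ℕ.+-assoc i h h) (cong (λ z → i + z) h+h≡m))) (perᵢ B i v))

  F-adjoint : ∀ {f g} → Biperiodic f → Biperiodic g → ⟪ F f , g ⟫ ≡ ⟪ f , F g ⟫
  F-adjoint {f} {g} A B = ≡.trans (⟪⟫-congʳ (F f) λ i v → sym (F-involutive B i v)) (F-isometry A (F-bip B))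

  F-cong : ∀ {f g} → f ≗ g → F f ≗ F g
  F-cong e i v = e (i + h) (v + s i)

  F-L : ∀ i₀ v₀ f → F (L i₀ v₀ f) ≗ L i₀ v₀ (F f)
  F-L i₀ v₀ f j w = cong₂ f (sym (ℕ.+-assoc i₀ j h))
    (≡.trans (lemma v₀ (s i₀) w (s j)) (cong (λ z → v₀ + s i₀ * w + z) (sym (s-+ i₀ j))))
    where
    lemma : ∀ a b c d → a + b * (c + d) ≡ a + b * c + b * d
    lemma = ℕSolver.solve-∀

  record Symmetric (f : Arc) : Set where
    field
      bip  : Biperiodic f
      flip : F f ≗ f

  open Symmetric public

  L-sym : ∀ {f} i₀ v₀ → Symmetric f → Symmetric (L i₀ v₀ f)
  L-sym i₀ v₀ S .bip = L-bip i₀ v₀ (bip S)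
  L-sym {f} i₀ v₀ S .flip i v = ≡.trans (F-L i₀ v₀ f i v) (flip S (i₀ + i) (v₀ + s i₀ * v))

  ⊖-sym : ∀ {f g} → Symmetric f → Symmetric g → Symmetric (f ⊖ g)
  ⊖-sym A B .bip = ⊖-bip (bip A) (bip B)
  ⊖-sym A B .flip i v = cong₂ ℤ._-_ (flip A i v) (flip B i v)

  ⊙-sym : ∀ {f} c → Symmetric f → Symmetric (c ⊙ f)
  ⊙-sym c A .bip = ⊙-bip c (bip A)
  ⊙-sym c A .flip i v = cong (c ℤ.*_) (flip A i v)

  symmetrize : ∀ {f} → Biperiodic f → Symmetric (f ⊕ F f)
  symmetrize B .bip = ⊕-bip B (F-bip B)
  symmetrize {f} B .flip i v = ≡.trans (ℤₚ.+-comm (F f i v) _) (cong (ℤ._+ F f i v) (F-involutive B i v))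

  F-⟪⟫ : ∀ {f g} → Biperiodic f → Symmetric g → ⟪ F f , g ⟫ ≡ ⟪ f , g ⟫
  F-⟪⟫ {f} {g} A B = ≡.trans (F-adjoint A (bip B)) (⟪⟫-congʳ f (flip B))

  -- The graph with its additional vertex, and the absence of K₄.

  module Graph (residues : List ℕ) (residues≡ : residues ≡ applyUpTo (λ j → g ^ j % n) m)
               (W : List ℕ) (V : ℕ) (n<V : n < V) where

    arc : ℕ → ℕ → Bool
    arc a b = any (λ r → (a + r) % n ≡ᵇ b) residues

    inW : ℕ → Bool
    inW a = any (_≡ᵇ a) W

    edge : ℕ → ℕ → Bool
    edge a b = ((a <ᵇ n) ∧ (b <ᵇ n)) ∧ (arc a b ∨ arc b a) ∨ ((a ≡ᵇ n) ∧ inW b ∨ (b ≡ᵇ n) ∧ inW a)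

    edge-sym : ∀ a b → edge a b ≡ edge b a
    edge-sym a b = cong₂ _∨_ (cong₂ _∧_ (∧-comm (a <ᵇ n) (b <ᵇ n)) (∨-comm (arc a b) (arc b a))) (∨-comm ((a ≡ᵇ n) ∧ inW b) _)

    Arrow : ℕ → ℕ → Set
    Arrow a b = ∃ λ j → (a + s j) % n ≡ b

    mod-bip : Biperiodic (λ _ v → + (v % n))
    mod-bip .perᵢ i v = ≡.refl
    mod-bip .perᵥ i v = cong +_ (≡.trans (cong (λ z → (v + z) % n) (sym (ℕ.*-identityˡ n))) ([m+kn]%n≡m%n v 1 n))

    +-%ˡ : ∀ a b → (a % n + b) % n ≡ (a + b) % n
    +-%ˡ a b = ≡.trans (%-distribˡ-+ (a % n) b n) (≡.trans (cong (λ z → (z + b % n) % n) (m%n%n≡m%n a n)) (sym (%-distribˡ-+ a b n)))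

    +-%ʳ : ∀ a b → (a + b % n) % n ≡ (a + b) % n
    +-%ʳ a b = ≡.trans (cong (_% n) (ℕ.+-comm a (b % n))) (≡.trans (+-%ˡ b a) (cong (_% n) (ℕ.+-comm b a)))

    *-%ʳ : ∀ a b → (a * (b % n)) % n ≡ (a * b) % n
    *-%ʳ a b = ≡.trans (%-distribˡ-* a (b % n) n) (≡.trans (cong (λ z → (a % n * z) % n) (m%n%n≡m%n b n)) (sym (%-distribˡ-* a b n)))

    arc⇒Arrow : ∀ {a b} → T (arc a b) → Arrow a b
    arc⇒Arrow {a} {b} p with find (any⁻ _ residues p)
    ... | r , r∈ , eq with ∈-applyUpTo⁻ (λ j → g ^ j % n) (subst (r ∈_) residues≡ r∈)
    ... | j , _ , r≡ = j , ≡.trans (sym (+-%ʳ a (s j))) (≡.trans (cong (λ z → (a + z) % n) (sym r≡)) (ℕ.≡ᵇ⇒≡ _ b eq))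

    Arrow⇒arc : ∀ {a b} → Arrow a b → T (arc a b)
    Arrow⇒arc {a} {b} (j , eq) = any⁺ _ (lose
      (subst (s (j % m) % n ∈_) (sym residues≡) (∈-applyUpTo⁺ (λ j → g ^ j % n) (m%n<n j m)))
      (ℕ.≡⇒≡ᵇ _ b (≡.trans (+-%ʳ a (s (j % m))) (≡.trans (period-% m (λ j → (a + s j) % n) (λ j → ℤₚ.+-injective (full-turn mod-bip 0 a j)) j) eq))))

    Arrow-sym : ∀ {a b} → a < n → Arrow a b → Arrow b a
    Arrow-sym {a} {b} a<n (j , eq) = j + h , (begin
      (b + s (j + h)) % n                 ≡⟨ cong (λ z → (z + s (j + h)) % n) eq ⟨
      ((a + s j) % n + s (j + h)) % n     ≡⟨ +-%ˡ (a + s j) _ ⟩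
      (a + s j + s (j + h)) % n           ≡⟨ ℤₚ.+-injective (opposite mod-bip 0 a j) ⟩
      a % n                               ≡⟨ m<n⇒m%n≡m a<n ⟩
      a                                   ∎)
      where open ≡-Reasoning

    edge-at-n : ∀ {x} → T (edge n x) → T (inW x)
    edge-at-n {x} p with ∨-elim p
    ... | inj₁ u = ⊥-elim (ℕ.<-irrefl ≡.refl (ℕ.<ᵇ⇒< n n (proj₁ (∧-elim (proj₁ (∧-elim u))))))
    ... | inj₂ u with ∨-elim u
    ... | inj₁ v = proj₂ (∧-elim v)
    ... | inj₂ v with ∧-elim v
    ... | x≡n , n∈W = subst (T ∘ inW) (sym (ℕ.≡ᵇ⇒≡ x n x≡n)) n∈W

    edge-below-n : ∀ {x y} → x ≢ n → y ≢ n → T (edge x y) → x < n × y < n × Arrow x y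
    edge-below-n {x} {y} x≢n y≢n p with ∨-elim p
    ... | inj₂ u = ⊥-elim (case ∨-elim u of λ where
      (inj₁ v) → x≢n (ℕ.≡ᵇ⇒≡ x n (proj₁ (∧-elim v)))
      (inj₂ v) → y≢n (ℕ.≡ᵇ⇒≡ y n (proj₁ (∧-elim v))))
    ... | inj₁ u with ∧-elim u
    ... | x,y , v with ∧-elim x,y
    ... | x<ᵇn , y<ᵇn = x<n , y<n , (case ∨-elim v of λ where
      (inj₁ a) → arc⇒Arrow a
      (inj₂ a) → Arrow-sym y<n (arc⇒Arrow a))
      where
      x<n = ℕ.<ᵇ⇒< x n x<ᵇn
      y<n = ℕ.<ᵇ⇒< y n y<ᵇn

    edge-of-Arrow : ∀ {x y} → x < n → y < n → Arrow x y → T (edge x y)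
    edge-of-Arrow x<n y<n a = Equivalence.from T-∨ (inj₁ (Equivalence.from T-∧
      (Equivalence.from T-∧ (ℕ.<⇒<ᵇ x<n , ℕ.<⇒<ᵇ y<n) , Equivalence.from T-∨ (inj₁ (Arrow⇒arc a)))))

    -- The affine maps x ↦ sₖ (x - a) preserve arrows; one of them takes a given arrow to (0 , 1).
    module _ (a k : ℕ) where

      φ : ℕ → ℕ
      φ x = s k * (x + (n ∸ a)) % n

      φ-Arrow : ∀ {x y} → Arrow x y → Arrow (φ x) (φ y)
      φ-Arrow {x} {y} (j , eq) = k + j , (begin
        (φ x + s (k + j)) % n                            ≡⟨ +-%ˡ (s k * (x + (n ∸ a))) _ ⟩
        (s k * (x + (n ∸ a)) + s (k + j)) % n            ≡⟨ cong (λ z → (s k * (x + (n ∸ a)) + z) % n) (s-+ k j) ⟩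
        (s k * (x + (n ∸ a)) + s k * s j) % n            ≡⟨ cong (_% n) (lemma (s k) x (n ∸ a) (s j)) ⟩
        (s k * (x + s j + (n ∸ a))) % n                  ≡⟨ *-%ʳ (s k) _ ⟨
        (s k * ((x + s j + (n ∸ a)) % n)) % n            ≡⟨ cong (λ z → (s k * z) % n) (+-%ˡ (x + s j) (n ∸ a)) ⟨
        (s k * (((x + s j) % n + (n ∸ a)) % n)) % n      ≡⟨ *-%ʳ (s k) _ ⟩
        (s k * ((x + s j) % n + (n ∸ a))) % n            ≡⟨ cong (λ z → (s k * (z + (n ∸ a))) % n) eq ⟩
        φ y                                              ∎)
        where
        open ≡-Reasoning
        lemma : ∀ k x a j → k * (x + a) + k * j ≡ k * (x + j + a)
        lemma = ℕSolver.solve-∀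

      φ-origin : a < n → φ a ≡ 0
      φ-origin a<n = ≡.trans (cong (λ z → s k * z % n) (ℕ.m+[n∸m]≡n (ℕ.<⇒≤ a<n))) (m*n%n≡0 (s k) n)

      φ-<n : ∀ x → φ x < n
      φ-<n x = m%n<n _ n

    s-multiple : ∀ i k → s (i + k * m) % n ≡ s i % n
    s-multiple i k = period-* m (λ j → s j % n) (λ j → ℤₚ.+-injective (full-turn mod-bip 0 0 j)) i k

    normalize : ∀ {a b} → a < n → Arrow a b → Σ ℕ λ k → φ a k b ≡ 1 % n
    normalize {a} {b} a<n (i , eq) = k , (begin
      s k * (b + (n ∸ a)) % n                    ≡⟨ cong (λ z → s k * (z + (n ∸ a)) % n) eq ⟨
      s k * ((a + s i) % n + (n ∸ a)) % n        ≡⟨ *-%ʳ (s k) _ ⟨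
      s k * (((a + s i) % n + (n ∸ a)) % n) % n  ≡⟨ cong (λ z → s k * z % n) (+-%ˡ (a + s i) (n ∸ a)) ⟩
      s k * ((a + s i + (n ∸ a)) % n) % n        ≡⟨ cong (λ z → s k * (z % n) % n) (≡.trans (lemma a (s i) (n ∸ a)) (cong (λ z → s i + z) (ℕ.m+[n∸m]≡n (ℕ.<⇒≤ a<n)))) ⟩
      s k * ((s i + n) % n) % n                  ≡⟨ cong (λ z → s k * z % n) (ℤₚ.+-injective (perᵥ mod-bip 0 (s i))) ⟩
      s k * (s i % n) % n                        ≡⟨ *-%ʳ (s k) (s i) ⟩
      s k * s i % n                              ≡⟨ cong (_% n) (s-+ k i) ⟨
      s (k + i) % n                              ≡⟨ cong (λ z → s z % n) (≡.trans (ℕ.+-comm k i) (≡.trans (sym (ℕ.*-suc i (m ∸ 1))) (cong (i *_) (ℕ.m+[n∸m]≡n (>-nonZero⁻¹ m))))) ⟩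
      s (i * m) % n                              ≡⟨ s-multiple 0 i ⟩
      1 % n                                      ∎)
      where
      open ≡-Reasoning
      k : ℕ
      -- The exponent of the inverse of `s i`: adding `i` gives the multiple `i * m` of the period.
      k = i * (m ∸ 1)
      lemma : ∀ a s b → a + s + b ≡ s + (a + b)
      lemma = ℕSolver.solve-∀

    -- A K₄ inside L can be moved by some `φ` so that one edge becomes (0 , 1); its other two
    -- vertices are then adjacent members of this list.
    commonNeighbours : List ℕ
    commonNeighbours = filterᵇ (λ c → arc 0 c ∧ arc (1 % n) c) (upTo n)

    vertex : ℕ → Fin V
    vertex a = _mod_ a V {{>-nonZero (ℕ.≤-trans (s≤s z≤n) n<V)}}

    module _ (loopless : any (λ a → edge a a) (upTo V) ≡ false) where

      G : SimpleGraph V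
      G .adj x y = edge (toℕ x) (toℕ y)
      G .SimpleGraph.sym x y = edge-sym (toℕ x) (toℕ y)
      G .irrefl x with edge (toℕ x) (toℕ x) in eq
      ... | false = ≡.refl
      ... | true  = ⊥-elim (none (λ a → edge a a) loopless (∈-upTo⁺ (toℕ<n x)) (Equivalence.from T-≡ eq))

      module _ (W-triangle-free : any (λ a → any (λ b → arc a b ∧ any (λ c → arc a c ∧ arc b c) W) W) W ≡ false)
               (W<n : All (_< n) W)
               (independent : any (λ c → any (λ d → arc c d) commonNeighbours) commonNeighbours ≡ false) where

        inW⇒∈ : ∀ {x} → T (inW x) → x ∈ W
        inW⇒∈ {x} p = Any.map (λ {y} eq → sym (ℕ.≡ᵇ⇒≡ y x eq)) (any⁻ _ W p)

        arcs-in-W : ∀ {b c} → b ∈ W → c ∈ W → T (edge b c) → T (arc b c)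
        arcs-in-W b∈ c∈ e = Arrow⇒arc (proj₂ (proj₂ (edge-below-n (ℕ.<⇒≢ (All.lookup W<n b∈)) (ℕ.<⇒≢ (All.lookup W<n c∈)) e)))

        no-K₄-at-n : ∀ {b c d} → T (edge n b) → T (edge n c) → T (edge n d) → T (edge b c) → T (edge b d) → T (edge c d) → ⊥
        no-K₄-at-n {b} {c} {d} nb nc nd bc bd cd = none _ W-triangle-free b∈ (any⁺ _ (lose c∈
          (Equivalence.from T-∧ (arcs-in-W b∈ c∈ bc , any⁺ _ (lose d∈
          (Equivalence.from T-∧ (arcs-in-W b∈ d∈ bd , arcs-in-W c∈ d∈ cd)))))))
          where
          b∈ = inW⇒∈ (edge-at-n {b} nb)
          c∈ = inW⇒∈ (edge-at-n {c} nc)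
          d∈ = inW⇒∈ (edge-at-n {d} nd)

        no-arc-K₄ : ∀ {a b c d} → a < n → Arrow a b → Arrow a c → Arrow a d → Arrow b c → Arrow b d → Arrow c d → ⊥
        no-arc-K₄ {a} {b} {c} {d} a<n ab ac ad bc bd cd =
          none _ independent (common ac bc) (any⁺ _ (lose (common ad bd) (Arrow⇒arc (φ-Arrow a k cd))))
          where
          k : ℕ
          k = proj₁ (normalize a<n ab)
          common : ∀ {x} → Arrow a x → Arrow b x → φ a k x ∈ commonNeighbours
          common {x} ax bx = ∈-filter⁺ (T? ∘ λ c → arc 0 c ∧ arc (1 % n) c) (∈-upTo⁺ (φ-<n a k x)) (Equivalence.from T-∧
            ( Arrow⇒arc (subst (λ z → Arrow z (φ a k x)) (φ-origin a k a<n) (φ-Arrow a k ax))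
            , Arrow⇒arc (subst (λ z → Arrow z (φ a k x)) (proj₂ (normalize a<n ab)) (φ-Arrow a k bx))))

        no-K₄ : ∀ a b c d → T (edge a b) → T (edge a c) → T (edge a d) → T (edge b c) → T (edge b d) → T (edge c d) → ⊥
        no-K₄ a b c d ab ac ad bc bd cd with a ℕ.≟ n | b ℕ.≟ n | c ℕ.≟ n | d ℕ.≟ n
        ... | yes ≡.refl | _ | _ | _ = no-K₄-at-n {b} {c} {d} ab ac ad bc bd cd
        ... | no _ | yes ≡.refl | _ | _ = no-K₄-at-n {a} {c} {d} (flipᵉ a b ab) bc bd ac ad cd
          where
          flipᵉ : ∀ x y → T (edge x y) → T (edge y x)
          flipᵉ x y = subst T (edge-sym x y)
        ... | no _ | no _ | yes ≡.refl | _ = no-K₄-at-n {a} {b} {d} (subst T (edge-sym a c) ac) (subst T (edge-sym b c) bc) cd ab ad bd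
        ... | no _ | no _ | no _ | yes ≡.refl = no-K₄-at-n {a} {b} {c} (subst T (edge-sym a d) ad) (subst T (edge-sym b d) bd) (subst T (edge-sym c d) cd) ab ac bc
        ... | no a≢ | no b≢ | no c≢ | no d≢ = no-arc-K₄ (proj₁ (edge-below-n a≢ b≢ ab))
          (arrow a≢ b≢ ab) (arrow a≢ c≢ ac) (arrow a≢ d≢ ad) (arrow b≢ c≢ bc) (arrow b≢ d≢ bd) (arrow c≢ d≢ cd)
          where
          arrow : ∀ {x y} → x ≢ n → y ≢ n → T (edge x y) → Arrow x y
          arrow x≢ y≢ e = proj₂ (proj₂ (edge-below-n x≢ y≢ e))

        K₄-free : K4Free G
        K₄-free (a , b , c , d , ab , ac , ad , bc , bd , cd) =
          no-K₄ (toℕ a) (toℕ b) (toℕ c) (toℕ d) (t ab) (t ac) (t ad) (t bc) (t bd) (t cd)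
          where
          t : ∀ {b} → b ≡ true → T b
          t = Equivalence.from T-≡

  -- Δ is the set of exponents t for which v, v + gⁱ, v + gⁱ⁺ᵗ form a triangle.
  module Local (Δ : List ℕ) (Δ≤m : All (_≤ m) Δ) (Δ-inverse : map (λ t → m ∸ t) Δ ↭ Δ) where

    -- The same-triangle operator.

    -- Half of that operator: it collects the arcs out of the tail that span a triangle with the
    -- given arc, while `F (C f)` collects those out of its head.
    C : Arc → Arc
    C f i v = ∑ᴸ Δ λ t → f (i + t) v

    C-bip : ∀ {f} → Biperiodic f → Biperiodic (C f)
    C-bip {f} B .perᵢ i v = ∑ᴸ-cong Δ λ t → reduceᵢ B v 1 (slide i t m)
    C-bip {f} B .perᵥ i v = ∑ᴸ-cong Δ λ t → perᵥ B (i + t) v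

    C-cong : ∀ {f g} → f ≗ g → C f ≗ C g
    C-cong e i v = ∑ᴸ-cong Δ λ t → e (i + t) v

    C-L : ∀ i₀ v₀ f → C (L i₀ v₀ f) ≗ L i₀ v₀ (C f)
    C-L i₀ v₀ f j w = ∑ᴸ-cong Δ λ t → cong (λ z → f z (v₀ + s i₀ * w)) (sym (ℕ.+-assoc i₀ j t))

    ⟪⟫-C : ∀ f g → ⟪ f , C g ⟫ ≡ ∑ᴸ Δ (λ t → ⟪ f , shift t 0 g ⟫)
    ⟪⟫-C f g = begin
      ∑∑ (λ i v → f i v ℤ.* C g i v)
        ≡⟨ ∑∑-cong (λ i v → ≡.trans (∑ᴸ-*ˡ Δ _ (f i v)) (∑ᴸ-cong Δ λ t → cong (λ z → f i v ℤ.* g (i + t) z) (sym (ℕ.+-identityʳ v)))) ⟩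
      ∑∑ (λ i v → ∑ᴸ Δ λ t → (f · shift t 0 g) i v)
        ≡⟨ ∑-cong m (λ i → ∑-∑ᴸ n Δ _) ⟩
      ∑ m (λ i → ∑ᴸ Δ λ t → ∑ n λ v → (f · shift t 0 g) i v)
        ≡⟨ ∑-∑ᴸ m Δ _ ⟩
      ∑ᴸ Δ (λ t → ⟪ f , shift t 0 g ⟫) ∎
      where open ≡-Reasoning

    -- The adjoint of a shift of the exponent by `t` is the shift by `m ∸ t`, and `Δ` is closed
    -- under this negation.
    C-adjoint : ∀ {f g} → Biperiodic f → Biperiodic g → ⟪ C f , g ⟫ ≡ ⟪ f , C g ⟫
    C-adjoint {f} {g} A B = begin
      ⟪ C f , g ⟫                                          ≡⟨ ⟪⟫-comm (C f) g ⟩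
      ⟪ g , C f ⟫                                          ≡⟨ ⟪⟫-C g f ⟩
      ∑ᴸ Δ (λ t → ⟪ g , shift t 0 f ⟫)                     ≡⟨ ∑ᴸ-congᴬ Δ≤m move ⟩
      ∑ᴸ Δ (λ t → ⟪ f , shift (m ∸ t) 0 g ⟫)               ≡⟨ ∑ᴸ-map (λ t → m ∸ t) Δ _ ⟨
      ∑ᴸ (map (λ t → m ∸ t) Δ) (λ t → ⟪ f , shift t 0 g ⟫) ≡⟨ ∑ᴸ-↭ _ Δ-inverse ⟩
      ∑ᴸ Δ (λ t → ⟪ f , shift t 0 g ⟫)                     ≡⟨ ⟪⟫-C f g ⟨
      ⟪ f , C g ⟫                                          ∎
      where
      open ≡-Reasoning
      back : ∀ t → t ≤ m → shift t 0 (shift (m ∸ t) 0 g) ≗ g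
      back t t≤m i v = ≡.trans
        (cong₂ g (≡.trans (ℕ.+-assoc i t (m ∸ t)) (cong (λ z → i + z) (ℕ.m+[n∸m]≡n t≤m)))
                 (≡.trans (ℕ.+-identityʳ (v + 0)) (ℕ.+-identityʳ v)))
        (perᵢ B i v)
      move : ∀ t → t ≤ m → ⟪ g , shift t 0 f ⟫ ≡ ⟪ f , shift (m ∸ t) 0 g ⟫
      move t t≤m = begin
        ⟪ g , shift t 0 f ⟫                            ≡⟨ ⟪⟫-congˡ (shift t 0 f) (λ i v → sym (back t t≤m i v)) ⟩
        ⟪ shift t 0 (shift (m ∸ t) 0 g) , shift t 0 f ⟫ ≡⟨ shift-isometry t 0 (shift-bip (m ∸ t) 0 B) A ⟩
        ⟪ shift (m ∸ t) 0 g , f ⟫                      ≡⟨ ⟪⟫-comm _ f ⟩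
        ⟪ f , shift (m ∸ t) 0 g ⟫                      ∎

    -- Iterated squaring of the operator.

    module Chain (a : ℕ) where

      -- The list is read from right to left: its last entry is r₀, and its head belongs to the
      -- outermost squaring.
      M : List ℕ → Arc → Arc
      M []       f = + a ⊙ f ⊖ (C f ⊕ F (C f))
      M (r ∷ rs) f = M rs (M rs f) ⊖ + r ⊙ f

      M-sym : ∀ rs {f} → Symmetric f → Symmetric (M rs f)
      M-sym []       S = ⊖-sym (⊙-sym (+ a) S) (symmetrize (C-bip (bip S)))
      M-sym (r ∷ rs) S = ⊖-sym (M-sym rs (M-sym rs S)) (⊙-sym (+ r) S)

      M-cong : ∀ rs {f g} → f ≗ g → M rs f ≗ M rs g
      M-cong []       e i v = cong₂ ℤ._-_ (cong (+ a ℤ.*_) (e i v)) (cong₂ ℤ._+_ (C-cong e i v) (F-cong (C-cong e) i v))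
      M-cong (r ∷ rs) e i v = cong₂ ℤ._-_ (M-cong rs (M-cong rs e) i v) (cong (+ r ℤ.*_) (e i v))

      M-L : ∀ rs i₀ v₀ f → M rs (L i₀ v₀ f) ≗ L i₀ v₀ (M rs f)
      M-L [] i₀ v₀ f j w = cong (λ z → + a ℤ.* L i₀ v₀ f j w ℤ.- z)
        (cong₂ ℤ._+_ (C-L i₀ v₀ f j w) (≡.trans (F-cong (C-L i₀ v₀ f) j w) (F-L i₀ v₀ (C f) j w)))
      M-L (r ∷ rs) i₀ v₀ f j w = cong (ℤ._- + r ℤ.* L i₀ v₀ f j w)
        (≡.trans (M-cong rs (M-L rs i₀ v₀ f) j w) (M-L rs i₀ v₀ (M rs f) j w))

      ⟪⟫-M[] : ∀ {f g} → Symmetric f → Symmetric g → ⟪ f , M [] g ⟫ ≡ + a ℤ.* ⟪ f , g ⟫ ℤ.- (⟪ f , C g ⟫ ℤ.+ ⟪ f , C g ⟫)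
      ⟪⟫-M[] {f} {g} A B = begin
        ⟪ f , + a ⊙ g ⊖ (C g ⊕ F (C g)) ⟫
          ≡⟨ ⟪⟫-⊖ f (+ a ⊙ g) (C g ⊕ F (C g)) ⟩
        ⟪ f , + a ⊙ g ⟫ ℤ.- ⟪ f , C g ⊕ F (C g) ⟫
          ≡⟨ cong₂ ℤ._-_ (⟪⟫-⊙ (+ a) f g) (⟪⟫-⊕ f (C g) (F (C g))) ⟩
        + a ℤ.* ⟪ f , g ⟫ ℤ.- (⟪ f , C g ⟫ ℤ.+ ⟪ f , F (C g) ⟫)
          ≡⟨ cong (λ z → + a ℤ.* ⟪ f , g ⟫ ℤ.- (⟪ f , C g ⟫ ℤ.+ z)) (≡.trans (⟪⟫-comm f (F (C g))) (≡.trans (F-⟪⟫ (C-bip (bip B)) A) (⟪⟫-comm (C g) f))) ⟩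
        + a ℤ.* ⟪ f , g ⟫ ℤ.- (⟪ f , C g ⟫ ℤ.+ ⟪ f , C g ⟫) ∎
        where open ≡-Reasoning

      ⟪⟫-M∷ : ∀ r rs f g → ⟪ f , M (r ∷ rs) g ⟫ ≡ ⟪ f , M rs (M rs g) ⟫ ℤ.- + r ℤ.* ⟪ f , g ⟫
      ⟪⟫-M∷ r rs f g = ≡.trans (⟪⟫-⊖ f (M rs (M rs g)) (+ r ⊙ g)) (cong (ℤ._-_ ⟪ f , M rs (M rs g) ⟫) (⟪⟫-⊙ (+ r) f g))

      -- For symmetric arguments `F` may be dropped from `F (C g)` inside the inner product;
      -- self-adjointness of `C` does the rest.
      M-adjoint : ∀ rs {f g} → Symmetric f → Symmetric g → ⟪ M rs f , g ⟫ ≡ ⟪ f , M rs g ⟫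
      M-adjoint [] {f} {g} A B = begin
        ⟪ M [] f , g ⟫                                        ≡⟨ ⟪⟫-comm (M [] f) g ⟩
        ⟪ g , M [] f ⟫                                        ≡⟨ ⟪⟫-M[] B A ⟩
        + a ℤ.* ⟪ g , f ⟫ ℤ.- (⟪ g , C f ⟫ ℤ.+ ⟪ g , C f ⟫)   ≡⟨ cong₂ (λ x y → + a ℤ.* x ℤ.- (y ℤ.+ y)) (⟪⟫-comm g f) (≡.trans (⟪⟫-comm g (C f)) (C-adjoint (bip A) (bip B))) ⟩
        + a ℤ.* ⟪ f , g ⟫ ℤ.- (⟪ f , C g ⟫ ℤ.+ ⟪ f , C g ⟫)   ≡⟨ ⟪⟫-M[] A B ⟨
        ⟪ f , M [] g ⟫                                        ∎
        where open ≡-Reasoning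
      M-adjoint (r ∷ rs) {f} {g} A B = begin
        ⟪ M (r ∷ rs) f , g ⟫                                  ≡⟨ ⟪⟫-comm (M (r ∷ rs) f) g ⟩
        ⟪ g , M (r ∷ rs) f ⟫                                  ≡⟨ ⟪⟫-M∷ r rs g f ⟩
        ⟪ g , M rs (M rs f) ⟫ ℤ.- + r ℤ.* ⟪ g , f ⟫           ≡⟨ cong₂ (λ x y → x ℤ.- + r ℤ.* y) step (⟪⟫-comm g f) ⟩
        ⟪ f , M rs (M rs g) ⟫ ℤ.- + r ℤ.* ⟪ f , g ⟫           ≡⟨ ⟪⟫-M∷ r rs f g ⟨
        ⟪ f , M (r ∷ rs) g ⟫                                  ∎
        where
        open ≡-Reasoning
        step : ⟪ g , M rs (M rs f) ⟫ ≡ ⟪ f , M rs (M rs g) ⟫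
        step = ≡.trans (⟪⟫-comm g _) (≡.trans (M-adjoint rs (M-sym rs A) B) (M-adjoint rs A (M-sym rs B)))

      c : ℤ → List ℕ → ℤ
      c c₀ []       = c₀
      c c₀ (r ∷ rs) = c c₀ rs ℤ.* c c₀ rs ℤ.- + r

      NonNegative-c : ℤ → List ℕ → Set
      NonNegative-c c₀ []       = ⊤
      NonNegative-c c₀ (r ∷ rs) = 0ℤ ℤ.≤ c c₀ rs × NonNegative-c c₀ rs

      -- With k the previous constant, expanding ⟪ Mf - kf , Mf - kf ⟫ ≥ 0 gives ⟪ f , M²f ⟫ ≥ 2k⟪ f
      -- , Mf ⟫ - k²⟪ f , f ⟫, which is at least k²⟪ f , f ⟫ by induction and k ≥ 0.
      M-lower : ∀ c₀ {f} → Symmetric f → c₀ ℤ.* ⟪ f , f ⟫ ℤ.≤ ⟪ f , M [] f ⟫ →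
                ∀ rs → NonNegative-c c₀ rs → c c₀ rs ℤ.* ⟪ f , f ⟫ ℤ.≤ ⟪ f , M rs f ⟫
      M-lower c₀ S le [] _ = le
      M-lower c₀ {f} S le (r ∷ rs) (c≥0 , cs≥0) = begin
        (k ℤ.* k ℤ.- + r) ℤ.* N                            ≡⟨ lemma₁ k (+ r) N ⟩
        (k ℤ.* (k ℤ.* N ℤ.+ k ℤ.* N) ℤ.- k ℤ.* k ℤ.* N) ℤ.- + r ℤ.* N
          ≤⟨ ℤₚ.+-monoˡ-≤ (ℤ.- (+ r ℤ.* N)) (ℤₚ.+-monoˡ-≤ (ℤ.- (k ℤ.* k ℤ.* N)) (ℤₚ.*-monoˡ-≤-nonNeg k {{ℤ.nonNegative c≥0}} (ℤₚ.+-mono-≤ ih ih))) ⟩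
        (k ℤ.* (X ℤ.+ X) ℤ.- k ℤ.* k ℤ.* N) ℤ.- + r ℤ.* N  ≤⟨ ℤₚ.+-monoˡ-≤ (ℤ.- (+ r ℤ.* N)) convex ⟩
        ⟪ y , y ⟫ ℤ.- + r ℤ.* N                            ≡⟨ cong (ℤ._- + r ℤ.* N) (M-adjoint rs S (M-sym rs S)) ⟩
        ⟪ f , M rs y ⟫ ℤ.- + r ℤ.* N                       ≡⟨ ⟪⟫-M∷ r rs f f ⟨
        ⟪ f , M (r ∷ rs) f ⟫                               ∎
        where
        open ℤₚ.≤-Reasoning
        k N X : ℤ
        k = c c₀ rs
        N = ⟪ f , f ⟫
        y : Arc
        y = M rs f
        X = ⟪ f , y ⟫
        ih : k ℤ.* N ℤ.≤ X
        ih = M-lower c₀ S le rs cs≥0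
        lemma₁ : ∀ k r N → (k ℤ.* k ℤ.- r) ℤ.* N ≡ (k ℤ.* (k ℤ.* N ℤ.+ k ℤ.* N) ℤ.- k ℤ.* k ℤ.* N) ℤ.- r ℤ.* N
        lemma₁ = solve-∀
        lemma₂ : ∀ k N X Y → ((Y ℤ.- k ℤ.* X) ℤ.- k ℤ.* (X ℤ.- k ℤ.* N)) ℤ.+ (k ℤ.* (X ℤ.+ X) ℤ.- k ℤ.* k ℤ.* N) ≡ Y
        lemma₂ = solve-∀
        d : Arc
        d = y ⊖ k ⊙ f
        pair-d : ∀ e → ⟪ e , d ⟫ ≡ ⟪ e , y ⟫ ℤ.- k ℤ.* ⟪ e , f ⟫
        pair-d e = ≡.trans (⟪⟫-⊖ e y (k ⊙ f)) (cong (ℤ._-_ ⟪ e , y ⟫) (⟪⟫-⊙ k e f))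
        expand : ⟪ d , d ⟫ ≡ (⟪ y , y ⟫ ℤ.- k ℤ.* X) ℤ.- k ℤ.* (X ℤ.- k ℤ.* N)
        expand = ≡.trans (pair-d d) (cong₂ (λ p q → p ℤ.- k ℤ.* q)
          (≡.trans (⟪⟫-comm d y) (≡.trans (pair-d y) (cong (λ z → ⟪ y , y ⟫ ℤ.- k ℤ.* z) (⟪⟫-comm y f))))
          (≡.trans (⟪⟫-comm d f) (pair-d f)))
        convex : k ℤ.* (X ℤ.+ X) ℤ.- k ℤ.* k ℤ.* N ℤ.≤ ⟪ y , y ⟫
        convex = begin
          k ℤ.* (X ℤ.+ X) ℤ.- k ℤ.* k ℤ.* N  ≡⟨ ℤₚ.+-identityˡ _ ⟨
          0ℤ ℤ.+ (k ℤ.* (X ℤ.+ X) ℤ.- k ℤ.* k ℤ.* N) ≤⟨ ℤₚ.+-monoˡ-≤ _ (⟪⟫-nonneg d) ⟩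
          ⟪ d , d ⟫ ℤ.+ (k ℤ.* (X ℤ.+ X) ℤ.- k ℤ.* k ℤ.* N) ≡⟨ cong (ℤ._+ (k ℤ.* (X ℤ.+ X) ℤ.- k ℤ.* k ℤ.* N)) expand ⟩
          ((⟪ y , y ⟫ ℤ.- k ℤ.* X) ℤ.- k ℤ.* (X ℤ.- k ℤ.* N)) ℤ.+ (k ℤ.* (X ℤ.+ X) ℤ.- k ℤ.* k ℤ.* N) ≡⟨ lemma₂ k N X ⟪ y , y ⟫ ⟩
          ⟪ y , y ⟫ ∎

    -- With p the exponent of t, the exponents of 1 - t and of 1 - 1/t are σ p and τ p:
    -- these are the exponents under which the triangle is seen from its two other vertices.
    module Good (σ τ : ℕ → ℕ) (e : ℕ) (|Δ|≡3e : length Δ ≡ 3 * e) (σ-perm : map σ Δ ↭ Δ) (τ-perm : map τ Δ ↭ Δ) where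

      -- The quadratic form of a colouring without monochromatic triangles.

      -- Both congruences describe the triangle v, v + gⁱ, v + gⁱ⁺ᵖ. The second closes it, being 1 -
      -- g^(σ p) = gᵖ; the first says that its third edge, taken from the third vertex, has exponent
      -- τ p relative to the reversed edge back to v.
      Corner : ℕ → Set
      Corner p = ((h + σ p + h) % m ≡ (p + h + τ p) % m) × ((1 + s (h + σ p)) % n ≡ s p % n)

      corner? : ∀ p → Dec (Corner p)
      corner? p = ((h + σ p + h) % m ℕ.≟ (p + h + τ p) % m) ×-dec ((1 + s (h + σ p)) % n ℕ.≟ s p % n)

      third-vertex : ∀ {f} → Biperiodic f → ∀ {p} → Corner p → ∀ j i v → f j (v + s i + s (i + h + σ p)) ≡ f j (v + s (i + p))
      third-vertex {f} B {p} (_ , e₂) j i v = begin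
        f j (v + s i + s (i + h + σ p))     ≡⟨ cong (f j) (≡.trans (cong (λ z → v + s i + z) (≡.trans (cong s (ℕ.+-assoc i h (σ p))) (s-+ i (h + σ p)))) (lemma v (s i) _)) ⟩
        f j (v + s i * (1 + s (h + σ p)))   ≡⟨ period-≡ n (λ z → f j (v + s i * z)) per e₂ ⟩
        f j (v + s i * s p)                 ≡⟨ cong (λ z → f j (v + z)) (s-+ i p) ⟨
        f j (v + s (i + p))                 ∎
        where
        open ≡-Reasoning
        lemma : ∀ v a b → v + a + a * b ≡ v + a * (1 + b)
        lemma = ℕSolver.solve-∀
        per : ∀ z → f j (v + s i * (z + n)) ≡ f j (v + s i * z)
        per z = reduceᵥ B j (s i) (lemma₂ v (s i) z n)
          where
          lemma₂ : ∀ a b c d → a + b * (c + d) ≡ a + b * c + b * d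
          lemma₂ = ℕSolver.solve-∀

      module _ {x : Arc} (S : Symmetric x) (corners : All Corner Δ)
               (x²≡1 : ∀ i v → x i v ℤ.* x i v ≡ 1ℤ)
               (nae : ∀ {p} → Corner p → ∀ i v →
                      x i v ℤ.* x (i + p) v ℤ.+ (x i v ℤ.* x (i + h + σ p) (v + s i) ℤ.+ x (i + p) v ℤ.* x (i + h + σ p) (v + s i)) ≡ ℤ.-1ℤ) where

        N : ℤ
        N = ⟪ x , x ⟫

        -- The third edge of the triangle, leaving the head of the first edge on the left and the
        -- head of the second edge on the right; symmetry of `x` identifies the two orientations.
        opposite-edge : ∀ {p} → Corner p → F (shift (σ p) 0 x) ≗ shift p 0 (F (shift (τ p) 0 x))
        opposite-edge {p} κ@(e₁ , _) i v = begin
          x (i + h + σ p) (v + s i + 0)                     ≡⟨ cong (x (i + h + σ p)) (ℕ.+-identityʳ _) ⟩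
          x (i + h + σ p) (v + s i)                         ≡⟨ flip S (i + h + σ p) (v + s i) ⟨
          x (i + h + σ p + h) (v + s i + s (i + h + σ p))   ≡⟨ third-vertex (bip S) κ _ i v ⟩
          x (i + h + σ p + h) (v + s (i + p))               ≡⟨ cong (λ z → x z (v + s (i + p))) (lemma i h (σ p)) ⟩
          x (i + (h + σ p + h)) (v + s (i + p))             ≡⟨ period-≡ m (λ z → x (i + z) (v + s (i + p))) (λ z → reduceᵢ (bip S) _ 1 (lemma₂ i z m)) e₁ ⟩
          x (i + (p + h + τ p)) (v + s (i + p))             ≡⟨ cong₂ x (lemma₃ i p h (τ p)) (lemma₄ v (s (i + p))) ⟩
          x (i + p + h + τ p) (v + 0 + s (i + p) + 0)       ∎
          where
          open ≡-Reasoning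
          lemma : ∀ i h a → i + h + a + h ≡ i + (h + a + h)
          lemma = ℕSolver.solve-∀
          lemma₂ : ∀ i z m → i + (z + m) ≡ i + z + 1 * m
          lemma₂ = ℕSolver.solve-∀
          lemma₃ : ∀ i p h t → i + (p + h + t) ≡ i + p + h + t
          lemma₃ = ℕSolver.solve-∀
          lemma₄ : ∀ v a → v + a ≡ v + 0 + a + 0
          lemma₄ = ℕSolver.solve-∀

        -- Summed over all arcs, the product at a corner depends only on the exponent between the
        -- two edges meeting there, since moving that corner to the tail is an isometry.
        corner-sum : ∀ p → Corner p →
          ⟪ x , shift p 0 x ⟫ ℤ.+ (⟪ x , shift (σ p) 0 x ⟫ ℤ.+ ⟪ x , shift (τ p) 0 x ⟫) ≡ ℤ.- N
        corner-sum p κ = begin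
          ⟪ x , x₂ ⟫ ℤ.+ (⟪ x , shift (σ p) 0 x ⟫ ℤ.+ ⟪ x , shift (τ p) 0 x ⟫)
            ≡⟨ cong (ℤ._+_ ⟪ x , x₂ ⟫) (cong₂ ℤ._+_ second third) ⟨
          ⟪ x , x₂ ⟫ ℤ.+ (⟪ x , x₃ ⟫ ℤ.+ ⟪ x₂ , x₃ ⟫)
            ≡⟨ cong (ℤ._+_ ⟪ x , x₂ ⟫) (∑∑-⊕ (x · x₃) (x₂ · x₃)) ⟨
          ⟪ x , x₂ ⟫ ℤ.+ ∑∑ (x · x₃ ⊕ x₂ · x₃)
            ≡⟨ ∑∑-⊕ (x · x₂) (x · x₃ ⊕ x₂ · x₃) ⟨
          ∑∑ (x · x₂ ⊕ (x · x₃ ⊕ x₂ · x₃))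
            ≡⟨ ∑∑-cong pointwise ⟩
          ∑∑ (ℤ.-1ℤ ⊙ (x · x))
            ≡⟨ ∑∑-⊙ ℤ.-1ℤ (x · x) ⟩
          ℤ.-1ℤ ℤ.* N
            ≡⟨ ℤₚ.-1*i≡-i N ⟩
          ℤ.- N ∎
          where
          open ≡-Reasoning
          x₂ x₃ : Arc
          x₂ = shift p 0 x
          x₃ = F (shift (σ p) 0 x)
          B = bip S
          second : ⟪ x , x₃ ⟫ ≡ ⟪ x , shift (σ p) 0 x ⟫
          second = ≡.trans (⟪⟫-comm x x₃) (≡.trans (F-⟪⟫ (shift-bip (σ p) 0 B) S) (⟪⟫-comm _ x))
          third : ⟪ x₂ , x₃ ⟫ ≡ ⟪ x , shift (τ p) 0 x ⟫
          third = begin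
            ⟪ x₂ , x₃ ⟫                                        ≡⟨ ⟪⟫-congʳ x₂ (opposite-edge κ) ⟩
            ⟪ shift p 0 x , shift p 0 (F (shift (τ p) 0 x)) ⟫  ≡⟨ shift-isometry p 0 B (F-bip (shift-bip (τ p) 0 B)) ⟩
            ⟪ x , F (shift (τ p) 0 x) ⟫                        ≡⟨ ⟪⟫-comm x _ ⟩
            ⟪ F (shift (τ p) 0 x) , x ⟫                        ≡⟨ F-⟪⟫ (shift-bip (τ p) 0 B) S ⟩
            ⟪ shift (τ p) 0 x , x ⟫                            ≡⟨ ⟪⟫-comm _ x ⟩
            ⟪ x , shift (τ p) 0 x ⟫                            ∎
          pointwise : x · x₂ ⊕ (x · x₃ ⊕ x₂ · x₃) ≗ ℤ.-1ℤ ⊙ (x · x)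
          pointwise i v = begin
            (x · x₂ ⊕ (x · x₃ ⊕ x₂ · x₃)) i v
              ≡⟨ cong₂ (λ a b → x i v ℤ.* a ℤ.+ (x i v ℤ.* b ℤ.+ a ℤ.* b))
                       (cong (x (i + p)) (ℕ.+-identityʳ v)) (cong (x (i + h + σ p)) (ℕ.+-identityʳ (v + s i))) ⟩
            _ ≡⟨ nae κ i v ⟩
            ℤ.-1ℤ                       ≡⟨ cong (ℤ._*_ ℤ.-1ℤ) (x²≡1 i v) ⟨
            ℤ.-1ℤ ℤ.* (x i v ℤ.* x i v) ∎

        -- As `σ` and `τ` permute `Δ`, summing `corner-sum` over `Δ` counts the form three times,
        -- against 3e copies of `ℤ.- N`.
        good-form : ⟪ x , C x ⟫ ≡ ℤ.- (+ e) ℤ.* N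
        good-form = ℤₚ.*-cancelˡ-≡ (+ 3) _ _ (begin
          + 3 ℤ.* ⟪ x , C x ⟫
            ≡⟨ thrice ⟪ x , C x ⟫ ⟩
          ⟪ x , C x ⟫ ℤ.+ (⟪ x , C x ⟫ ℤ.+ ⟪ x , C x ⟫)
            ≡⟨ cong₂ ℤ._+_ (⟪⟫-C x x) (cong₂ ℤ._+_ (reindex σ σ-perm) (reindex τ τ-perm)) ⟩
          ∑ᴸ Δ k ℤ.+ (∑ᴸ Δ (λ p → k (σ p)) ℤ.+ ∑ᴸ Δ (λ p → k (τ p)))
            ≡⟨ cong (ℤ._+_ (∑ᴸ Δ k)) (∑ᴸ-+ Δ (λ p → k (σ p)) (λ p → k (τ p))) ⟨
          ∑ᴸ Δ k ℤ.+ ∑ᴸ Δ (λ p → k (σ p) ℤ.+ k (τ p))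
            ≡⟨ ∑ᴸ-+ Δ k _ ⟨
          ∑ᴸ Δ (λ p → k p ℤ.+ (k (σ p) ℤ.+ k (τ p)))
            ≡⟨ ∑ᴸ-congᴬ corners corner-sum ⟩
          ∑ᴸ Δ (λ _ → ℤ.- N)
            ≡⟨ ∑ᴸ-const Δ (ℤ.- N) ⟩
          + length Δ ℤ.* ℤ.- N
            ≡⟨ cong (λ l → + l ℤ.* ℤ.- N) |Δ|≡3e ⟩
          + (3 * e) ℤ.* ℤ.- N
            ≡⟨ cong (ℤ._* ℤ.- N) (ℤₚ.pos-* 3 e) ⟩
          + 3 ℤ.* + e ℤ.* ℤ.- N
            ≡⟨ regroup (+ 3) (+ e) N ⟩
          + 3 ℤ.* (ℤ.- (+ e) ℤ.* N) ∎)
          where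
          open ≡-Reasoning
          k : ℕ → ℤ
          k t = ⟪ x , shift t 0 x ⟫
          thrice : ∀ z → + 3 ℤ.* z ≡ z ℤ.+ (z ℤ.+ z)
          thrice = solve-∀
          regroup : ∀ a b c → a ℤ.* b ℤ.* ℤ.- c ≡ a ℤ.* (ℤ.- b ℤ.* c)
          regroup = solve-∀
          reindex : ∀ ρ → map ρ Δ ↭ Δ → ⟪ x , C x ⟫ ≡ ∑ᴸ Δ (λ p → k (ρ p))
          reindex ρ perm = ≡.trans (⟪⟫-C x x) (≡.trans (sym (∑ᴸ-↭ k perm)) (∑ᴸ-map ρ Δ k))

    -- Correctness of the packed evaluation.

    module Representation (a B : ℕ) .{{a≢0 : NonZero a}} .{{B≢0 : NonZero B}} where

      open Chain a
      open Evaluator n m h g Δ a B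

      -- Digits are the values moved by one common `offset` to make them natural numbers. The offset
      -- lives only in the proof and is never part of the computation.
      record Rep (D : ℕ) (f : Arc) (Ps : List ℕ) : Set where
        field
          digit  : ℕ → ℕ → ℕ
          offset : ℤ
          value  : ∀ j w → f j w ℤ.+ offset ≡ + digit j w
          small  : ∀ j w → digit j w ≤ D
          packed : Ps ≡ applyUpTo (λ j → pack B n (digit j)) m

        module _ (P : Biperiodic f) where

          digit-perᵢ : ∀ j w → digit (j + m) w ≡ digit j w
          digit-perᵢ j w = ℤₚ.+-injective (≡.trans (sym (value (j + m) w)) (≡.trans (cong (ℤ._+ offset) (perᵢ P j w)) (value j w)))

          digit-perᵥ : ∀ j w → digit j (w + n) ≡ digit j w
          digit-perᵥ j w = ℤₚ.+-injective (≡.trans (sym (value j (w + n))) (≡.trans (cong (ℤ._+ offset) (perᵥ P j w)) (value j w)))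

      open Rep public

      sum-rep : ∀ {D D′ f f′ Ps Ps′} → Rep D f Ps → Rep D′ f′ Ps′ → Rep (D + D′) (f ⊕ f′) (sumᴾ Ps Ps′)
      sum-rep R R′ .digit j w = digit R j w + digit R′ j w
      sum-rep R R′ .offset = offset R ℤ.+ offset R′
      sum-rep {f = f} {f′} R R′ .value j w = ≡.trans (lemma (f j w) (f′ j w) (offset R) (offset R′)) (cong₂ ℤ._+_ (value R j w) (value R′ j w))
        where
        lemma : ∀ a b c d → a ℤ.+ b ℤ.+ (c ℤ.+ d) ≡ (a ℤ.+ c) ℤ.+ (b ℤ.+ d)
        lemma = solve-∀
      sum-rep R R′ .small j w = ℕ.+-mono-≤ (small R j w) (small R′ j w)
      sum-rep R R′ .packed = ≡.trans (cong₂ sumᴾ (packed R) (packed R′))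
        (≡.trans (zipWith-applyUpTo _+_ _ _ m) (applyUpTo-cong (λ j → sym (pack-+ B n (digit R j) (digit R′ j))) m))

      scale-rep : ∀ k {D f Ps} → Rep D f Ps → Rep (k * D) (+ k ⊙ f) (scaleᴾ k Ps)
      scale-rep k R .digit j w = k * digit R j w
      scale-rep k R .offset = + k ℤ.* offset R
      scale-rep k {f = f} R .value j w = ≡.trans (sym (ℤₚ.*-distribˡ-+ (+ k) (f j w) (offset R)))
        (≡.trans (cong (ℤ._*_ (+ k)) (value R j w)) (sym (ℤₚ.pos-* k (digit R j w))))
      scale-rep k R .small j w = ℕ.*-monoʳ-≤ k (small R j w)
      scale-rep k R .packed = ≡.trans (cong (scaleᴾ k) (packed R))
        (≡.trans (map-applyUpTo _ (k *_) m) (applyUpTo-cong (λ j → sym (pack-* B n k (digit R j))) m))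

      diff-rep : ∀ {D D′ f f′ Ps Ps′} → Rep D f Ps → Rep D′ f′ Ps′ → Rep (D + D′) (f ⊖ f′) (diffᴾ (D′ * ones) Ps Ps′)
      diff-rep {D′ = D′} R R′ .digit j w = digit R j w + (D′ ∸ digit R′ j w)
      diff-rep {D′ = D′} R R′ .offset = offset R ℤ.+ (+ D′ ℤ.- offset R′)
      diff-rep {D′ = D′} {f} {f′} R R′ .value j w = begin
        f j w ℤ.- f′ j w ℤ.+ (offset R ℤ.+ (+ D′ ℤ.- offset R′))  ≡⟨ lemma (f j w) (f′ j w) (offset R) (+ D′) (offset R′) ⟩
        (f j w ℤ.+ offset R) ℤ.+ (+ D′ ℤ.- (f′ j w ℤ.+ offset R′)) ≡⟨ cong₂ (λ a b → a ℤ.+ (+ D′ ℤ.- b)) (value R j w) (value R′ j w) ⟩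
        + digit R j w ℤ.+ (+ D′ ℤ.- + digit R′ j w)               ≡⟨ cong (ℤ._+_ (+ digit R j w)) (≡.trans (ℤₚ.m-n≡m⊖n D′ (digit R′ j w)) (ℤₚ.⊖-≥ (small R′ j w))) ⟩
        + digit R j w ℤ.+ + (D′ ∸ digit R′ j w)                   ≡⟨ ℤₚ.pos-+ (digit R j w) _ ⟨
        + (digit R j w + (D′ ∸ digit R′ j w))                     ∎
        where
        open ≡-Reasoning
        lemma : ∀ a b c d e → a ℤ.- b ℤ.+ (c ℤ.+ (d ℤ.- e)) ≡ (a ℤ.+ c) ℤ.+ (d ℤ.- (b ℤ.+ e))
        lemma = solve-∀
      diff-rep {D′ = D′} R R′ .small j w = ℕ.+-mono-≤ (small R j w) (ℕ.m∸n≤m D′ (digit R′ j w))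
      diff-rep {D′ = D′} R R′ .packed = ≡.trans (cong₂ (diffᴾ (D′ * ones)) (packed R) (packed R′))
        (≡.trans (zipWith-applyUpTo (λ p r → p + (D′ * ones ∸ r)) _ _ m) (applyUpTo-cong (λ j → sym (≡.trans (pack-+ B n (digit R j) (λ w → D′ ∸ digit R′ j w))
          (cong (λ z → pack B n (digit R j) + z) (pack-∸ B n D′ (digit R′ j) (small R′ j))))) m))

      rotate-rep : ∀ {D f Ps} t → t ≤ m → Biperiodic f → Rep D f Ps → Rep D (λ j w → f (j + t) w) (rotate t Ps)
      rotate-rep t t≤m P R .digit j w = digit R (j + t) w
      rotate-rep t t≤m P R .offset = offset R
      rotate-rep t t≤m P R .value j w = value R (j + t) w
      rotate-rep t t≤m P R .small j w = small R (j + t) w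
      rotate-rep {f = f} {Ps} t t≤m P R .packed = ≡.trans (cong (rotate t) (packed R))
        (subst (λ l → rotate t (applyUpTo u l) ≡ applyUpTo (λ j → u (j + t)) l) (ℕ.m+[n∸m]≡n t≤m)
          (rotate-applyUpTo u t (m ∸ t) λ i → ≡.trans (cong (λ l → u (i + l)) (ℕ.m+[n∸m]≡n t≤m)) (pack-cong B n (digit-perᵢ R P i))))
        where
        u : ℕ → ℕ
        u j = pack B n (digit R j)

      pack-0 : ∀ k → pack B k (λ _ → 0) ≡ 0
      pack-0 zero    = ≡.refl
      pack-0 (suc k) = ≡.trans (cong (B *_) (pack-0 k)) (ℕ.*-zeroʳ B)

      C-rep : ∀ ts {D f Ps} → All (_≤ m) ts → Biperiodic f → Rep D f Ps →
              Rep (length ts * D) (λ j w → ∑ᴸ ts λ t → f (j + t) w) (Cᴾ ts Ps)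
      C-rep [] _ P R = record
        { digit = λ _ _ → 0 ; offset = 0ℤ ; value = λ _ _ → ≡.refl ; small = λ _ _ → z≤n
        ; packed = applyUpTo-cong (λ _ → sym (pack-0 n)) m }
      C-rep (t ∷ ts) (t≤m ∷ ts≤m) P R = sum-rep (rotate-rep t t≤m P R) (C-rep ts ts≤m P R)

      h≤m : h ≤ m
      h≤m = subst (h ≤_) h+h≡m (ℕ.m≤m+n h h)

      -- Reversal sends row `j + h` to row `j`, cyclically shifted by `s j`. Digits must stay below
      -- `B` here, because the shift splits a number by division.
      F-rep : ∀ {D f Ps} → D < B → Biperiodic f → Rep D f Ps → Rep D (F f) (Fᴾ powers Ps)
      F-rep D<B P R .digit j w = digit R (j + h) (w + s j)
      F-rep D<B P R .offset = offset R
      F-rep D<B P R .value j w = value R (j + h) (w + s j)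
      F-rep D<B P R .small j w = small R (j + h) (w + s j)
      F-rep D<B P R .packed = ≡.trans (cong (zipWith rotate-digits powers) (packed (rotate-rep h h≤m P R)))
        (≡.trans (zipWith-applyUpTo rotate-digits _ _ m) (applyUpTo-cong row m))
        where
        row : ∀ j → rotate-digits (B ^ (s j % n) , B ^ (n ∸ s j % n)) (pack B n (digit R (j + h))) ≡ pack B n (λ w → digit R (j + h) (w + s j))
        row j = ≡.trans
          (subst (λ l → rotate-digits (B ^ r , B ^ (n ∸ r)) (pack B l d) ≡ pack B l (λ w → d (w + r))) r+[n∸r]≡n
            (rotate-digits-pack B r (n ∸ r) d (λ w → ℕ.≤-<-trans (small R (j + h) w) D<B)
              (λ w → ≡.trans (cong (λ l → d (w + l)) r+[n∸r]≡n) (digit-perᵥ R P (j + h) w))))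
          (pack-cong B n λ w → period-≡ n (λ z → d (w + z)) (λ z → ≡.trans (cong d (sym (ℕ.+-assoc w z n))) (digit-perᵥ R P (j + h) (w + z))) (m%n%n≡m%n (s j) n))
          where
          r : ℕ
          r = s j % n
          d : ℕ → ℕ
          d = digit R (j + h)
          r+[n∸r]≡n : r + (n ∸ r) ≡ n
          r+[n∸r]≡n = ℕ.m+[n∸m]≡n (ℕ.<⇒≤ (m%n<n (s j) n))

      -- Since bounds never decrease, the single check against `B` at the outermost level covers all
      -- intermediate results.
      bound-≥ : ∀ rs D → D ≤ bound rs D
      bound-≥ []       D = ℕ.≤-trans (ℕ.m≤n*m D a) (ℕ.m≤m+n (a * D) _)
      bound-≥ (r ∷ rs) D = ℕ.≤-trans (bound-≥ rs D) (ℕ.≤-trans (bound-≥ rs (bound rs D)) (ℕ.m≤m+n _ (r * D)))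

      M-rep : ∀ rs {D f Ps} → bound rs D < B → Symmetric f → Rep D f Ps → Rep (bound rs D) (M rs f) (Mᴾ powers ones rs D Ps)
      M-rep [] {D} b<B S R = diff-rep (scale-rep a R) (sum-rep CR (F-rep C<B (C-bip (bip S)) CR))
        where
        CR = C-rep Δ Δ≤m (bip S) R
        C<B : length Δ * D < B
        C<B = ℕ.≤-<-trans (ℕ.≤-trans (ℕ.m≤m+n (length Δ * D) _) (ℕ.m≤n+m _ (a * D))) b<B
      M-rep (r ∷ rs) {D} b<B S R = diff-rep (M-rep rs outer (M-sym rs S) (M-rep rs (ℕ.≤-<-trans (bound-≥ rs (bound rs D)) outer) S R)) (scale-rep r R)
        where
        outer : bound rs (bound rs D) < B
        outer = ℕ.≤-<-trans (ℕ.m≤m+n _ (r * D)) b<B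

      deviation-sum : ∀ κ k w (d : ℕ → ℕ) → (∀ u → d u < B) → + deviation κ k w (pack B k d) ≡ ∑ k (λ u → + ℤ.∣ + d u ℤ.- + κ (w + u) ∣)
      deviation-sum κ zero    w d d<B = ≡.refl
      deviation-sum κ (suc k) w d d<B = begin
        + (ℤ.∣ + ((d 0 + B * p) % B) ℤ.- + κ w ∣ + deviation κ k (suc w) ((d 0 + B * p) / B))
          ≡⟨ cong₂ (λ l r → + (ℤ.∣ + l ℤ.- + κ w ∣ + deviation κ k (suc w) r)) (proj₂ uniq) (proj₁ uniq) ⟩
        + (ℤ.∣ + d 0 ℤ.- + κ w ∣ + deviation κ k (suc w) p)
          ≡⟨ ℤₚ.pos-+ ℤ.∣ + d 0 ℤ.- + κ w ∣ _ ⟩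
        + ℤ.∣ + d 0 ℤ.- + κ w ∣ ℤ.+ + deviation κ k (suc w) p
          ≡⟨ cong₂ ℤ._+_ (cong (λ z → + ℤ.∣ + d 0 ℤ.- + κ z ∣) (sym (ℕ.+-identityʳ w)))
                         (≡.trans (deviation-sum κ k (suc w) (λ u → d (suc u)) (λ u → d<B (suc u)))
                                  (∑-cong k λ u → cong (λ z → + ℤ.∣ + d (suc u) ℤ.- + κ z ∣) (sym (ℕ.+-suc w u)))) ⟩
        + ℤ.∣ + d 0 ℤ.- + κ (w + 0) ∣ ℤ.+ ∑ k (λ u → + ℤ.∣ + d (suc u) ℤ.- + κ (w + suc u) ∣)
          ≡⟨ ∑-first k _ ⟨
        ∑ (suc k) (λ u → + ℤ.∣ + d u ℤ.- + κ (w + u) ∣) ∎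
        where
        open ≡-Reasoning
        p : ℕ
        p = pack B k (λ u → d (suc u))
        uniq = divMod-unique B (d 0) p (d<B 0)

      deviations-sum : ∀ κ k j (d : ℕ → ℕ → ℕ) → (∀ i u → d i u < B) →
        + deviations κ j (applyUpTo (λ i → pack B n (d i)) k) ≡ ∑ k (λ i → ∑ n λ u → + ℤ.∣ + d i u ℤ.- + κ (j + i) u ∣)
      deviations-sum κ zero    j d d<B = ≡.refl
      deviations-sum κ (suc k) j d d<B = begin
        + (deviation (κ j) n 0 (pack B n (d 0)) + deviations κ (suc j) (applyUpTo (λ i → pack B n (d (suc i))) k))
          ≡⟨ ℤₚ.pos-+ (deviation (κ j) n 0 (pack B n (d 0))) _ ⟩
        + deviation (κ j) n 0 (pack B n (d 0)) ℤ.+ + deviations κ (suc j) (applyUpTo (λ i → pack B n (d (suc i))) k)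
          ≡⟨ cong₂ ℤ._+_ (≡.trans (deviation-sum (κ j) n 0 (d 0) (d<B 0)) (∑-cong n λ u → cong (λ z → + ℤ.∣ + d 0 u ℤ.- + κ z u ∣) (sym (ℕ.+-identityʳ j))))
                         (≡.trans (deviations-sum κ k (suc j) (λ i → d (suc i)) (λ i → d<B (suc i)))
                                  (∑-cong k λ i → ∑-cong n λ u → cong (λ z → + ℤ.∣ + d (suc i) u ℤ.- + κ z u ∣) (sym (ℕ.+-suc j i)))) ⟩
        ∑ n (λ u → + ℤ.∣ + d 0 u ℤ.- + κ (j + 0) u ∣) ℤ.+ ∑ k (λ i → ∑ n λ u → + ℤ.∣ + d (suc i) u ℤ.- + κ (j + suc i) u ∣)
          ≡⟨ ∑-first k _ ⟨
        ∑ (suc k) (λ i → ∑ n λ u → + ℤ.∣ + d i u ℤ.- + κ (j + i) u ∣) ∎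
        where open ≡-Reasoning

    -- Functions constant on the fibres over K₅.

    module Fibres (nf mf : ℕ) .{{nf≢0 : NonZero nf}} .{{mf≢0 : NonZero mf}}
                  (n≡ : n ≡ nf * 5) (m≡ : m ≡ mf * 4)
                  (w : ℕ) (g⁴ : g ^ 4 ≡ 1 + 5 * w)
                  (g′ q′ : ℕ) (gg′ : g * g′ ≡ 1 + q′ * n)
                  (e : ℕ) (Δ-mod-4 : map (_% 4) Δ ↭ replicate e 1 ++ replicate e 2 ++ replicate e 3) where

      -- Pull-backs from the arcs of K₅: the tail lies over v modulo 5, and i modulo 4 fixes gⁱ
      -- modulo 5.
      record Fibral (z : Arc) : Set where
        field
          per₄ : ∀ i v → z (i + 4) v ≡ z i v
          per₅ : ∀ i v → z i (v + 5) ≡ z i v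

        constant : ∀ i v a b → z (i + 4 * a) (v + 5 * b) ≡ z i v
        constant i v a b = ≡.trans (cong₂ (λ a b → z (i + a) (v + b)) (ℕ.*-comm 4 a) (ℕ.*-comm 5 b))
          (≡.trans (period-* 5 (z (i + a * 4)) (per₅ (i + a * 4)) v b) (period-* 4 (λ i → z i v) (λ i → per₄ i v) i a))

        fibral-bip : Biperiodic z
        fibral-bip .perᵢ i v = ≡.trans (cong (λ l → z (i + l) v) m≡) (period-* 4 (λ i → z i v) (λ i → per₄ i v) i mf)
        fibral-bip .perᵥ i v = ≡.trans (cong (λ l → z i (v + l)) n≡) (period-* 5 (z i) (per₅ i) v nf)

      open Fibral public

      -- The sum over a fibre instead of the mean, so that values stay integral; deviations are
      -- accordingly scaled by the fibre size `K`.
      P : Arc → Arc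
      P x i v = ∑ mf λ a → ∑ nf λ b → x (i + 4 * a) (v + 5 * b)

      K : ℤ
      K = + mf ℤ.* + nf

      module _ {x : Arc} (B : Biperiodic x) where

        per-b : ∀ i v b → x i (v + 5 * (b + nf)) ≡ x i (v + 5 * b)
        per-b i v b = reduceᵥ B i 1 (≡.trans (lemma v b nf) (cong (λ l → v + 5 * b + 1 * l) (sym n≡)))
          where
          lemma : ∀ v b k → v + 5 * (b + k) ≡ v + 5 * b + 1 * (k * 5)
          lemma = ℕSolver.solve-∀

        P-fibral : Fibral (P x)
        P-fibral .per₄ i v = ≡.trans (∑-cong mf λ a → ∑-cong nf λ b → cong (λ j → x j (v + 5 * b)) (lemma i a))
          (∑-shift mf (λ a → ∑ nf λ b → x (i + 4 * a) (v + 5 * b))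
            (λ a → ∑-cong nf λ b → reduceᵢ B _ 1 (≡.trans (lemma₂ i a mf) (cong (λ l → i + 4 * a + 1 * l) (sym m≡)))) 1)
          where
          lemma : ∀ i a → i + 4 + 4 * a ≡ i + 4 * (a + 1)
          lemma = ℕSolver.solve-∀
          lemma₂ : ∀ i a k → i + 4 * (a + k) ≡ i + 4 * a + 1 * (k * 4)
          lemma₂ = ℕSolver.solve-∀
        P-fibral .per₅ i v = ∑-cong mf λ a → ≡.trans (∑-cong nf λ b → cong (x (i + 4 * a)) (lemma v b))
          (∑-shift nf (λ b → x (i + 4 * a) (v + 5 * b)) (per-b (i + 4 * a) v) 1)
          where
          lemma : ∀ v b → v + 5 + 5 * b ≡ v + 5 * (b + 1)
          lemma = ℕSolver.solve-∀

        g⁴ᵃ : ∀ a → Σ ℕ λ k → g ^ (4 * a) ≡ 1 + 5 * k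
        g⁴ᵃ zero = 0 , ≡.refl
        g⁴ᵃ (suc a) with g⁴ᵃ a
        ... | k , eq = w + k + 5 * w * k , (begin
          g ^ (4 * suc a)            ≡⟨ cong (g ^_) (ℕ.*-suc 4 a) ⟩
          g ^ (4 + 4 * a)            ≡⟨ s-+ 4 (4 * a) ⟩
          g ^ 4 * g ^ (4 * a)        ≡⟨ cong₂ _*_ g⁴ eq ⟩
          (1 + 5 * w) * (1 + 5 * k)  ≡⟨ lemma w k ⟩
          1 + 5 * (w + k + 5 * w * k) ∎)
          where
          open ≡-Reasoning
          lemma : ∀ w k → (1 + 5 * w) * (1 + 5 * k) ≡ 1 + 5 * (w + k + 5 * w * k)
          lemma = ℕSolver.solve-∀

        -- As g⁴ is 1 modulo 5, passing from `i` to `i + 4 * a` changes the head by a multiple of 5,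
        -- a shift within the fibre.
        P-F : P (F x) ≗ F (P x)
        P-F i v = ∑-cong mf row
          where
          row : ∀ a → ∑ nf (λ b → F x (i + 4 * a) (v + 5 * b)) ≡ ∑ nf (λ b → x (i + h + 4 * a) (v + s i + 5 * b))
          row a = ≡.trans (∑-cong nf λ b → cong₂ x (lemma₁ i (4 * a) h)
              (≡.trans (cong (λ z → v + 5 * b + z) (≡.trans (s-+ i (4 * a)) (cong (s i *_) (proj₂ (g⁴ᵃ a))))) (lemma₂ v b (s i) (proj₁ (g⁴ᵃ a)))))
            (∑-shift nf (λ b → x (i + h + 4 * a) (v + s i + 5 * b)) (per-b (i + h + 4 * a) (v + s i)) (s i * proj₁ (g⁴ᵃ a)))
            where
            lemma₁ : ∀ i a h → i + a + h ≡ i + h + a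
            lemma₁ = ℕSolver.solve-∀
            lemma₂ : ∀ v b c k → v + 5 * b + c * (1 + 5 * k) ≡ v + c + 5 * (b + c * k)
            lemma₂ = ℕSolver.solve-∀

        inverse : ∀ i → Σ ℕ λ u → Σ ℕ λ k → s i * u ≡ 1 + k * n
        inverse zero = 1 , 0 , ≡.refl
        inverse (suc i) with inverse i
        ... | u , k , eq = g′ * u , q′ + k + q′ * n * k , (begin
          g * s i * (g′ * u)           ≡⟨ lemma g (s i) g′ u ⟩
          (g * g′) * (s i * u)         ≡⟨ cong₂ _*_ gg′ eq ⟩
          (1 + q′ * n) * (1 + k * n)   ≡⟨ lemma₂ q′ k n ⟩
          1 + (q′ + k + q′ * n * k) * n ∎)
          where
          open ≡-Reasoning
          lemma : ∀ a b c d → a * b * (c * d) ≡ (a * c) * (b * d)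
          lemma = ℕSolver.solve-∀
          lemma₂ : ∀ a b n → (1 + a * n) * (1 + b * n) ≡ 1 + (a + b + a * n * b) * n
          lemma₂ = ℕSolver.solve-∀

        -- Translation multiplies the position within a fibre by the unit `s i₀`, and a sum over a
        -- full period does not see such a factor.
        P-L : ∀ i₀ v₀ → P (L i₀ v₀ x) ≗ L i₀ v₀ (P x)
        P-L i₀ v₀ j w = ∑-cong mf λ a → ≡.trans
          (∑-cong nf λ b → cong₂ x (sym (ℕ.+-assoc i₀ j (4 * a))) (lemma v₀ (s i₀) w b))
          (∑-unit nf (λ b → x (i₀ + j + 4 * a) (v₀ + s i₀ * w + 5 * b)) (per-b (i₀ + j + 4 * a) (v₀ + s i₀ * w))
            (s i₀) u (k * 5) (≡.trans (proj₂ (proj₂ (inverse i₀)))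
              (cong suc (≡.trans (cong (k *_) n≡) (lemma₂ k nf)))))
          where
          u k : ℕ
          u = proj₁ (inverse i₀)
          k = proj₁ (proj₂ (inverse i₀))
          lemma : ∀ v c w b → v + c * (w + 5 * b) ≡ v + c * w + 5 * (c * b)
          lemma = ℕSolver.solve-∀
          lemma₂ : ∀ k l → k * (l * 5) ≡ k * 5 * l
          lemma₂ = ℕSolver.solve-∀

      P-cong : ∀ {f k} → f ≗ k → P f ≗ P k
      P-cong eq i v = ∑-cong mf λ a → ∑-cong nf λ b → eq _ _

      P-of-fibral : ∀ {z} → Fibral z → P z ≗ K ⊙ z
      P-of-fibral {z} Z i v = begin
        P z i v                            ≡⟨ ∑-cong mf (λ a → ∑-cong nf λ b → constant Z i v a b) ⟩
        ∑ mf (λ a → ∑ nf λ b → z i v)      ≡⟨ ∑-cong mf (λ a → ∑-const nf _) ⟩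
        ∑ mf (λ a → + nf ℤ.* z i v)        ≡⟨ ∑-const mf _ ⟩
        + mf ℤ.* (+ nf ℤ.* z i v)          ≡⟨ ℤₚ.*-assoc (+ mf) (+ nf) (z i v) ⟨
        K ℤ.* z i v                        ∎
        where open ≡-Reasoning

      ∑-∑∑ : ∀ k (f : ℕ → Arc) → ∑ k (λ a → ∑∑ (f a)) ≡ ∑∑ (λ i v → ∑ k λ a → f a i v)
      ∑-∑∑ k f = ≡.trans (∑-swap k m _) (∑-cong m λ i → ∑-swap k n _)

      K≢0 : ∀ {z} → K ℤ.* z ≡ 0ℤ → z ≡ 0ℤ
      K≢0 {z} eq = ℤₚ.*-cancelˡ-≡ (+ nf) _ _ (≡.trans (ℤₚ.*-cancelˡ-≡ (+ mf) _ _ (≡.trans (sym (ℤₚ.*-assoc (+ mf) (+ nf) z))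
        (≡.trans eq (sym (ℤₚ.*-zeroʳ (+ mf)))))) (sym (ℤₚ.*-zeroʳ (+ nf))))

      -- Shifts along the fibres preserve the inner product and fix `z`; adding up all of them
      -- replaces `y` by `P y`.
      orthogonal : ∀ {z y} → Fibral z → Biperiodic y → (∀ i v → P y i v ≡ 0ℤ) → ⟪ z , y ⟫ ≡ 0ℤ
      orthogonal {z} {y} Z Y Py≡0 = K≢0 (begin
        K ℤ.* ⟪ z , y ⟫
          ≡⟨ ℤₚ.*-assoc (+ mf) (+ nf) _ ⟩
        + mf ℤ.* (+ nf ℤ.* ⟪ z , y ⟫)
          ≡⟨ ∑-const mf _ ⟨
        ∑ mf (λ a → + nf ℤ.* ⟪ z , y ⟫)
          ≡⟨ ∑-cong mf (λ a → ∑-const nf _) ⟨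
        ∑ mf (λ a → ∑ nf λ b → ⟪ z , y ⟫)
          ≡⟨ ∑-cong mf (λ a → ∑-cong nf λ b → move a b) ⟩
        ∑ mf (λ a → ∑ nf λ b → ⟪ z , shift (4 * a) (5 * b) y ⟫)
          ≡⟨ ∑-cong mf (λ a → ∑-∑∑ nf _) ⟩
        ∑ mf (λ a → ∑∑ λ i v → ∑ nf λ b → z i v ℤ.* y (i + 4 * a) (v + 5 * b))
          ≡⟨ ∑-∑∑ mf _ ⟩
        ∑∑ (λ i v → ∑ mf λ a → ∑ nf λ b → z i v ℤ.* y (i + 4 * a) (v + 5 * b))
          ≡⟨ ∑∑-cong (λ i v → ≡.trans (∑-cong mf λ a → ∑-* nf (z i v) _) (∑-* mf (z i v) _)) ⟩
        ⟪ z , P y ⟫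
          ≡⟨ ∑∑-cong (λ i v → ≡.trans (cong (ℤ._*_ (z i v)) (Py≡0 i v)) (ℤₚ.*-zeroʳ (z i v))) ⟩
        ∑∑ (λ _ _ → 0ℤ)
          ≡⟨ ≡.trans (∑-cong m λ _ → ∑-0 n) (∑-0 m) ⟩
        0ℤ ∎)
        where
        open ≡-Reasoning
        move : ∀ a b → ⟪ z , y ⟫ ≡ ⟪ z , shift (4 * a) (5 * b) y ⟫
        move a b = ≡.trans (sym (shift-isometry (4 * a) (5 * b) (fibral-bip Z) Y))
          (⟪⟫-congˡ _ λ i v → constant Z i v a b)

      C-fibral : ∀ {z} → Fibral z → Fibral (C z)
      C-fibral {z} Z .per₄ i v = ∑ᴸ-cong Δ λ t → ≡.trans (cong (λ j → z j v) (lemma i t)) (per₄ Z (i + t) v)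
        where
        lemma : ∀ i t → i + 4 + t ≡ i + t + 4
        lemma = ℕSolver.solve-∀
      C-fibral Z .per₅ i v = ∑ᴸ-cong Δ λ t → per₅ Z (i + t) v

      -- On fibre-constant functions C + e is e times the sum over the four fibres at a vertex.
      C-fibral-nonneg : ∀ {z} → Fibral z → 0ℤ ℤ.≤ ⟪ z , C z ⟫ ℤ.+ + e ℤ.* ⟪ z , z ⟫
      C-fibral-nonneg {z} Z = ℤₚ.*-cancelˡ-≤-pos 0ℤ _ (+ 4) (begin
        + 4 ℤ.* 0ℤ                                         ≡⟨ ℤₚ.*-zeroʳ (+ 4) ⟩
        0ℤ                                                 ≡⟨ ℤₚ.*-zeroʳ (+ e) ⟨
        + e ℤ.* 0ℤ                                         ≤⟨ ℤₚ.*-monoˡ-≤-nonNeg (+ e) (⟪⟫-nonneg H) ⟩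
        + e ℤ.* ⟪ H , H ⟫                                  ≡⟨ cong (+ e ℤ.*_) H-norm ⟩
        + e ℤ.* (+ 4 ℤ.* ⟪ z , H ⟫)                        ≡⟨ regroup (+ e) (+ 4) ⟪ z , H ⟫ ⟩
        + 4 ℤ.* (+ e ℤ.* ⟪ z , H ⟫)                        ≡⟨ cong (+ 4 ℤ.*_) C+e ⟨
        + 4 ℤ.* (⟪ z , C z ⟫ ℤ.+ + e ℤ.* ⟪ z , z ⟫)        ∎)
        where
        open ℤₚ.≤-Reasoning
        regroup : ∀ a b c → a ℤ.* (b ℤ.* c) ≡ b ℤ.* (a ℤ.* c)
        regroup = solve-∀
        H : Arc
        H i v = z i v ℤ.+ (z (i + 1) v ℤ.+ (z (i + 2) v ℤ.+ z (i + 3) v))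
        H-step : ∀ i v → H (i + 1) v ≡ H i v
        H-step i v = ≡.trans (cong₂ (λ a b → z (i + 1) v ℤ.+ (a ℤ.+ b)) (at 1) (cong₂ ℤ._+_ (at 2) (≡.trans (at 3) (per₄ Z i v))))
          (cycle (z (i + 1) v) (z (i + 2) v) (z (i + 3) v) (z i v))
          where
          at : ∀ k → z (i + 1 + k) v ≡ z (i + suc k) v
          at k = cong (λ j → z j v) (ℕ.+-assoc i 1 k)
          cycle : ∀ a b c d → a ℤ.+ (b ℤ.+ (c ℤ.+ d)) ≡ d ℤ.+ (a ℤ.+ (b ℤ.+ c))
          cycle = solve-∀
        H-bip : Biperiodic H
        H-bip .perᵢ i v = ≡.trans (cong (λ j → H (i + j) v) (sym (ℕ.*-identityʳ m))) (period-* 1 (λ i → H i v) (λ i → H-step i v) i m)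
        H-bip .perᵥ i v = cong₂ ℤ._+_ (pv i) (cong₂ ℤ._+_ (pv (i + 1)) (cong₂ ℤ._+_ (pv (i + 2)) (pv (i + 3))))
          where
          pv : ∀ j → z j (v + n) ≡ z j v
          pv j = perᵥ (fibral-bip Z) j v
        H-const : ∀ k i v → H (i + k) (v + 0) ≡ H i v
        H-const k i v = ≡.trans (cong₂ H (cong (λ l → i + l) (sym (ℕ.*-identityʳ k))) (ℕ.+-identityʳ v))
          (period-* 1 (λ i → H i v) (λ i → H-step i v) i k)
        term : ∀ k → ⟪ H , (λ i v → z (i + k) v) ⟫ ≡ ⟪ z , H ⟫
        term k = ≡.trans (⟪⟫-cong (λ i v → sym (H-const k i v)) (λ i v → cong (z (i + k)) (sym (ℕ.+-identityʳ v))))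
          (≡.trans (shift-isometry k 0 H-bip (fibral-bip Z)) (⟪⟫-comm H z))
        -- `H` does not depend on the exponent, so each of its four summands pairs with it as `z`
        -- does.
        H-norm : ⟪ H , H ⟫ ≡ + 4 ℤ.* ⟪ z , H ⟫
        H-norm = begin-equality
          ⟪ H , H ⟫
            ≡⟨ ⟪⟫-⊕ H z _ ∙ cong (ℤ._+_ ⟪ H , z ⟫) (⟪⟫-⊕ H _ _ ∙ cong (ℤ._+_ ⟪ H , (λ i v → z (i + 1) v) ⟫) (⟪⟫-⊕ H (λ i v → z (i + 2) v) (λ i v → z (i + 3) v))) ⟩
          ⟪ H , z ⟫ ℤ.+ (⟪ H , (λ i v → z (i + 1) v) ⟫ ℤ.+ (⟪ H , (λ i v → z (i + 2) v) ⟫ ℤ.+ ⟪ H , (λ i v → z (i + 3) v) ⟫))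
            ≡⟨ cong₂ ℤ._+_ (⟪⟫-comm H z) (cong₂ ℤ._+_ (term 1) (cong₂ ℤ._+_ (term 2) (term 3))) ⟩
          ⟪ z , H ⟫ ℤ.+ (⟪ z , H ⟫ ℤ.+ (⟪ z , H ⟫ ℤ.+ ⟪ z , H ⟫))
            ≡⟨ four ⟪ z , H ⟫ ⟨
          + 4 ℤ.* ⟪ z , H ⟫ ∎
          where
          _∙_ : ∀ {a b c : ℤ} → a ≡ b → b ≡ c → a ≡ c
          _∙_ = ≡.trans
          four : ∀ a → + 4 ℤ.* a ≡ a ℤ.+ (a ℤ.+ (a ℤ.+ a))
          four = solve-∀
        C-value : ∀ i v → C z i v ℤ.+ + e ℤ.* z i v ≡ + e ℤ.* H i v
        C-value i v = begin-equality
          C z i v ℤ.+ + e ℤ.* z i v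
            ≡⟨ cong (ℤ._+ + e ℤ.* z i v) (∑ᴸ-cong Δ λ t → sym (period-% 4 (λ t → z (i + t) v) (λ t → ≡.trans (cong (λ j → z j v) (sym (ℕ.+-assoc i t 4))) (per₄ Z (i + t) v)) t)) ⟩
          ∑ᴸ Δ (λ t → k (t % 4)) ℤ.+ + e ℤ.* z i v
            ≡⟨ cong (ℤ._+ + e ℤ.* z i v) (≡.trans (sym (∑ᴸ-map (_% 4) Δ k)) (∑ᴸ-↭ k Δ-mod-4)) ⟩
          ∑ᴸ (replicate e 1 ++ replicate e 2 ++ replicate e 3) k ℤ.+ + e ℤ.* z i v
            ≡⟨ cong (ℤ._+ + e ℤ.* z i v) (≡.trans (∑ᴸ-++ (replicate e 1) _ k) (cong₂ ℤ._+_ (∑ᴸ-replicate e 1 k) (≡.trans (∑ᴸ-++ (replicate e 2) _ k) (cong₂ ℤ._+_ (∑ᴸ-replicate e 2 k) (∑ᴸ-replicate e 3 k))))) ⟩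
          (+ e ℤ.* k 1 ℤ.+ (+ e ℤ.* k 2 ℤ.+ + e ℤ.* k 3)) ℤ.+ + e ℤ.* z i v
            ≡⟨ factor (+ e) (k 1) (k 2) (k 3) (z i v) ⟩
          + e ℤ.* H i v ∎
          where
          k : ℕ → ℤ
          k t = z (i + t) v
          factor : ∀ e a b c d → (e ℤ.* a ℤ.+ (e ℤ.* b ℤ.+ e ℤ.* c)) ℤ.+ e ℤ.* d ≡ e ℤ.* (d ℤ.+ (a ℤ.+ (b ℤ.+ c)))
          factor = solve-∀
        C+e : ⟪ z , C z ⟫ ℤ.+ + e ℤ.* ⟪ z , z ⟫ ≡ + e ℤ.* ⟪ z , H ⟫
        C+e = begin-equality
          ⟪ z , C z ⟫ ℤ.+ + e ℤ.* ⟪ z , z ⟫   ≡⟨ cong (ℤ._+_ ⟪ z , C z ⟫) (⟪⟫-⊙ (+ e) z z) ⟨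
          ⟪ z , C z ⟫ ℤ.+ ⟪ z , + e ⊙ z ⟫     ≡⟨ ⟪⟫-⊕ z (C z) (+ e ⊙ z) ⟨
          ⟪ z , C z ⊕ + e ⊙ z ⟫               ≡⟨ ⟪⟫-congʳ z C-value ⟩
          ⟪ z , + e ⊙ H ⟫                     ≡⟨ ⟪⟫-⊙ (+ e) z H ⟩
          + e ℤ.* ⟪ z , H ⟫                   ∎

      -- The deviation from the fibre means.

      module Deviation {x : Arc} (S : Symmetric x) where

        z y : Arc
        z = P x
        y = K ⊙ x ⊖ z

        Z : Fibral z
        Z = P-fibral (bip S)

        y-sym : Symmetric y
        y-sym = ⊖-sym (⊙-sym K S) z-sym
          where
          z-sym : Symmetric z
          z-sym .bip = fibral-bip Z
          z-sym .flip i v = ≡.trans (sym (P-F (bip S) i v)) (P-cong (flip S) i v)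

        Py≡0 : ∀ i v → P y i v ≡ 0ℤ
        Py≡0 i v = begin
          P y i v
            ≡⟨ ∑-cong mf (λ a → ≡.trans (∑-- nf _ _) (cong (ℤ._- ∑ nf (λ b → z (i + 4 * a) (v + 5 * b))) (∑-* nf K _))) ⟩
          ∑ mf (λ a → K ℤ.* ∑ nf (λ b → x (i + 4 * a) (v + 5 * b)) ℤ.- ∑ nf (λ b → z (i + 4 * a) (v + 5 * b)))
            ≡⟨ ≡.trans (∑-- mf _ _) (cong (ℤ._- P z i v) (∑-* mf K _)) ⟩
          K ℤ.* z i v ℤ.- P z i v
            ≡⟨ cong (ℤ._-_ (K ℤ.* z i v)) (P-of-fibral Z i v) ⟩
          K ℤ.* z i v ℤ.- K ℤ.* z i v
            ≡⟨ ℤₚ.+-inverseʳ (K ℤ.* z i v) ⟩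
          0ℤ ∎
          where open ≡-Reasoning

        y-orthogonal : ∀ {k} → Fibral k → ⟪ k , y ⟫ ≡ 0ℤ
        y-orthogonal Kf = orthogonal Kf (bip y-sym) Py≡0

        Ly-orthogonal : ∀ {k} → Fibral k → ∀ i₀ v₀ → ⟪ k , L i₀ v₀ y ⟫ ≡ 0ℤ
        Ly-orthogonal Kf i₀ v₀ = orthogonal Kf (L-bip i₀ v₀ (bip y-sym))
          (λ i v → ≡.trans (P-L (bip y-sym) i₀ v₀ i v) (Py≡0 (i₀ + i) (v₀ + s i₀ * v)))

        module _ (form : ⟪ x , C x ⟫ ≡ ℤ.- (+ e) ℤ.* ⟪ x , x ⟫) where

          x-split : K ⊙ x ≗ y ⊕ z
          x-split i v = lemma (K ℤ.* x i v) (z i v)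
            where
            lemma : ∀ a b → a ≡ a ℤ.- b ℤ.+ b
            lemma = solve-∀

          B = bip y-sym
          BZ = fibral-bip Z

          norm-split : K ℤ.* (K ℤ.* ⟪ x , x ⟫) ≡ ⟪ y , y ⟫ ℤ.+ ⟪ z , z ⟫
          norm-split = begin
            K ℤ.* (K ℤ.* ⟪ x , x ⟫)                              ≡⟨ cong (ℤ._*_ K) (≡.trans (sym (⟪⟫-⊙ K x x)) (⟪⟫-comm x (K ⊙ x))) ⟩
            K ℤ.* ⟪ K ⊙ x , x ⟫                                  ≡⟨ ⟪⟫-⊙ K (K ⊙ x) x ⟨
            ⟪ K ⊙ x , K ⊙ x ⟫                                    ≡⟨ ⟪⟫-cong x-split x-split ⟩
            ⟪ y ⊕ z , y ⊕ z ⟫                                    ≡⟨ ⟪⟫-⊕ (y ⊕ z) y z ⟩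
            ⟪ y ⊕ z , y ⟫ ℤ.+ ⟪ y ⊕ z , z ⟫                      ≡⟨ cong₂ ℤ._+_ (≡.trans (⟪⟫-comm (y ⊕ z) y) (⟪⟫-⊕ y y z)) (≡.trans (⟪⟫-comm (y ⊕ z) z) (⟪⟫-⊕ z y z)) ⟩
            (⟪ y , y ⟫ ℤ.+ ⟪ y , z ⟫) ℤ.+ (⟪ z , y ⟫ ℤ.+ ⟪ z , z ⟫) ≡⟨ cong₂ (λ a b → (⟪ y , y ⟫ ℤ.+ a) ℤ.+ (b ℤ.+ ⟪ z , z ⟫)) (≡.trans (⟪⟫-comm y z) (y-orthogonal Z)) (y-orthogonal Z) ⟩
            (⟪ y , y ⟫ ℤ.+ 0ℤ) ℤ.+ (0ℤ ℤ.+ ⟪ z , z ⟫)            ≡⟨ cong₂ ℤ._+_ (ℤₚ.+-identityʳ ⟪ y , y ⟫) (ℤₚ.+-identityˡ ⟪ z , z ⟫) ⟩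
            ⟪ y , y ⟫ ℤ.+ ⟪ z , z ⟫                              ∎
            where open ≡-Reasoning

          -- The cross terms vanish because `C` maps fibre-constant functions to such functions and
          -- is self-adjoint.
          C-split : K ℤ.* (K ℤ.* ⟪ x , C x ⟫) ≡ ⟪ y , C y ⟫ ℤ.+ ⟪ z , C z ⟫
          C-split = begin
            K ℤ.* (K ℤ.* ⟪ x , C x ⟫)                            ≡⟨ cong (ℤ._*_ K) (⟪⟫-⊙ K x (C x)) ⟨
            K ℤ.* ⟪ x , K ⊙ C x ⟫                                ≡⟨ cong (ℤ._*_ K) (⟪⟫-comm x _) ⟩
            K ℤ.* ⟪ K ⊙ C x , x ⟫                                ≡⟨ ⟪⟫-⊙ K (K ⊙ C x) x ⟨
            ⟪ K ⊙ C x , K ⊙ x ⟫                                  ≡⟨ ⟪⟫-cong C-K x-split ⟩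
            ⟪ C y ⊕ C z , y ⊕ z ⟫                                ≡⟨ ⟪⟫-⊕ (C y ⊕ C z) y z ⟩
            ⟪ C y ⊕ C z , y ⟫ ℤ.+ ⟪ C y ⊕ C z , z ⟫              ≡⟨ cong₂ ℤ._+_ (≡.trans (⟪⟫-comm _ y) (⟪⟫-⊕ y (C y) (C z))) (≡.trans (⟪⟫-comm _ z) (⟪⟫-⊕ z (C y) (C z))) ⟩
            (⟪ y , C y ⟫ ℤ.+ ⟪ y , C z ⟫) ℤ.+ (⟪ z , C y ⟫ ℤ.+ ⟪ z , C z ⟫)
              ≡⟨ cong₂ (λ a b → (⟪ y , C y ⟫ ℤ.+ a) ℤ.+ (b ℤ.+ ⟪ z , C z ⟫))
                       (≡.trans (⟪⟫-comm y (C z)) (y-orthogonal (C-fibral Z)))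
                       (≡.trans (sym (C-adjoint BZ B)) (y-orthogonal (C-fibral Z))) ⟩
            (⟪ y , C y ⟫ ℤ.+ 0ℤ) ℤ.+ (0ℤ ℤ.+ ⟪ z , C z ⟫)        ≡⟨ cong₂ ℤ._+_ (ℤₚ.+-identityʳ ⟪ y , C y ⟫) (ℤₚ.+-identityˡ ⟪ z , C z ⟫) ⟩
            ⟪ y , C y ⟫ ℤ.+ ⟪ z , C z ⟫                          ∎
            where
            open ≡-Reasoning
            C-K : K ⊙ C x ≗ C y ⊕ C z
            C-K i v = ≡.trans (∑ᴸ-*ˡ Δ _ K) (≡.trans (∑ᴸ-cong Δ λ t → x-split (i + t) v) (∑ᴸ-+ Δ _ _))

          -- The form of C + e is zero at `x`, splits after scaling by K² into its values at `y` and
          -- `z`, and is non-negative at `z`.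
          y-form : ⟪ y , C y ⟫ ℤ.+ + e ℤ.* ⟪ y , y ⟫ ℤ.≤ 0ℤ
          y-form = begin
            ⟪ y , C y ⟫ ℤ.+ + e ℤ.* ⟪ y , y ⟫
              ≡⟨ ℤₚ.+-identityʳ _ ⟨
            ⟪ y , C y ⟫ ℤ.+ + e ℤ.* ⟪ y , y ⟫ ℤ.+ 0ℤ
              ≤⟨ ℤₚ.+-monoʳ-≤ (⟪ y , C y ⟫ ℤ.+ + e ℤ.* ⟪ y , y ⟫) (C-fibral-nonneg Z) ⟩
            ⟪ y , C y ⟫ ℤ.+ + e ℤ.* ⟪ y , y ⟫ ℤ.+ (⟪ z , C z ⟫ ℤ.+ + e ℤ.* ⟪ z , z ⟫)
              ≡⟨ regroup ⟪ y , C y ⟫ ⟪ y , y ⟫ ⟪ z , C z ⟫ ⟪ z , z ⟫ (+ e) ⟩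
            (⟪ y , C y ⟫ ℤ.+ ⟪ z , C z ⟫) ℤ.+ + e ℤ.* (⟪ y , y ⟫ ℤ.+ ⟪ z , z ⟫)
              ≡⟨ cong₂ (λ a b → a ℤ.+ + e ℤ.* b) C-split norm-split ⟨
            K ℤ.* (K ℤ.* ⟪ x , C x ⟫) ℤ.+ + e ℤ.* (K ℤ.* (K ℤ.* ⟪ x , x ⟫))
              ≡⟨ cong (λ a → K ℤ.* (K ℤ.* a) ℤ.+ + e ℤ.* (K ℤ.* (K ℤ.* ⟪ x , x ⟫))) form ⟩
            K ℤ.* (K ℤ.* (ℤ.- (+ e) ℤ.* ⟪ x , x ⟫)) ℤ.+ + e ℤ.* (K ℤ.* (K ℤ.* ⟪ x , x ⟫))
              ≡⟨ cancel K (+ e) ⟪ x , x ⟫ ⟩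
            0ℤ ∎
            where
            open ℤₚ.≤-Reasoning
            regroup : ∀ a b c d e → a ℤ.+ e ℤ.* b ℤ.+ (c ℤ.+ e ℤ.* d) ≡ (a ℤ.+ c) ℤ.+ e ℤ.* (b ℤ.+ d)
            regroup = solve-∀
            cancel : ∀ k e x → k ℤ.* (k ℤ.* (ℤ.- e ℤ.* x)) ℤ.+ e ℤ.* (k ℤ.* (k ℤ.* x)) ≡ 0ℤ
            cancel = solve-∀

        fibral-if-null : ⟪ y , y ⟫ ≡ 0ℤ → Fibral x
        fibral-if-null y≡0 = record
          { per₄ = λ i v → cancel (≡.trans (Kx≡z (i + 4) v) (≡.trans (per₄ Z i v) (sym (Kx≡z i v))))
          ; per₅ = λ i v → cancel (≡.trans (Kx≡z i (v + 5)) (≡.trans (per₅ Z i v) (sym (Kx≡z i v))))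
          }
          where
          cancel : ∀ {a b} → K ℤ.* a ≡ K ℤ.* b → a ≡ b
          cancel {a} {b} eq = ≡.trans (add-sub a b) (≡.trans (cong (ℤ._+ b) (K≢0 (≡.trans (ℤₚ.*-distribˡ-+ K a (ℤ.- b))
            (≡.trans (cong₂ ℤ._+_ eq (sym (ℤₚ.neg-distribʳ-* K b))) (ℤₚ.+-inverseʳ (K ℤ.* b)))))) (ℤₚ.+-identityˡ b))
            where
            add-sub : ∀ a b → a ≡ a ℤ.+ ℤ.- b ℤ.+ b
            add-sub = solve-∀
          square-zero : ∀ {a} → a ℤ.* a ≡ 0ℤ → a ≡ 0ℤ
          square-zero {a} eq with ℤₚ.i*j≡0⇒i≡0∨j≡0 a eq
          ... | inj₁ p = p
          ... | inj₂ p = p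
          y-zero : ∀ i v → i < m → v < n → y i v ≡ 0ℤ
          y-zero i v i<m v<n = square-zero (∑-zero⁻ n (λ v → square-nonneg (y i v))
            (∑-zero⁻ m (λ i → ∑-nonneg n λ v → square-nonneg (y i v)) y≡0 i i<m) v v<n)
          Kx≡z : ∀ i v → K ℤ.* x i v ≡ z i v
          Kx≡z i v = begin
            K ℤ.* x i v              ≡⟨ add-sub (K ℤ.* x i v) (z i v) ⟩
            y i v ℤ.+ z i v          ≡⟨ cong (ℤ._+ z i v) (period-% m (λ i → y i v) (λ i → perᵢ (bip y-sym) i v) i) ⟨
            y (i % m) v ℤ.+ z i v    ≡⟨ cong (ℤ._+ z i v) (period-% n (y (i % m)) (perᵥ (bip y-sym) (i % m)) v) ⟨
            y (i % m) (v % n) ℤ.+ z i v ≡⟨ cong (ℤ._+ z i v) (y-zero (i % m) (v % n) (m%n<n i m) (m%n<n v n)) ⟩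
            0ℤ ℤ.+ z i v             ≡⟨ ℤₚ.+-identityˡ _ ⟩
            z i v                    ∎
            where
            open ≡-Reasoning
            add-sub : ∀ a b → a ≡ a ℤ.- b ℤ.+ b
            add-sub = solve-∀

      -- The convolution kernel and its ℓ¹-bound.

      module Kernel (a : ℕ) where

        open Chain a

        δ : Arc
        δ i v = + ([ i % m ≡0] * [ v % n ≡0])

        δ-bip : Biperiodic δ
        δ-bip .perᵢ i v = cong (λ r → + ([ r ≡0] * [ v % n ≡0])) (≡.trans (cong (λ z → (i + z) % m) (sym (ℕ.*-identityˡ m))) ([m+kn]%n≡m%n i 1 m))
        δ-bip .perᵥ i v = cong (λ r → + ([ i % m ≡0] * [ r ≡0])) (≡.trans (cong (λ z → (v + z) % n) (sym (ℕ.*-identityˡ n))) ([m+kn]%n≡m%n v 1 n))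

        ⟪δ⟫ : ∀ f → ⟪ δ , f ⟫ ≡ f 0 0
        ⟪δ⟫ f = begin
          ∑∑ (λ i v → + ([ i % m ≡0] * [ v % n ≡0]) ℤ.* f i v)
            ≡⟨ ∑∑-cong (λ i v → ≡.trans (cong (ℤ._* f i v) (ℤₚ.pos-* [ i % m ≡0] _)) (ℤₚ.*-assoc (+ [ i % m ≡0]) _ (f i v))) ⟩
          ∑∑ (λ i v → + [ i % m ≡0] ℤ.* (+ [ v % n ≡0] ℤ.* f i v))
            ≡⟨ ∑-cong m (λ i → ≡.trans (∑-* n (+ [ i % m ≡0]) _) (cong (ℤ._*_ (+ [ i % m ≡0])) (∑-indicator n (f i)))) ⟩
          ∑ m (λ i → + [ i % m ≡0] ℤ.* f i 0)
            ≡⟨ ∑-indicator m (λ i → f i 0) ⟩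
          f 0 0 ∎
          where open ≡-Reasoning

        -- The point mass has to be symmetrized before `M` can be moved across the inner product. It
        -- then evaluates symmetric functions with a factor 2, the source of the doubled quantities
        -- below.
        ε : Arc
        ε = δ ⊕ F δ

        ε-sym : Symmetric ε
        ε-sym = symmetrize δ-bip

        ⟪ε⟫ : ∀ {f} → Symmetric f → ⟪ ε , f ⟫ ≡ f 0 0 ℤ.+ f 0 0
        ⟪ε⟫ {f} S = begin
          ⟪ ε , f ⟫                     ≡⟨ ⟪⟫-comm ε f ⟩
          ⟪ f , ε ⟫                     ≡⟨ ⟪⟫-⊕ f δ (F δ) ⟩
          ⟪ f , δ ⟫ ℤ.+ ⟪ f , F δ ⟫     ≡⟨ cong₂ ℤ._+_ (⟪⟫-comm f δ) (≡.trans (⟪⟫-comm f (F δ)) (F-⟪⟫ δ-bip S)) ⟩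
          ⟪ δ , f ⟫ ℤ.+ ⟪ δ , f ⟫       ≡⟨ cong₂ ℤ._+_ (⟪δ⟫ f) (⟪δ⟫ f) ⟩
          f 0 0 ℤ.+ f 0 0               ∎
          where open ≡-Reasoning

        -- Translation brings the arc `(i , v)` to the base point, commutes with `M`, and
        -- self-adjointness transfers `M` to `ε`.
        M-value : ∀ rs {y} → Symmetric y → ∀ i v → M rs y i v ℤ.+ M rs y i v ≡ ⟪ M rs ε , L i v y ⟫
        M-value rs {y} S i v = begin
          M rs y i v ℤ.+ M rs y i v                        ≡⟨ cong (λ z → z ℤ.+ z) (cong₂ (M rs y) (ℕ.+-identityʳ i) (≡.trans (cong (λ z → v + z) (ℕ.*-zeroʳ (s i))) (ℕ.+-identityʳ v))) ⟨
          L i v (M rs y) 0 0 ℤ.+ L i v (M rs y) 0 0        ≡⟨ ⟪ε⟫ (L-sym i v (M-sym rs S)) ⟨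
          ⟪ ε , L i v (M rs y) ⟫                           ≡⟨ ⟪⟫-congʳ ε (M-L rs i v y) ⟨
          ⟪ ε , M rs (L i v y) ⟫                           ≡⟨ M-adjoint rs ε-sym (L-sym i v S) ⟨
          ⟪ M rs ε , L i v y ⟫                             ∎
          where open ≡-Reasoning

        autocorrelation : Arc → Arc
        autocorrelation y j u = ∑∑ λ i v → y i v ℤ.* y (i + j) (v + s i * u)

        module _ {y : Arc} (B : Biperiodic y) (j u : ℕ) where

          y′ : Arc
          y′ i v = y (i + j) (v + s i * u)

          y′-norm : ⟪ y′ , y′ ⟫ ≡ ⟪ y , y ⟫
          y′-norm = ∑∑-shift (·-bip B B) j (λ i → s i * u)

          -- Cauchy-Schwarz for two vectors of equal norm: expand the squared norm of `y ⊖ y′`, and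
          -- of `y ⊕ y′` for the opposite sign.
          autocorrelation-≤ : autocorrelation y j u ℤ.≤ ⟪ y , y ⟫
          autocorrelation-≤ = ℤₚ.0≤i-j⇒j≤i (ℤₚ.*-cancelˡ-≤-pos 0ℤ _ (+ 2) (ℤₚ.≤-trans (⟪⟫-nonneg (y ⊖ y′)) (ℤₚ.≤-reflexive (begin
            ⟪ y ⊖ y′ , y ⊖ y′ ⟫                                     ≡⟨ ⟪⟫-⊖ (y ⊖ y′) y y′ ⟩
            ⟪ y ⊖ y′ , y ⟫ ℤ.- ⟪ y ⊖ y′ , y′ ⟫                      ≡⟨ cong₂ ℤ._-_ (≡.trans (⟪⟫-comm _ y) (⟪⟫-⊖ y y y′)) (≡.trans (⟪⟫-comm _ y′) (⟪⟫-⊖ y′ y y′)) ⟩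
            (⟪ y , y ⟫ ℤ.- ⟪ y , y′ ⟫) ℤ.- (⟪ y′ , y ⟫ ℤ.- ⟪ y′ , y′ ⟫) ≡⟨ cong₂ (λ a b → (⟪ y , y ⟫ ℤ.- ⟪ y , y′ ⟫) ℤ.- (a ℤ.- b)) (⟪⟫-comm y′ y) y′-norm ⟩
            (⟪ y , y ⟫ ℤ.- ⟪ y , y′ ⟫) ℤ.- (⟪ y , y′ ⟫ ℤ.- ⟪ y , y ⟫) ≡⟨ lemma ⟪ y , y ⟫ ⟪ y , y′ ⟫ ⟩
            + 2 ℤ.* (⟪ y , y ⟫ ℤ.- ⟪ y , y′ ⟫)                       ∎))))
            where
            open ≡-Reasoning
            lemma : ∀ a b → (a ℤ.- b) ℤ.- (b ℤ.- a) ≡ + 2 ℤ.* (a ℤ.- b)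
            lemma = solve-∀

          autocorrelation-≥ : ℤ.- autocorrelation y j u ℤ.≤ ⟪ y , y ⟫
          autocorrelation-≥ = ℤₚ.0≤i-j⇒j≤i (ℤₚ.*-cancelˡ-≤-pos 0ℤ _ (+ 2) (ℤₚ.≤-trans (⟪⟫-nonneg (y ⊕ y′)) (ℤₚ.≤-reflexive (begin
            ⟪ y ⊕ y′ , y ⊕ y′ ⟫                                     ≡⟨ ⟪⟫-⊕ (y ⊕ y′) y y′ ⟩
            ⟪ y ⊕ y′ , y ⟫ ℤ.+ ⟪ y ⊕ y′ , y′ ⟫                      ≡⟨ cong₂ ℤ._+_ (≡.trans (⟪⟫-comm _ y) (⟪⟫-⊕ y y y′)) (≡.trans (⟪⟫-comm _ y′) (⟪⟫-⊕ y′ y y′)) ⟩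
            (⟪ y , y ⟫ ℤ.+ ⟪ y , y′ ⟫) ℤ.+ (⟪ y′ , y ⟫ ℤ.+ ⟪ y′ , y′ ⟫) ≡⟨ cong₂ (λ a b → (⟪ y , y ⟫ ℤ.+ ⟪ y , y′ ⟫) ℤ.+ (a ℤ.+ b)) (⟪⟫-comm y′ y) y′-norm ⟩
            (⟪ y , y ⟫ ℤ.+ ⟪ y , y′ ⟫) ℤ.+ (⟪ y , y′ ⟫ ℤ.+ ⟪ y , y ⟫) ≡⟨ lemma ⟪ y , y ⟫ ⟪ y , y′ ⟫ ⟩
            + 2 ℤ.* (⟪ y , y ⟫ ℤ.- ℤ.- ⟪ y , y′ ⟫)                   ∎))))
            where
            open ≡-Reasoning
            lemma : ∀ a b → (a ℤ.+ b) ℤ.+ (b ℤ.+ a) ≡ + 2 ℤ.* (a ℤ.- ℤ.- b)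
            lemma = solve-∀

        -- The arc `(i + j , v + s i * u)` is the group product of `(i , v)` and `(j , u)`; fixing
        -- `(j , u)` and summing over `(i , v)` leaves an autocorrelation.
        convolve : ∀ E y → ⟪ y , (λ i v → ⟪ E , L i v y ⟫) ⟫ ≡ ⟪ E , autocorrelation y ⟫
        convolve E y = begin
          ∑∑ (λ i v → y i v ℤ.* ∑∑ (E · L i v y))
            ≡⟨ ∑∑-cong (λ i v → sym (∑∑-⊙ (y i v) (E · L i v y))) ⟩
          ∑∑ (λ i v → ∑ m λ j → ∑ n λ u → y i v ℤ.* (E j u ℤ.* y (i + j) (v + s i * u)))
            ≡⟨ ∑-∑∑ m (λ j i v → ∑ n λ u → y i v ℤ.* (E j u ℤ.* y (i + j) (v + s i * u))) ⟨
          ∑ m (λ j → ∑∑ λ i v → ∑ n λ u → y i v ℤ.* (E j u ℤ.* y (i + j) (v + s i * u)))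
            ≡⟨ ∑-cong m (λ j → ∑-∑∑ n (λ u i v → y i v ℤ.* (E j u ℤ.* y (i + j) (v + s i * u)))) ⟨
          ∑∑ (λ j u → ∑∑ λ i v → y i v ℤ.* (E j u ℤ.* y (i + j) (v + s i * u)))
            ≡⟨ ∑∑-cong (λ j u → ≡.trans (∑∑-cong λ i v → lemma (y i v) (E j u) _) (∑∑-⊙ (E j u) _)) ⟩
          ∑∑ (λ j u → E j u ℤ.* autocorrelation y j u) ∎
          where
          open ≡-Reasoning
          lemma : ∀ a b c → a ℤ.* (b ℤ.* c) ≡ b ℤ.* (a ℤ.* c)
          lemma = solve-∀

        module _ {x : Arc} (S : Symmetric x) (form : ⟪ x , C x ⟫ ≡ ℤ.- (+ e) ℤ.* ⟪ x , x ⟫)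
                 (rs : List ℕ) (c≥0 : NonNegative-c (+ (a + 2 * e)) rs)
                 (E κ : Arc) (κ-fibral : Fibral κ)
                 (M-ε : ∀ j u → j < m → u < n → M rs ε j u ≡ E j u ℤ.+ κ j u)
                 (small : ∑∑ (λ j u → + ℤ.∣ E j u ∣) ℤ.< c (+ (a + 2 * e)) rs ℤ.+ c (+ (a + 2 * e)) rs) where

          open Deviation S

          N c* : ℤ
          N = ⟪ y , y ⟫
          c* = c (+ (a + 2 * e)) rs

          lower : c* ℤ.* N ℤ.≤ ⟪ y , M rs y ⟫
          lower = M-lower (+ (a + 2 * e)) y-sym (begin
            + (a + 2 * e) ℤ.* N
              ≡⟨ cong (ℤ._* N) (≡.trans (ℤₚ.pos-+ a (2 * e)) (cong (ℤ._+_ (+ a)) (ℤₚ.pos-* 2 e))) ⟩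
            (+ a ℤ.+ + 2 ℤ.* + e) ℤ.* N
              ≡⟨ lemma (+ a) (+ e) N ⟪ y , C y ⟫ ⟩
            (Q ℤ.+ Q) ℤ.+ (+ a ℤ.* N ℤ.- (⟪ y , C y ⟫ ℤ.+ ⟪ y , C y ⟫))
              ≤⟨ ℤₚ.+-monoˡ-≤ _ (ℤₚ.+-mono-≤ (y-form form) (y-form form)) ⟩
            0ℤ ℤ.+ (+ a ℤ.* N ℤ.- (⟪ y , C y ⟫ ℤ.+ ⟪ y , C y ⟫))
              ≡⟨ ℤₚ.+-identityˡ _ ⟩
            + a ℤ.* N ℤ.- (⟪ y , C y ⟫ ℤ.+ ⟪ y , C y ⟫)
              ≡⟨ ⟪⟫-M[] y-sym y-sym ⟨
            ⟪ y , M [] y ⟫ ∎) rs c≥0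
            where
            open ℤₚ.≤-Reasoning
            Q : ℤ
            Q = ⟪ y , C y ⟫ ℤ.+ + e ℤ.* N
            lemma : ∀ a e N k → (a ℤ.+ + 2 ℤ.* e) ℤ.* N ≡ ((k ℤ.+ e ℤ.* N) ℤ.+ (k ℤ.+ e ℤ.* N)) ℤ.+ (a ℤ.* N ℤ.- (k ℤ.+ k))
            lemma = solve-∀

          -- A fibre-constant part of the kernel may be discarded, since every translate of `y` is
          -- orthogonal to it.
          kernel-mod-κ : ∀ i v → M rs y i v ℤ.+ M rs y i v ≡ ⟪ E , L i v y ⟫
          kernel-mod-κ i v = begin
            M rs y i v ℤ.+ M rs y i v               ≡⟨ M-value rs y-sym i v ⟩
            ⟪ M rs ε , Ly ⟫                         ≡⟨ ∑-cong< m (λ j j<m → ∑-cong< n λ u u<n → cong (ℤ._* Ly j u) (M-ε j u j<m u<n)) ⟩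
            ⟪ E ⊕ κ , Ly ⟫                          ≡⟨ ≡.trans (⟪⟫-comm (E ⊕ κ) Ly) (⟪⟫-⊕ Ly E κ) ⟩
            ⟪ Ly , E ⟫ ℤ.+ ⟪ Ly , κ ⟫               ≡⟨ cong₂ ℤ._+_ (⟪⟫-comm Ly E) (≡.trans (⟪⟫-comm Ly κ) (Ly-orthogonal κ-fibral i v)) ⟩
            ⟪ E , Ly ⟫ ℤ.+ 0ℤ                       ≡⟨ ℤₚ.+-identityʳ ⟪ E , Ly ⟫ ⟩
            ⟪ E , Ly ⟫                              ∎
            where
            open ≡-Reasoning
            Ly : Arc
            Ly = L i v y

          upper : ⟪ y , M rs y ⟫ ℤ.+ ⟪ y , M rs y ⟫ ℤ.≤ ∑∑ (λ j u → + ℤ.∣ E j u ∣) ℤ.* N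
          upper = begin
            ⟪ y , M rs y ⟫ ℤ.+ ⟪ y , M rs y ⟫                  ≡⟨ ⟪⟫-⊕ y (M rs y) (M rs y) ⟨
            ⟪ y , M rs y ⊕ M rs y ⟫                            ≡⟨ ⟪⟫-congʳ y kernel-mod-κ ⟩
            ⟪ y , (λ i v → ⟪ E , L i v y ⟫) ⟫                  ≡⟨ convolve E y ⟩
            ∑∑ (λ j u → E j u ℤ.* autocorrelation y j u)       ≤⟨ ∑-mono m (λ j → ∑-mono n λ u → *-≤-∣∣ (E j u) (autocorrelation-≤ (bip y-sym) j u) (autocorrelation-≥ (bip y-sym) j u)) ⟩
            ∑∑ (λ j u → + ℤ.∣ E j u ∣ ℤ.* N)                   ≡⟨ ∑∑-cong (λ j u → ℤₚ.*-comm _ N) ⟩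
            ∑∑ (N ⊙ λ j u → + ℤ.∣ E j u ∣)                     ≡⟨ ∑∑-⊙ N (λ j u → + ℤ.∣ E j u ∣) ⟩
            N ℤ.* ∑∑ (λ j u → + ℤ.∣ E j u ∣)                   ≡⟨ ℤₚ.*-comm N _ ⟩
            ∑∑ (λ j u → + ℤ.∣ E j u ∣) ℤ.* N                   ∎
            where open ℤₚ.≤-Reasoning

          squeeze : ∀ {c s N} → s ℤ.< c ℤ.+ c → 0ℤ ℤ.≤ N → (c ℤ.+ c) ℤ.* N ℤ.≤ s ℤ.* N → N ≡ 0ℤ
          squeeze {N = + zero}  _   _ _  = ≡.refl
          squeeze {c} {s} {N = + suc k} s<c _ le = ⊥-elim (ℤₚ.<⇒≱ s<c (ℤₚ.*-cancelʳ-≤-pos (c ℤ.+ c) s (+ suc k) le))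
          squeeze {N = ℤ.-[1+ k ]} _ () _

          -- The two bounds give 2c⟪ y , y ⟫ ≤ ‖E‖₁⟪ y , y ⟫, while ‖E‖₁ < 2c.
          fibral : Fibral x
          fibral = fibral-if-null (squeeze {c*} small (⟪⟫-nonneg y) (ℤₚ.≤-trans
            (ℤₚ.≤-reflexive (ℤₚ.*-distribʳ-+ N c* c*)) (ℤₚ.≤-trans (ℤₚ.+-mono-≤ lower lower) upper)))

      -- Fibre-constancy from the computed kernel.

      module Certificate (a B : ℕ) .{{a≢0 : NonZero a}} .{{B≢0 : NonZero B}} (rs : List ℕ) (κ : ℕ → ℕ → ℕ)
                         (κ-per₄ : ∀ j u → κ (j + 4) u ≡ κ j u) (κ-per₅ : ∀ j u → κ j (u + 5) ≡ κ j u) where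

        open Chain a
        open Kernel a
        open Evaluator n m h g Δ a B
        open Representation a B

        δ-rep : Rep 1 δ (applyUpTo (λ j → [ j % m ≡0]) m)
        δ-rep .digit j w = [ j % m ≡0] * [ w % n ≡0]
        δ-rep .offset = 0ℤ
        δ-rep .value j w = ℤₚ.+-identityʳ _
        δ-rep .small j w = ℕ.*-mono-≤ ([≡0]≤1 (j % m)) ([≡0]≤1 (w % n))
        δ-rep .packed = applyUpTo-cong (λ j → sym (≡.trans (pack-* B n [ j % m ≡0] _)
          (≡.trans (cong ([ j % m ≡0] *_) (pack-indicator B n)) (ℕ.*-identityʳ _)))) m

        certified : bound rs 2 < B → NonNegative-c (+ (a + 2 * e)) rs →
                    + evaluate κ rs ℤ.< c (+ (a + 2 * e)) rs ℤ.+ c (+ (a + 2 * e)) rs →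
                    ∀ {x} → Symmetric x → ⟪ x , C x ⟫ ≡ ℤ.- (+ e) ℤ.* ⟪ x , x ⟫ → Fibral x
        certified b<B c≥0 small-deviation S form = fibral S form rs c≥0
          -- The offset of the digits is a constant, hence fibre-constant: it goes into the
          -- discarded part, so `κ` can be compared with the raw digits.
          (λ j u → + digit R j u ℤ.- + κ j u) (λ j u → + κ j u ℤ.- offset R)
          (record { per₄ = λ j u → cong (λ z → + z ℤ.- offset R) (κ-per₄ j u) ; per₅ = λ j u → cong (λ z → + z ℤ.- offset R) (κ-per₅ j u) })
          (λ j u _ _ → ≡.trans (add-sub (M rs ε j u) (offset R) (+ κ j u)) (cong (λ z → z ℤ.- + κ j u ℤ.+ (+ κ j u ℤ.- offset R)) (value R j u)))
          (ℤₚ.≤-<-trans (ℤₚ.≤-reflexive total) small-deviation)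
          where
          1<B : 1 < B
          1<B = ℕ.≤-<-trans (ℕ.≤-trans (s≤s z≤n) (bound-≥ rs 2)) b<B
          R : Rep (bound rs 2) (M rs ε) (Mᴾ powers ones rs 2 (εᴾ powers))
          R = M-rep rs b<B ε-sym (sum-rep δ-rep (F-rep 1<B δ-bip δ-rep))
          add-sub : ∀ x o k → x ≡ x ℤ.+ o ℤ.- k ℤ.+ (k ℤ.- o)
          add-sub = solve-∀
          total : ∑∑ (λ j u → + ℤ.∣ + digit R j u ℤ.- + κ j u ∣) ≡ + evaluate κ rs
          total = sym (≡.trans (cong (λ Ps → + deviations κ 0 Ps) (packed R))
            (deviations-sum κ m 0 (digit R) (λ j u → ℕ.≤-<-trans (small R j u) b<B)))

      -- From fibre-constant colourings to a finite search.

      module Arrowing (σ τ : ℕ → ℕ) (|Δ|≡3e : length Δ ≡ 3 * e) (σ-perm : map σ Δ ↭ Δ) (τ-perm : map τ Δ ↭ Δ)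
                      (a B : ℕ) .{{a≢0 : NonZero a}} .{{B≢0 : NonZero B}} (rs : List ℕ) (κ : ℕ → ℕ → ℕ)
                      (κ-per₄ : ∀ j u → κ (j + 4) u ≡ κ j u) (κ-per₅ : ∀ j u → κ j (u + 5) ≡ κ j u)
                      (residues : List ℕ) (residues≡ : residues ≡ applyUpTo (λ j → g ^ j % n) m)
                      (W : List ℕ) (V : ℕ) (n<V : n < V) where

        open Good σ τ e |Δ|≡3e σ-perm τ-perm
        open Graph residues residues≡ W V n<V
        open Chain a using (c; NonNegative-c)
        open Evaluator n m h g Δ a B using (bound; evaluate)
        open Certificate a B rs κ κ-per₄ κ-per₅ using (certified)

        -- Variables of the final search: r + 5 p with p ≤ r stands for the colour of the arcs between the classes
        -- p and r modulo 5, and 25 + a for the colour of the edge from a to the additional vertex n.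
        code : ℕ → ℕ → ℕ
        code a b = if b ≡ᵇ n then 25 + a else ((a % 5) ⊔ (b % 5)) + 5 * ((a % 5) ⊓ (b % 5))

        codes : ℕ × ℕ × ℕ → ℕ × ℕ × ℕ
        codes (a , b , c) = code a b , code a c , code b c

        triangle : ℕ × ℕ × ℕ → Bool
        triangle (a , b , c) = ((a <ᵇ n) ∧ (b <ᵇ n) ∧ (c <ᵇ suc n)) ∧ (edge a b ∧ edge a c ∧ edge b c)

        module _ (loopless : any (λ a → edge a a) (upTo V) ≡ false)
                 (corners : All Corner Δ)
                 (bounded : bound rs 2 < B) (c≥0 : NonNegative-c (+ (a + 2 * e)) rs)
                 (small-deviation : + evaluate κ rs ℤ.< c (+ (a + 2 * e)) rs ℤ.+ c (+ (a + 2 * e)) rs)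
                 (dir : ℕ → ℕ → ℕ)
                 (dir-correct : ∀ {p} → p < 5 → ∀ {r} → r < 4 → dir p ((p + g ^ r) % 5) ≡ r)
                 (triangles : List (ℕ × ℕ × ℕ)) (are-triangles : any (not ∘ triangle) triangles ≡ false)
                 (order : List ℕ) (refuted : refute (map codes triangles) order [] ≡ true) where

          module _ (χ : EdgeColouring (G loopless)) (no-mono : ¬ MonoTriangle χ) where

            col : ℕ → ℕ → Bool
            col a b = colour χ (vertex a) (vertex b)

            toℕ-vertex : ∀ {a} → a < V → toℕ (vertex a) ≡ a
            toℕ-vertex {a} a<V = ≡.trans (toℕ-fromℕ< _) (m<n⇒m%n≡m {{>-nonZero (ℕ.≤-trans (s≤s z≤n) n<V)}} a<V)

            adjacent : ∀ {a b} → a < V → b < V → T (edge a b) → Adj (G loopless) (vertex a) (vertex b)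
            adjacent a<V b<V e = ≡.trans (cong₂ edge (toℕ-vertex a<V) (toℕ-vertex b<V)) (Equivalence.to T-≡ e)

            not-mono : ∀ {a b c} → a < V → b < V → c < V → T (edge a b) → T (edge a c) → T (edge b c) →
                       ¬ (col a b ≡ col a c × col a b ≡ col b c)
            not-mono {a} {b} {c} a<V b<V c<V ab ac bc (p , r) = no-mono
              (vertex a , vertex b , vertex c , adjacent a<V b<V ab , adjacent a<V c<V ac , adjacent b<V c<V bc , p , r)

            arcColour : ℕ → ℕ → Bool
            arcColour i v = col (v % n) ((v + s i) % n)

            x : Arc
            x i v = sgn (arcColour i v)

            <n⇒<V : ∀ {a} → a < n → a < V
            <n⇒<V a<n = ℕ.<-trans a<n n<V

            arc-edge : ∀ i v → T (edge (v % n) ((v + s i) % n))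
            arc-edge i v = edge-of-Arrow (m%n<n v n) (m%n<n _ n) (i , +-%ˡ v (s i))

            x-sym : Symmetric x
            x-sym .bip .perᵢ i v = cong (λ u → sgn (col (v % n) u)) (ℤₚ.+-injective (full-turn mod-bip 0 v i))
            x-sym .bip .perᵥ i v = cong₂ (λ u u′ → sgn (col u u′)) (ℤₚ.+-injective (perᵥ mod-bip 0 v))
              (≡.trans (cong (_% n) (lemma v n (s i))) (ℤₚ.+-injective (perᵥ mod-bip 0 (v + s i))))
              where
              lemma : ∀ a b c → a + b + c ≡ a + c + b
              lemma = ℕSolver.solve-∀
            x-sym .flip i v = cong sgn (≡.trans (cong (col ((v + s i) % n)) (ℤₚ.+-injective (opposite mod-bip 0 v i)))
              (colour-sym χ (vertex ((v + s i) % n)) (vertex (v % n))))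

            x-nae : ∀ {p} → Corner p → ∀ i v →
                    x i v ℤ.* x (i + p) v ℤ.+ (x i v ℤ.* x (i + h + σ p) (v + s i) ℤ.+ x (i + p) v ℤ.* x (i + h + σ p) (v + s i)) ≡ ℤ.-1ℤ
            x-nae {p} corner i v = sgn-nae (arcColour i v) (arcColour (i + p) v) (arcColour (i + h + σ p) (v + s i))
              (λ (eq , eq′) → not-mono (lt (v % n) (m%n<n v n)) (lt _ (m%n<n (v + s i) n)) (lt _ (m%n<n (v + s (i + p)) n))
                (arc-edge i v) (arc-edge (i + p) v)
                (subst (T ∘ edge ((v + s i) % n)) third (arc-edge (i + h + σ p) (v + s i)))
                (eq , ≡.trans eq′ (cong (col ((v + s i) % n)) third)))
              where
              lt : ∀ a → a < n → a < V
              lt a = <n⇒<V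
              third : (v + s i + s (i + h + σ p)) % n ≡ (v + s (i + p)) % n
              third = ℤₚ.+-injective (third-vertex mod-bip corner 0 i v)

            x-fibral : Fibral x
            x-fibral = certified bounded c≥0 small-deviation x-sym (good-form x-sym corners (λ i v → sgn-square (arcColour i v)) x-nae)

            mod-5 : ∀ z j → (z + s j) % 5 ≡ (z % 5 + s (j % 4)) % 5
            mod-5 z j = ≡.trans (sym (period-% 5 (λ z → (z + s j) % 5) (λ z → shift-5 z (s j)) z))
              (sym (period-% 4 (λ j → (z % 5 + s j) % 5) step j))
              where
              shift-5 : ∀ z c → (z + 5 + c) % 5 ≡ (z + c) % 5
              shift-5 z c = ≡.trans (cong (_% 5) (lemma z c)) ([m+kn]%n≡m%n (z + c) 1 5)
                where
                lemma : ∀ z c → z + 5 + c ≡ z + c + 1 * 5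
                lemma = ℕSolver.solve-∀
              step : ∀ j → (z % 5 + s (j + 4)) % 5 ≡ (z % 5 + s j) % 5
              step j = ≡.trans (cong (λ c → (z % 5 + c) % 5) (≡.trans (s-+ j 4) (cong (s j *_) g⁴)))
                (≡.trans (cong (_% 5) (lemma (z % 5) (s j) w)) ([m+kn]%n≡m%n (z % 5 + s j) (s j * w) 5))
                where
                lemma : ∀ z c w → z + c * (1 + 5 * w) ≡ z + c + c * w * 5
                lemma = ℕSolver.solve-∀

            -- Fibre-constancy reduces the exponent modulo 4 and the tail modulo 5; `dir` recovers
            -- the reduced exponent from the residues of the two end points.
            fibre-colour : ∀ {a b} → a < n → Arrow a b → col a b ≡ arcColour (dir (a % 5) (b % 5)) (a % 5)
            fibre-colour {a} {b} a<n (j , eq) = begin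
              col a b                                        ≡⟨ cong₂ col (m<n⇒m%n≡m a<n) eq ⟨
              arcColour j a                                  ≡⟨ sgn-injective (period-% 4 (λ j → x j a) (λ j → per₄ x-fibral j a) j) ⟨
              arcColour (j % 4) a                            ≡⟨ sgn-injective (period-% 5 (x (j % 4)) (per₅ x-fibral (j % 4)) a) ⟨
              arcColour (j % 4) (a % 5)                      ≡⟨ cong (λ i → arcColour i (a % 5)) dir≡ ⟨
              arcColour (dir (a % 5) (b % 5)) (a % 5)        ∎
              where
              open ≡-Reasoning
              b%5 : b % 5 ≡ (a % 5 + s (j % 4)) % 5
              b%5 = ≡.trans (cong (_% 5) (sym eq)) (≡.trans (m∣n⇒o%n%m≡o%m 5 n (a + s j) (divides nf n≡)) (mod-5 a j))
              dir≡ : dir (a % 5) (b % 5) ≡ j % 4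
              dir≡ = ≡.trans (cong (dir (a % 5)) b%5) (dir-correct (m%n<n a 5) (m%n<n j 4))

            α : ℕ → Bool
            α k = if k <ᵇ 25 then arcColour (dir (k / 5) (k % 5)) (k / 5) else col (k ∸ 25) n

            α-fibre : ∀ p r → p < 5 → r < 5 → α (r + 5 * p) ≡ arcColour (dir p r) p
            α-fibre p r p<5 r<5 with r + 5 * p <ᵇ 25 in eq
            ... | true  = cong₂ (λ k l → arcColour (dir k l) k) (proj₁ (divMod-unique 5 r p r<5)) (proj₂ (divMod-unique 5 r p r<5))
            ... | false = ⊥-elim (subst T eq (ℕ.<⇒<ᵇ (ℕ.≤-trans (ℕ.+-monoˡ-≤ (5 * p) r<5) (ℕ.≤-trans (ℕ.≤-reflexive (sym (ℕ.*-suc 5 p))) (ℕ.*-monoʳ-≤ 5 p<5)))))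

            -- A code names the smaller class first; in the other order the arc is reversed before
            -- the colour of its fibre is read off.
            code-colour : ∀ {a b} → a < n → T (edge a b) → col a b ≡ α (code a b)
            code-colour {a} {b} a<n ab = by-cases (b ≡ᵇ n) ≡.refl
              where
              p r : ℕ
              p = a % 5
              r = b % 5
              by-cases : ∀ t → (b ≡ᵇ n) ≡ t → col a b ≡ α (if t then 25 + a else (p ⊔ r) + 5 * (p ⊓ r))
              by-cases true  b≡n = cong (col a) (ℕ.≡ᵇ⇒≡ b n (Equivalence.from T-≡ b≡n))
              by-cases false b≢n with edge-below-n (ℕ.<⇒≢ a<n) (λ eq → subst T b≢n (ℕ.≡⇒≡ᵇ b n eq)) ab | ℕ.≤-total p r
              ... | _ , b<n , a→b | inj₁ p≤r = ≡.trans (fibre-colour a<n a→b) (sym (≡.trans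
                (cong₂ (λ k l → α (k + 5 * l)) (ℕ.m≤n⇒m⊔n≡n p≤r) (ℕ.m≤n⇒m⊓n≡m p≤r)) (α-fibre p r (m%n<n a 5) (m%n<n b 5))))
              ... | _ , b<n , a→b | inj₂ p≥r = ≡.trans (colour-sym χ (vertex a) (vertex b)) (≡.trans (fibre-colour b<n (Arrow-sym a<n a→b)) (sym (≡.trans
                (cong₂ (λ k l → α (k + 5 * l)) (ℕ.m≥n⇒m⊔n≡m p≥r) (ℕ.m≥n⇒m⊓n≡n p≥r)) (α-fibre r p (m%n<n b 5) (m%n<n a 5)))))

            contradictory : ⊥
            contradictory with find (map⁻ (refute-sound α (map codes triangles) order [] (Equivalence.from T-≡ refuted)))
            ... | (a , b , c) , t∈ , (eq , eq′) with triangle (a , b , c) in is-triangle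
            ... | false = none (not ∘ triangle) are-triangles t∈ (subst (T ∘ not) (sym is-triangle) tt)
            ... | true with ∧-elim (Equivalence.from T-≡ is-triangle)
            ... | bounds , edges with ∧-elim bounds | ∧-elim edges
            ... | a<ᵇn , bc-bounds | ab , edges′ with ∧-elim bc-bounds | ∧-elim edges′
            ... | b<ᵇn , c<ᵇ1+n | ac , bc = not-mono (<n⇒<V a<n) (<n⇒<V b<n) (ℕ.<-≤-trans (ℕ.<ᵇ⇒< c (suc n) c<ᵇ1+n) n<V) ab ac bc
              ( ≡.trans (code-colour a<n ab) (≡.trans eq (sym (code-colour a<n ac)))
              , ≡.trans (code-colour a<n ab) (≡.trans eq′ (sym (code-colour b<n bc))))
              where
              a<n = ℕ.<ᵇ⇒< a n a<ᵇn
              b<n = ℕ.<ᵇ⇒< b n b<ᵇn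

          -- The argument by eigenvalues refutes only the absence of a monochromatic triangle;
          -- decidability on a finite graph turns this into a witness.
          arrows : Arrows33 (G loopless)
          arrows χ = decidable-stable (monoTriangle? χ) (contradictory χ)

          folkman : any (λ b → any (λ c → arc b c ∧ any (λ d → arc b d ∧ arc c d) W) W) W ≡ false → All (_< n) W →
                    any (λ c → any (λ d → arc c d) commonNeighbours) commonNeighbours ≡ false →
                    Σ (SimpleGraph V) λ G → K4Free G × Arrows33 G
          folkman W-triangle-free W<n independent = G loopless , K₄-free loopless W-triangle-free W<n independent , arrows

-- The instance with modulus 785 and generator 53, and its certificates.

-- The exponents p for which both 53ᵖ and 53ᵖ - 1 are powers of 53 modulo 785.
Δ₀ : List ℕ
Δ₀ = 2 ∷ 3 ∷ 10 ∷ 17 ∷ 23 ∷ 41 ∷ 53 ∷ 54 ∷ 65 ∷ 69 ∷ 78 ∷ 87 ∷ 91 ∷ 102 ∷ 103 ∷ 115 ∷ 133 ∷ 139 ∷ 146 ∷ 153 ∷ 154 ∷ []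

residues : List ℕ
residues = iterate (λ r → r * 53 % 785) 1 156

position : ℕ → List ℕ → ℕ
position a []       = 0
position a (r ∷ rs) = if r ≡ᵇ a then 0 else suc (position a rs)

-- `position` acts as the discrete logarithm to base 53. In `τ`, adding 78 is a change of sign and
-- adding `156 ∸ p` a division by t = 53ᵖ, as 1 - 1/t = -(1 - t)/t.
σ τ : ℕ → ℕ
σ p = position ((786 ∸ 53 ^ p % 785) % 785) residues
τ p = (σ p + 78 + (156 ∸ p)) % 156

permutes : ∀ {xs ys : List ℕ} → sort xs ≡ ys → xs ↭ ys
permutes {xs} eq = ↭-trans (↭-sym (sort-↭ xs)) (↭-reflexive eq)

-- Each r is about half the square of the spectral radius of the previous operator off the fibre-constant
-- functions, so that the iteration behaves like a Chebyshev recursion.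
rs : List ℕ
rs = 75400000000000000000000000000000 ∷ 12280000000000000 ∷ 156700000 ∷ 17700 ∷ 188 ∷ []

-- Rounded fibre means of the digits of the kernel: α, β and γ belong to the arcs that share two, one and
-- no end points modulo 5 with the arc from 0 to 1.
entry : ℕ → ℕ → ℕ
entry j u = lookupOr 0 (lookupOr [] rows j) u
  where
  lookupOr : ∀ {A : Set} → A → List A → ℕ → A
  lookupOr d []       _       = d
  lookupOr d (x ∷ xs) zero    = x
  lookupOr d (x ∷ xs) (suc k) = lookupOr d xs k
  α β γ : ℕ
  -- The common leading digits come mostly from the offset collected by the complements, about half
  -- the digit bound; the differences show the fibre-constant part of the kernel.
  α = 2262889310321931561320211157000000000000000000000000000
  β = 2262889310321931561320199268000000000000000000000000000
  γ = 2262889310321931561320205214000000000000000000000000000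
  rows : List (List ℕ)
  rows = (α ∷ β ∷ γ ∷ γ ∷ β ∷ []) ∷ (β ∷ β ∷ β ∷ β ∷ γ ∷ []) ∷ (β ∷ α ∷ β ∷ γ ∷ γ ∷ []) ∷ (β ∷ β ∷ γ ∷ β ∷ β ∷ []) ∷ []

κ : ℕ → ℕ → ℕ
κ j u = entry (j % 4) (u % 5)

κ-per₄ : ∀ j u → κ (j + 4) u ≡ κ j u
κ-per₄ j u = cong (λ r → entry r (u % 5)) ([m+kn]%n≡m%n j 1 4)

κ-per₅ : ∀ j u → κ j (u + 5) ≡ κ j u
κ-per₅ j u = cong (entry (j % 4)) ([m+kn]%n≡m%n u 1 5)

-- A power of ten above `bound rs 2`, which is about 4.5 · 10⁵⁴: the growth factor of M₀ is 48 = 6 +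
-- 2 · 21, and each level squares the factor and adds r.
B : ℕ
B = 10000000000000000000000000000000000000000000000000000000

-- The discrete logarithm of r - p to the base 53 ≡ 3 modulo 5.
dir : ℕ → ℕ → ℕ
dir p r with (r + 5 ∸ p) % 5
... | 1 = 0
... | 3 = 1
... | 4 = 2
... | _ = 3

-- Found by computer search.
W : List ℕ
W = 16 ∷ 130 ∷ 195 ∷ 233 ∷ 356 ∷ 376 ∷ 468 ∷ 472 ∷ 519 ∷ 534 ∷ 535 ∷ 572 ∷ []

-- One triangle of L over each triangle of K₅, and all triangles through the additional vertex 785.
triangles : List (ℕ × ℕ × ℕ)
triangles =
  (0 , 1 , 2) ∷ (0 , 1 , 23) ∷ (0 , 1 , 64) ∷ (0 , 2 , 83) ∷ (0 , 2 , 4) ∷ (0 , 8 , 4) ∷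
  (1 , 2 , 3) ∷ (1 , 2 , 24) ∷ (1 , 3 , 84) ∷ (2 , 3 , 4) ∷
  (16 , 233 , 785) ∷ (16 , 535 , 785) ∷ (130 , 376 , 785) ∷ (130 , 472 , 785) ∷ (130 , 534 , 785) ∷ (195 , 468 , 785) ∷
  (195 , 519 , 785) ∷ (195 , 534 , 785) ∷ (233 , 356 , 785) ∷ (233 , 472 , 785) ∷ (233 , 534 , 785) ∷ (233 , 572 , 785) ∷
  (356 , 519 , 785) ∷ (376 , 468 , 785) ∷ (376 , 572 , 785) ∷ (468 , 472 , 785) ∷ (472 , 535 , 785) ∷ (519 , 535 , 785) ∷
  (519 , 572 , 785) ∷ (534 , 535 , 785) ∷ []

-- The ten pairs of classes come first, which leaves the twelve splittings of K₅ into two 5-cycles;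
-- the edges from `W` to 785 follow, with code 25 + a.
order : List ℕ
order = 1 ∷ 2 ∷ 3 ∷ 4 ∷ 7 ∷ 8 ∷ 9 ∷ 13 ∷ 14 ∷ 19 ∷ 258 ∷ 497 ∷ 559 ∷ 560 ∷ 41 ∷ 155 ∷ 401 ∷ 493 ∷ 597 ∷ 544 ∷ 220 ∷ 381 ∷ []

n<V : 785 < 860
n<V = ℕ.<ᵇ⇒< 785 860 tt

theorem2 : Σ (SimpleGraph 860) λ G → K4Free G × Arrows33 G
theorem2 = Arcs.Local.Fibres.Arrowing.folkman
  785 156 78 53 ((1 + 53 ^ 78) / 785) ≡.refl ≡.refl
  Δ₀ (from-yes (All.all? (ℕ._≤? 156) Δ₀)) (permutes ≡.refl)
  -- 785 = 157 · 5, 156 = 39 · 4, 53⁴ = 1 + 5 · 1578096 and 53 · 237 = 1 + 16 · 785. The 21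
  -- exponents of `Δ₀` fall evenly, 7 each, into the classes 1, 2, 3 modulo 4.
  157 39 ≡.refl ≡.refl 1578096 ≡.refl 237 16 ≡.refl 7 (permutes ≡.refl)
  σ τ ≡.refl (permutes ≡.refl) (permutes ≡.refl)
  6 B rs κ κ-per₄ κ-per₅
  residues ≡.refl W 860 n<V
  ≡.refl
  (from-yes (All.all? (Arcs.Local.Good.corner? 785 156 78 53 ((1 + 53 ^ 78) / 785) ≡.refl ≡.refl
    Δ₀ (from-yes (All.all? (ℕ._≤? 156) Δ₀)) (permutes ≡.refl) σ τ 7 ≡.refl (permutes ≡.refl) (permutes ≡.refl)) Δ₀))
  (ℕ.<ᵇ⇒< _ _ tt)
  (ℤ.+≤+ z≤n , ℤ.+≤+ z≤n , ℤ.+≤+ z≤n , ℤ.+≤+ z≤n , ℤ.+≤+ z≤n , tt)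
  -- Here the kernel is actually evaluated, and its ℓ¹-distance from `κ` compared with 2c₅.
  (ℤ.+<+ (ℕ.<ᵇ⇒< _ _ tt))
  dir (from-yes (ℕ.allUpTo? (λ p → ℕ.allUpTo? (λ r → dir p ((p + 53 ^ r) % 5) ℕ.≟ r) 4) 5))
  triangles ≡.refl order ≡.refl
  ≡.refl (from-yes (All.all? (ℕ._<? 785) W)) ≡.refl
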